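{- Let $q$ be an odd prime power, $n\geq 3$ odd, $\xi$ a non-square in $\mathbb{F}_q$, $r$ an integer with $\gcd(n,r)=1$, $a\in\mathbb{F}_{q^n}^*$ with $N_q(a)\neq1$, and $A_{a,r}(x)=x^{q^r}-ax^{q^{n-r}}$. Consider the $\mathbb{F}_q$-linear set $$L_{\mathcal{D}_A}=\{\langle(x,y,A_{a,r}(y),\xi A_{a,r}(x))\rangle : x,y\in\mathbb{F}_{q^n},\ (x,y)\neq(0,0)\}\subset PG(3,q^n).$$ Then: (i) If $N_q(a)\neq-1$ and $n=3$, then $L_{\mathcal{D}_A}$ is a maximum scattered $\mathbb{F}_q$-linear set of $PG(3,q^3)$ of pseudoregulus type. (ii) If $N_q(a)\neq-1$ and $n>3$, then $L_{\mathcal{D}_A}$ is a maximum scattered $\mathbb{F}_q$-linear set of $PG(3,q^n)$, and the lines $X_1=X_2=0$ and $X_0=X_3=0$ are two long lines of it that are not of pseudoregulus type. (iii) If $N_q(a)=-1$, then the points of $L_{\mathcal{D}_A}$ of weight bigger than $1$ have weight $2$, there are $\frac{q^{n-1}-1}{q-1}$ of them, and $|L_{\mathcal{D}_A}|=\frac{q^{2n}-q^n}{q-1}+1$.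
   Context: $N_q$ denotes the norm from $\mathbb{F}_{q^n}$ to $\mathbb{F}_q$. For an $\mathbb{F}_q$-subspace $U$ of $V=\mathbb{F}_{q^n}^4$, $L_U=\{\langle\mathbf u\rangle:\mathbf u\in U\setminus\{0\}\}$ is an $\mathbb{F}_q$-linear set of rank $\dim_{\mathbb{F}_q}U$; the weight of a subspace $PG(W,\mathbb{F}_{q^n})$ in $L_U$ is $\dim_{\mathbb{F}_q}(W\cap U)$. $L_U$ is scattered if all its points have weight $1$, and maximum scattered in $PG(3,q^n)$ if moreover it has rank $2n$. For a scattered $L$, a long line is a line of weight $n$. A scattered $\mathbb{F}_q$-linear set $L$ of $PG(3,q^n)$ of rank $2n$ is of pseudoregulus type if there exist $q^n+1$ pairwise disjoint long lines of $L$ and exactly two lines disjoint from $L$ meeting each of these long lines. An $\mathbb{F}_q$-linear set of $PG(1,q^n)$ is of pseudoregulus type if it equals $\{\langle\lambda\mathbf w+\rho\lambda^\tau\mathbf v\rangle:\lambda\in\mathbb{F}_{q^n}^*\}$ for independent $\mathbf w,\mathbf v$, $\rho\in\mathbb{F}_{q^n}^*$ and an automorphism $\tau$ of $\mathbb{F}_{q^n}$ with fixed field $\mathbb{F}_q$; a line $r$ of $PG(3,q^n)$ is of pseudoregulus type (w.r.t. $L$) if $L\cap r$ is of pseudoregulus type as a linear set of $r$. -}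

module Defs where

open import Level using (0ℓ)
open import Data.Nat as ℕ using (ℕ; zero; suc; _^_; _≡ᵇ_)
open import Data.Nat.Primality using (Prime)
open import Data.Integer as ℤ using (ℤ; +_; -[1+_])
open import Data.Bool using (Bool; true; false; _∧_; not; T)
open import Data.List using (List; []; _∷_; length; filterᵇ; concatMap; map)
open import Data.Bool.ListAction using (any)
open import Data.List.Membership.Propositional using (_∈_)
open import Data.List.Relation.Unary.Unique.Propositional using (Unique)
open import Data.Product using (Σ; ∃; _×_; _,_)
open import Data.Sum using (_⊎_)
open import Data.Fin using (Fin)
open import Relation.Nullary using (¬_; does)
open import Relation.Binary.PropositionalEquality using (_≡_; _≢_)
open import Relation.Binary.Definitions using (DecidableEquality)
open import Algebra.Structures using (IsCommutativeRing)

IsPrimePower : ℕ → Set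
IsPrimePower q = Σ ℕ λ p → Σ ℕ λ k → Prime p × q ≡ p ^ suc k

record FieldOfOrder (q n : ℕ) : Set₁ where
  infixl 6 _+_
  infixl 7 _*_
  field
    K      : Set
    _≟_    : DecidableEquality K
    _+_    : K → K → K
    _*_    : K → K → K
    -_     : K → K
    0#     : K
    1#     : K
    isCommutativeRing : IsCommutativeRing _≡_ _+_ _*_ -_ 0# 1#
    0≢1    : 0# ≢ 1#
    inverse : ∀ x → x ≢ 0# → ∃ λ y → x * y ≡ 1#
    elems  : List K
    elems-complete : ∀ x → x ∈ elems
    elems-unique   : Unique elems
    elems-card     : length elems ≡ q ^ n

module Setup {q n : ℕ} (F : FieldOfOrder q n) where
  open FieldOfOrder F public

  pow : K → ℕ → K
  pow x zero    = 1#
  pow x (suc k) = x * pow x k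

  InFq : K → Set
  InFq x = pow x q ≡ x

  -- σ^r (x) = x^{q^r} for an integer r, σ the Frobenius x ↦ x^q (order n);
  -- for negative r we use σ^{-1} = σ^{n-1}.
  frob : ℤ → K → K
  frob (+ k)      x = pow x (q ^ k)
  frob -[1+ k ]   x = pow x (q ^ (ℕ._*_ (ℕ._∸_ n 1) (suc k)))

  geom : ℕ → ℕ
  geom zero    = 0
  geom (suc i) = ℕ._+_ (geom i) (q ^ i)

  N : K → K
  N x = pow x (geom n)

  IsAutFixingFq : (K → K) → Set
  IsAutFixingFq τ =
    (∀ x y → τ (x + y) ≡ τ x + τ y) ×
    (∀ x y → τ (x * y) ≡ τ x * τ y) ×
    τ 1# ≡ 1# ×
    (∀ x y → τ x ≡ τ y → x ≡ y) ×
    (∀ x → (τ x ≡ x → InFq x) × (InFq x → τ x ≡ x))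

  eqK : K → K → Bool
  eqK x y = does (x ≟ y)

  record V4 : Set where
    constructor v4
    field c0 c1 c2 c3 : K

  eqV : V4 → V4 → Bool
  eqV (v4 a b c d) (v4 a' b' c' d') = eqK a a' ∧ eqK b b' ∧ eqK c c' ∧ eqK d d'

  zeroV : V4
  zeroV = v4 0# 0# 0# 0#

  isZeroV : V4 → Bool
  isZeroV v = eqV v zeroV

  scale : K → V4 → V4
  scale λ' (v4 a b c d) = v4 (λ' * a) (λ' * b) (λ' * c) (λ' * d)

  addV : V4 → V4 → V4
  addV (v4 a b c d) (v4 a' b' c' d') = v4 (a + a') (b + b') (c + c') (d + d')

  e0 e1 e2 e3 : V4
  e0 = v4 1# 0# 0# 0#
  e1 = v4 0# 1# 0# 0#
  e2 = v4 0# 0# 1# 0#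
  e3 = v4 0# 0# 0# 1#

  pairs : List (K × K)
  pairs = concatMap (λ x → map (λ y → (x , y)) elems) elems

  allV : List V4
  allV = concatMap (λ a → concatMap (λ b → concatMap (λ c → map (λ d → v4 a b c d)
           elems) elems) elems) elems

  countV : (V4 → Bool) → ℕ
  countV P = length (filterᵇ P allV)

  inSpan1 : V4 → V4 → Bool
  inSpan1 v u = any (λ λ' → eqV (scale λ' v) u) elems

  inSpan2 : V4 → V4 → V4 → Bool
  inSpan2 v w u = any (λ { (λ' , μ) → eqV (addV (scale λ' v) (scale μ w)) u }) pairs

  Indep : V4 → V4 → Set
  Indep v w = ∀ λ' μ → addV (scale λ' v) (scale μ w) ≡ zeroV → (λ' ≡ 0#) × (μ ≡ 0#)

  Line : Set
  Line = V4 × V4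

  IsLine : Line → Set
  IsLine (v , w) = Indep v w

  onLine : Line → V4 → Bool
  onLine (v , w) u = inSpan2 v w u

  SameLine : Line → Line → Set
  SameLine ℓ m = ∀ u → onLine ℓ u ≡ onLine m u

  DisjointLines : Line → Line → Set
  DisjointLines ℓ m = ∀ u → T (onLine ℓ u) → T (onLine m u) → u ≡ zeroV

  MeetLines : Line → Line → Set
  MeetLines ℓ m = ∃ λ u → T (not (isZeroV u)) × T (onLine ℓ u) × T (onLine m u)

  SamePoint : V4 → V4 → Set
  SamePoint u w = ∃ λ μ → μ ≢ 0# × u ≡ scale μ w

  -- Linear sets L_U where U = { f(x,y) : x , y ∈ F_{q^n} } for an
  -- F_q-linear injective parametrisation f : F_{q^n}^2 → V
  module LinearSet (f : K → K → V4) where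

    inU : V4 → Bool
    inU u = any (λ { (x , y) → eqV (f x y) u }) pairs

    -- |U| = q^{rank}
    sizeU : ℕ
    sizeU = countV inU

    inL : V4 → Bool
    inL v = not (isZeroV v) ∧
            any (λ { (x , y) → not (isZeroV (f x y)) ∧ inSpan1 v (f x y) }) pairs

    cntPt : V4 → ℕ
    cntPt v = countV (λ u → inU u ∧ inSpan1 v u)

    Weight : V4 → ℕ → Set
    Weight v w = cntPt v ≡ q ^ w

    cntLine : Line → ℕ
    cntLine ℓ = countV (λ u → inU u ∧ onLine ℓ u)

    LineWeight : Line → ℕ → Set
    LineWeight ℓ w = cntLine ℓ ≡ q ^ w

    Scattered : Set
    Scattered = ∀ v → T (inL v) → Weight v 1

    MaximumScattered : Set
    MaximumScattered = Scattered × sizeU ≡ q ^ (ℕ._*_ 2 n)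

    LongLine : Line → Set
    LongLine ℓ = IsLine ℓ × LineWeight ℓ n

    LineDisjointFromL : Line → Set
    LineDisjointFromL ℓ = ∀ u → T (onLine ℓ u) → ¬ T (inL u)

    -- pseudoregulus type (for a scattered linear set of rank 2n in PG(3,q^n))
    PseudoregulusType : Set
    PseudoregulusType =
      Σ (Fin (suc (q ^ n)) → Line) λ ℓ →
        (∀ i → LongLine (ℓ i)) ×
        (∀ i j → i ≢ j → DisjointLines (ℓ i) (ℓ j)) ×
        (let Good : Line → Set
             Good m = IsLine m × LineDisjointFromL m × (∀ i → MeetLines m (ℓ i))
         in Σ Line λ m₁ → Σ Line λ m₂ →
              Good m₁ × Good m₂ × ¬ SameLine m₁ m₂ ×
              (∀ m → Good m → SameLine m m₁ ⊎ SameLine m m₂))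

    LineOfPseudoregulusType : Line → Set
    LineOfPseudoregulusType r =
      Σ V4 λ w' → Σ V4 λ v' → Σ K λ ρ → Σ (K → K) λ τ →
        T (onLine r w') × T (onLine r v') × Indep w' v' ×
        ρ ≢ 0# × IsAutFixingFq τ ×
        (∀ p → T (onLine r p) → T (not (isZeroV p)) →
           (T (inL p) →
              ∃ λ λ' → λ' ≢ 0# × SamePoint p (addV (scale λ' w') (scale (ρ * τ λ') v'))) ×
           ((∃ λ λ' → λ' ≢ 0# × SamePoint p (addV (scale λ' w') (scale (ρ * τ λ') v'))) →
              T (inL p)))

    -- "the set of points satisfying P has m elements": P is a predicate on
    -- vectors invariant under nonzero scalars and false on 0, so it is
    -- satisfied by exactly m (q^n - 1) vectors.
    NumPoints : (V4 → Bool) → ℕ → Set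
    NumPoints P m = countV P ≡ ℕ._*_ m (ℕ._∸_ (q ^ n) 1)

    -- points of L of weight bigger than 1 (weight ≠ 1, i.e. |⟨v⟩∩U| ≠ q)
    heavy : V4 → Bool
    heavy v = inL v ∧ not (cntPt v ≡ᵇ q)

  module DA (ξ : K) (r : ℤ) (a : K) where
    A : K → K
    A x = frob r x + - (a * frob (ℤ._-_ (+ n) r) x)

    fDA : K → K → V4
    fDA x y = v4 x y (A y) (ξ * A x)

    open LinearSet fDA public

{-# OPTIONS --safe #-}
module Submission where

open import Defs
open import Algebra.Bundles using (CommutativeRing)
import Algebra.Properties.AbelianGroup
import Algebra.Properties.CommutativeSemiring.Binomial
import Algebra.Properties.Monoid.Sum
import Algebra.Properties.Ring
import Algebra.Properties.Semiring.Exp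
import Algebra.Properties.Semiring.Mult
import Algebra.Solver.Ring
open import Algebra.Solver.Ring.AlmostCommutativeRing using (AlmostCommutativeRing; _-Raw-AlmostCommutative⟶_; fromCommutativeRing)
import Algebra.Structures
open import Algebra.Structures using (IsCommutativeMonoid)
open import Data.Bool using (Bool; T; _∧_; false; if_then_else_; not; true)
open import Data.Bool.ListAction using (any)
open import Data.Bool.Properties using (T-∧; T?)
open import Data.Empty using (⊥; ⊥-elim)
open import Data.Fin using (Fin; cast; fromℕ; inject₁; toℕ) renaming (suc to fsuc; zero to fzero)
import Data.Fin.Properties as Finₚ
import Data.Integer as Int
open import Data.Integer using (ℤ; ∣_∣)
import Data.Integer.Properties as ℤₚ
open import Data.List using (List; []; _++_; _∷_; concatMap; downFrom; filter; foldr; length; lookup; map; replicate)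
open import Data.List.Membership.Propositional using (_∈_; find)
import Data.List.Membership.Propositional.Properties as ∈ₚ
open import Data.List.Membership.Propositional.Properties using (∈-concatMap⁺; ∈-concatMap⁻; ∈-downFrom⁺; ∈-downFrom⁻; ∈-filter⁺; ∈-filter⁻; ∈-lookup; ∈-map⁺; ∈-map⁻)
open import Data.List.Membership.Propositional.Properties.WithK using (unique∧set⇒bag)
import Data.List.Properties as Listₚ
open import Data.List.Relation.Binary.BagAndSetEquality using (∼bag⇒↭)
open import Data.List.Relation.Binary.Permutation.Propositional using (_↭_; ↭⇒↭ₛ)
import Data.List.Relation.Binary.Permutation.Propositional.Properties as ↭ₚ
import Data.List.Relation.Binary.Permutation.Setoid.Properties as ↭ₛ
import Data.List.Relation.Unary.All as All
open import Data.List.Relation.Unary.All using (All; []; _∷_)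
import Data.List.Relation.Unary.All.Properties as Allₚ
open import Data.List.Relation.Unary.AllPairs using ([]; _∷_)
import Data.List.Relation.Unary.Any as Any
open import Data.List.Relation.Unary.Any using (here; index; there)
import Data.List.Relation.Unary.Any.Properties as Anyₚ
open import Data.List.Relation.Unary.Any.Properties using (lookup-index)
open import Data.List.Relation.Unary.Unique.Propositional using (Unique)
import Data.List.Relation.Unary.Unique.Propositional.Properties as Uniqueₚ
open import Data.Maybe using (Maybe; just; nothing)
import Data.Nat as ℕ
open import Data.Nat using (>-nonZero; NonZero; _!; _%_; _/_; _<_; _^_; _∸_; _≤_; suc; s≤s; zero; z≤n; ℕ) renaming (_*_ to _*ℕ_; _+_ to _+ℕ_)
open import Data.Nat.Combinatorics using (_C_; k![n∸k]!∣n!; nCk≡n!/k![n-k]!; nCn≡1)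
open import Data.Nat.Coprimality using (Coprime; coprime-Bézout; gcd≡1⇒coprime)
open import Data.Nat.DivMod using (%-distribˡ-*; [m+kn]%n≡m%n; m%n%n≡m%n; m%n<n; m/n*n≡m; m<n⇒m%n≡m; m≡m%n+[m/n]*n)
open import Data.Nat.Divisibility using (_∣_; divides; ∣m+n∣m⇒∣n; ∣m⇒∣m*n; ∣⇒≤)
open import Data.Nat.GCD using (gcd; module Bézout)
open import Data.Nat.Primality using (Prime; euclidsLemma; prime⇒nonTrivial; ¬prime[0]; ¬prime[1])
import Data.Nat.Properties as ℕₚ
import Data.Nat.Solver as ℕSolver
open import Data.Product using (_,_; _×_; proj₁; proj₂; uncurry; Σ; ∃)
open import Data.Product.Properties using (≡-dec)
open import Data.Sum using ([_,_]′; _⊎_; inj₁; inj₂)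
open import Data.Unit using (tt)
open import Function using (Equivalence; _∘_; mk⇔)
open import Relation.Binary.Definitions using (DecidableEquality; tri<; tri>; tri≈)
open import Relation.Binary.PropositionalEquality using (_≡_; _≢_; cong; cong₂; module ≡-Reasoning; refl; setoid; subst; sym; trans)
open import Relation.Nullary using (Dec; does; no; yes; ¬_)
open import Relation.Nullary.Decidable using (_×-dec_; map′; ¬?)

-- A multiple λ·(x, y, A y, ξ A x) of a vector of U lies in U iff A (λx) = λ A x and A (λy) = λ A y.
-- With s = σ^r and δ = λ^s − λ the first condition reads δ x^s = − a (δ x)^{s⁻¹}; taking norms, a
-- solution with λ ∉ F_q and x ≠ 0 forces N a = −1, so U is scattered otherwise.
--
-- If N a = −1, then for every λ ∉ F_q Hilbert 90 for s² gives exactly q − 1 such x, while every x has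
-- q or q² such λ; double counting yields the number of heavy points.
--
-- If n = 3, a linear change of coordinates (invertible as N a ≠ −1) turns U into {(z, w, z^s, w^s)}.
--
-- If n > 3 and the line were of pseudoregulus type, then two linear forms in (x, A x) would have
-- proportional norms for all x. In the variables v_i = μ^{q^i}, μ = A x / x, this says that a difference
-- G of two products of one-variable factors vanishes at the (qⁿ − 1)/(q − 1) eigenvalues μ. So does
-- the trace equation D of the cyclic product of the transfer matrices of A x = μ x. Both are multi-affine
-- in v, so as polynomials in μ they have degree at most the number of these roots, and hence are
-- proportional on all of Kⁿ. A suitable v₀ leaves a single product in G, but D does not split.

-- Finite counting

-- A point of the linear set has weight above one exactly when some λ outside F_q carries a nonzero
-- vector of U spanning it to another vector of U. Since U is a graph over (x, y) and ξ ≠ 0, this is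
-- one and the same condition `W` imposed on x and on y. Let s be the automorphism belonging to r, t
-- its inverse, and δ λ = s λ - λ. The condition on x reads δ λ · s x = -a · t (δ λ · x). The norm
-- is invariant under s and t, so a solution with x ≠ 0 and δ λ ≠ 0 forces N (-a) = 1, that is N a =
-- -1 because n is odd. Hence U is scattered whenever N a ≠ -1.
--
-- For N a = -1 the same equation is read in two directions. For fixed x, quotients of two nonzero
-- values δ λ lie in F_q, so the admissible λ form F_q or a two-dimensional F_q-space (`W-span`).
-- For fixed λ outside F_q, the substitution x = s y gives s² y = g y with N g = 1; as n is odd, s²
-- has fixed field F_q too, and `Hilbert90` yields q - 1 values of x. Counting the pairs (x, λ)
-- leaves q^(n-1) - 1 exceptional x, and counting vectors of U against the points they span
-- (`PointClass`) turns this into numbers of points.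
--
-- For n = 3 one has s² = t, and z = x - t(a) A x together with s z are two combinations of x and A
-- x with determinant 1 + N a. In these coordinates the long lines join (α, β, 0, 0) to (0, 0, s α,
-- s β), and four of them already determine their transversals (`four-points`).
--
-- For n > 3, suppose one of the two lines were of pseudoregulus type. Automorphisms over F_q
-- preserve norms, so two independent linear forms in x and A x would have proportional norms. In
-- terms of μ = A x / x this is the vanishing of `G`. A second relation is `D`: the vector (x, t x)
-- is fixed by the product of the transfer matrices of A x = μ x, whose determinant is -N a. Both
-- relations are affine in every conjugate of μ, hence of degree at most 1 + q + ⋯ + q^(n-1) in μ,
-- while N a ≠ -1 guarantees at least that many values μ. So the two are proportional, and since
-- sums of distinct powers of q are distinct, they are proportional even as functions of n
-- independent variables. There they differ in kind: with v₀ chosen to kill one of its two products,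
-- `G` becomes a product of functions of one variable each, whereas a suitable plane section of `D`
-- has the form κ + α x + β y with α β ≠ 0 (`D-not-rank-one`). The section uses four free variables
-- followed by an odd number of zeros, which an odd n > 3 provides.

private
  variable
    X Y : Set

indicator : {P : Set} → Dec P → ℕ
indicator d = if does d then 1 else 0

Σ[_]_ : List X → (X → ℕ) → ℕ
Σ[ [] ] f     = 0
Σ[ x ∷ xs ] f = f x +ℕ Σ[ xs ] f

#[_]_ : {P : X → Set} → List X → (∀ x → Dec (P x)) → ℕ
#[ xs ] P? = length (filter P? xs)

#-Σ : {P : X → Set} (xs : List X) (P? : ∀ x → Dec (P x)) → #[ xs ] P? ≡ Σ[ xs ] (indicator ∘ P?)
#-Σ []       P? = refl
#-Σ (x ∷ xs) P? with does (P? x)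
... | true  = cong suc (#-Σ xs P?)
... | false = #-Σ xs P?

Σ-cong : (xs : List X) {f g : X → ℕ} → (∀ x → f x ≡ g x) → Σ[ xs ] f ≡ Σ[ xs ] g
Σ-cong []       eq = refl
Σ-cong (x ∷ xs) eq = cong₂ _+ℕ_ (eq x) (Σ-cong xs eq)

Σ-mono : (xs : List X) {f g : X → ℕ} → (∀ x → f x ≤ g x) → Σ[ xs ] f ≤ Σ[ xs ] g
Σ-mono []       le = z≤n
Σ-mono (x ∷ xs) le = ℕₚ.+-mono-≤ (le x) (Σ-mono xs le)

Σ-*ʳ : (xs : List X) (f : X → ℕ) (k : ℕ) → Σ[ xs ] (λ x → f x *ℕ k) ≡ Σ[ xs ] f *ℕ k
Σ-*ʳ []       f k = refl
Σ-*ʳ (x ∷ xs) f k = trans (cong (f x *ℕ k +ℕ_) (Σ-*ʳ xs f k)) (sym (ℕₚ.*-distribʳ-+ k (f x) _))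

Σ-*ˡ : (xs : List X) (k : ℕ) (f : X → ℕ) → Σ[ xs ] (λ x → k *ℕ f x) ≡ k *ℕ Σ[ xs ] f
Σ-*ˡ []       k f = sym (ℕₚ.*-zeroʳ k)
Σ-*ˡ (x ∷ xs) k f = trans (cong (k *ℕ f x +ℕ_) (Σ-*ˡ xs k f)) (sym (ℕₚ.*-distribˡ-+ k (f x) _))

Σ-+ : (xs : List X) (f g : X → ℕ) → Σ[ xs ] (λ x → f x +ℕ g x) ≡ Σ[ xs ] f +ℕ Σ[ xs ] g
Σ-+ []       f g = refl
Σ-+ (x ∷ xs) f g rewrite Σ-+ xs f g = begin
  f x +ℕ g x +ℕ (F +ℕ G)  ≡⟨ ℕₚ.+-assoc (f x) (g x) _ ⟩
  f x +ℕ (g x +ℕ (F +ℕ G))  ≡⟨ cong (f x +ℕ_) (sym (ℕₚ.+-assoc (g x) F G)) ⟩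
  f x +ℕ (g x +ℕ F +ℕ G)  ≡⟨ cong (λ z → f x +ℕ (z +ℕ G)) (ℕₚ.+-comm (g x) F) ⟩
  f x +ℕ (F +ℕ g x +ℕ G)  ≡⟨ cong (f x +ℕ_) (ℕₚ.+-assoc F (g x) G) ⟩
  f x +ℕ (F +ℕ (g x +ℕ G))  ≡⟨ sym (ℕₚ.+-assoc (f x) F _) ⟩
  f x +ℕ F +ℕ (g x +ℕ G)  ∎
  where
  open ≡-Reasoning
  F = Σ[ xs ] f
  G = Σ[ xs ] g

Σ-zero : (xs : List X) → Σ[ xs ] (λ _ → 0) ≡ 0
Σ-zero []       = refl
Σ-zero (x ∷ xs) = Σ-zero xs

Σ-swap : (xs : List X) (ys : List Y) (h : X → Y → ℕ) →
         Σ[ xs ] (λ x → Σ[ ys ] (h x)) ≡ Σ[ ys ] (λ y → Σ[ xs ] (λ x → h x y))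
Σ-swap []       ys h = sym (Σ-zero ys)
Σ-swap (x ∷ xs) ys h =
  trans (cong (Σ[ ys ] (h x) +ℕ_) (Σ-swap xs ys h)) (sym (Σ-+ ys (h x) _))

indicator-*≤ : {P : Set} (p : Dec P) {m n : ℕ} → (P → m ≤ n) → indicator p *ℕ m ≤ indicator p *ℕ n
indicator-*≤ (yes p) le = ℕₚ.*-monoʳ-≤ 1 (le p)
indicator-*≤ (no _)  le = z≤n

module _ (xs : List X) (ys : List Y) {P : X → Set} {Q : Y → Set} {R : X → Y → Set}
         (P? : ∀ x → Dec (P x)) (Q? : ∀ y → Dec (Q y)) (R? : ∀ x y → Dec (R x y)) where

  -- Both sides count the pairs related by `R` whose members satisfy `P` and `Q`. One of the two
  -- conditions stands outside the inner count as an indicator, so that bounds known only on `P` or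
  -- only on `Q` can be applied row by row.
  pairs-by-columns : Σ[ xs ] (λ x → indicator (P? x) *ℕ #[ ys ] (λ y → Q? y ×-dec R? x y))
                   ≡ Σ[ ys ] (λ y → indicator (Q? y) *ℕ #[ xs ] (λ x → P? x ×-dec R? x y))
  pairs-by-columns = begin
    Σ[ xs ] (λ x → indicator (P? x) *ℕ #[ ys ] (λ y → Q? y ×-dec R? x y))
      ≡⟨ Σ-cong xs (λ x → trans (cong (indicator (P? x) *ℕ_) (#-Σ ys _)) (sym (Σ-*ˡ ys (indicator (P? x)) _))) ⟩
    Σ[ xs ] (λ x → Σ[ ys ] (λ y → indicator (P? x) *ℕ indicator (Q? y ×-dec R? x y)))
      ≡⟨ Σ-swap xs ys _ ⟩
    Σ[ ys ] (λ y → Σ[ xs ] (λ x → indicator (P? x) *ℕ indicator (Q? y ×-dec R? x y)))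
      ≡⟨ Σ-cong ys (λ y → Σ-cong xs (λ x → exchange x y)) ⟩
    Σ[ ys ] (λ y → Σ[ xs ] (λ x → indicator (Q? y) *ℕ indicator (P? x ×-dec R? x y)))
      ≡⟨ Σ-cong ys (λ y → trans (Σ-*ˡ xs (indicator (Q? y)) _) (cong (indicator (Q? y) *ℕ_) (sym (#-Σ xs _)))) ⟩
    Σ[ ys ] (λ y → indicator (Q? y) *ℕ #[ xs ] (λ x → P? x ×-dec R? x y)) ∎
    where
    open ≡-Reasoning
    exchange : ∀ x y → indicator (P? x) *ℕ indicator (Q? y ×-dec R? x y)
                     ≡ indicator (Q? y) *ℕ indicator (P? x ×-dec R? x y)
    exchange x y with does (P? x) | does (Q? y)
    ... | true  | true  = refl
    ... | true  | false = refl
    ... | false | true  = refl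
    ... | false | false = refl

  doubleCount≤ : ∀ {k l} → (∀ x → P x → k ≤ #[ ys ] (λ y → Q? y ×-dec R? x y)) →
                 (∀ y → Q y → #[ xs ] (λ x → P? x ×-dec R? x y) ≤ l) →
                 #[ xs ] P? *ℕ k ≤ #[ ys ] Q? *ℕ l
  doubleCount≤ {k} {l} rows columns = begin
    #[ xs ] P? *ℕ k  ≡⟨ cong (_*ℕ k) (#-Σ xs P?) ⟩
    (Σ[ xs ] (indicator ∘ P?)) *ℕ k  ≡⟨ sym (Σ-*ʳ xs _ k) ⟩
    Σ[ xs ] (λ x → indicator (P? x) *ℕ k)  ≤⟨ Σ-mono xs (λ x → indicator-*≤ (P? x) (rows x)) ⟩
    Σ[ xs ] (λ x → indicator (P? x) *ℕ #[ ys ] (λ y → Q? y ×-dec R? x y))  ≡⟨ pairs-by-columns ⟩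
    Σ[ ys ] (λ y → indicator (Q? y) *ℕ #[ xs ] (λ x → P? x ×-dec R? x y))  ≤⟨ Σ-mono ys (λ y → indicator-*≤ (Q? y) (columns y)) ⟩
    Σ[ ys ] (λ y → indicator (Q? y) *ℕ l)  ≡⟨ Σ-*ʳ ys _ l ⟩
    (Σ[ ys ] (indicator ∘ Q?)) *ℕ l  ≡⟨ cong (_*ℕ l) (sym (#-Σ ys Q?)) ⟩
    #[ ys ] Q? *ℕ l  ∎
    where open ℕₚ.≤-Reasoning

  doubleCount≥ : ∀ {k l} → (∀ x → P x → #[ ys ] (λ y → Q? y ×-dec R? x y) ≤ k) →
                 (∀ y → Q y → l ≤ #[ xs ] (λ x → P? x ×-dec R? x y)) →
                 #[ ys ] Q? *ℕ l ≤ #[ xs ] P? *ℕ k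
  doubleCount≥ {k} {l} rows columns = begin
    #[ ys ] Q? *ℕ l  ≡⟨ cong (_*ℕ l) (#-Σ ys Q?) ⟩
    (Σ[ ys ] (indicator ∘ Q?)) *ℕ l  ≡⟨ sym (Σ-*ʳ ys _ l) ⟩
    Σ[ ys ] (λ y → indicator (Q? y) *ℕ l)  ≤⟨ Σ-mono ys (λ y → indicator-*≤ (Q? y) (columns y)) ⟩
    Σ[ ys ] (λ y → indicator (Q? y) *ℕ #[ xs ] (λ x → P? x ×-dec R? x y))  ≡⟨ sym pairs-by-columns ⟩
    Σ[ xs ] (λ x → indicator (P? x) *ℕ #[ ys ] (λ y → Q? y ×-dec R? x y))  ≤⟨ Σ-mono xs (λ x → indicator-*≤ (P? x) (rows x)) ⟩
    Σ[ xs ] (λ x → indicator (P? x) *ℕ k)  ≡⟨ Σ-*ʳ xs _ k ⟩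
    (Σ[ xs ] (indicator ∘ P?)) *ℕ k  ≡⟨ cong (_*ℕ k) (sym (#-Σ xs P?)) ⟩
    #[ xs ] P? *ℕ k  ∎
    where open ℕₚ.≤-Reasoning

  doubleCount : ∀ {k l} → (∀ x → P x → #[ ys ] (λ y → Q? y ×-dec R? x y) ≡ k) →
                (∀ y → Q y → #[ xs ] (λ x → P? x ×-dec R? x y) ≡ l) →
                #[ xs ] P? *ℕ k ≡ #[ ys ] Q? *ℕ l
  doubleCount rows columns = ℕₚ.≤-antisym
    (doubleCount≤ (λ x p → ℕₚ.≤-reflexive (sym (rows x p))) (λ y q → ℕₚ.≤-reflexive (columns y q)))
    (doubleCount≥ (λ x p → ℕₚ.≤-reflexive (rows x p)) (λ y q → ℕₚ.≤-reflexive (sym (columns y q))))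

#-cong : (xs : List X) {P Q : X → Set} (P? : ∀ x → Dec (P x)) (Q? : ∀ x → Dec (Q x)) →
         (∀ x → P x → Q x) → (∀ x → Q x → P x) → #[ xs ] P? ≡ #[ xs ] Q?
#-cong []       P? Q? f g = refl
#-cong (x ∷ xs) P? Q? f g with P? x | Q? x
... | yes p | yes q = cong suc (#-cong xs P? Q? f g)
... | yes p | no ¬q = ⊥-elim (¬q (f x p))
... | no ¬p | yes q = ⊥-elim (¬p (g x q))
... | no ¬p | no ¬q = #-cong xs P? Q? f g

#-mono : (xs : List X) {P Q : X → Set} (P? : ∀ x → Dec (P x)) (Q? : ∀ x → Dec (Q x)) →
         (∀ x → P x → Q x) → #[ xs ] P? ≤ #[ xs ] Q?
#-mono []       P? Q? f = z≤n
#-mono (x ∷ xs) P? Q? f with P? x | Q? x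
... | yes p | yes q = s≤s (#-mono xs P? Q? f)
... | yes p | no ¬q = ⊥-elim (¬q (f x p))
... | no ¬p | yes q = ℕₚ.m≤n⇒m≤1+n (#-mono xs P? Q? f)
... | no ¬p | no ¬q = #-mono xs P? Q? f

#-all : (xs : List X) {P : X → Set} (P? : ∀ x → Dec (P x)) → (∀ x → P x) → #[ xs ] P? ≡ length xs
#-all []       P? f = refl
#-all (x ∷ xs) P? f with P? x
... | yes _ = cong suc (#-all xs P? f)
... | no ¬p = ⊥-elim (¬p (f x))

#-split : (xs : List X) {P Q : X → Set} (P? : ∀ x → Dec (P x)) (Q? : ∀ x → Dec (Q x)) →
          #[ xs ] P? ≡ #[ xs ] (λ x → P? x ×-dec Q? x) +ℕ #[ xs ] (λ x → P? x ×-dec ¬? (Q? x))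
#-split []       P? Q? = refl
#-split (x ∷ xs) P? Q? with ih ← #-split xs P? Q? | does (P? x) | does (Q? x)
... | true  | true  = cong suc ih
... | true  | false = trans (cong suc ih) (sym (ℕₚ.+-suc _ _))
... | false | _     = ih

#-complement : (xs : List X) {P : X → Set} (P? : ∀ x → Dec (P x)) →
               #[ xs ] P? +ℕ #[ xs ] (λ x → ¬? (P? x)) ≡ length xs
#-complement []       P? = refl
#-complement (x ∷ xs) P? with ih ← #-complement xs P? | does (P? x)
... | true  = cong suc ih
... | false = trans (ℕₚ.+-suc _ _) (cong suc ih)

record Enumeration (X : Set) : Set where
  field
    list     : List X
    complete : ∀ x → x ∈ list
    unique   : Unique list
    _≟_      : DecidableEquality X

  # : {P : X → Set} → (∀ x → Dec (P x)) → ℕ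
  # = #[ list ]_

  #-none : {P : X → Set} (P? : ∀ x → Dec (P x)) → (∀ x → ¬ P x) → # P? ≡ 0
  #-none P? ¬P = none list
    where
    none : ∀ xs → #[ xs ] P? ≡ 0
    none []       = refl
    none (x ∷ xs) with P? x
    ... | yes p = ⊥-elim (¬P x p)
    ... | no  _ = none xs

  #-singleton : ∀ a → # (_≟ a) ≡ 1
  #-singleton a = once list unique (complete a)
    where
    absent : ∀ xs → All (a ≢_) xs → #[ xs ] (_≟ a) ≡ 0
    absent []       []        = refl
    absent (x ∷ xs) (ne ∷ nes) with x ≟ a
    ... | yes refl = ⊥-elim (ne refl)
    ... | no  _    = absent xs nes
    once : ∀ xs → Unique xs → a ∈ xs → #[ xs ] (_≟ a) ≡ 1
    once (x ∷ xs) (ne ∷ u) (here refl) with x ≟ x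
    ... | yes _   = cong suc (absent xs ne)
    ... | no  x≢x = ⊥-elim (x≢x refl)
    once (x ∷ xs) (ne ∷ u) (there a∈xs) with x ≟ a
    ... | yes refl = ⊥-elim (All.lookup ne a∈xs refl)
    ... | no  _    = once xs u a∈xs

  #-one : {P : X → Set} (P? : ∀ x → Dec (P x)) → ∀ a → P a → (∀ x → P x → x ≡ a) → # P? ≡ 1
  #-one P? a pa only = trans (#-cong list P? (_≟ a) only (λ { _ refl → pa })) (#-singleton a)

  #-≤one : {P : X → Set} (P? : ∀ x → Dec (P x)) → (∀ x y → P x → P y → x ≡ y) → # P? ≤ 1
  #-≤one P? same with Any.any? P? list
  ... | yes some with a , pa ← Any.satisfied some =
        ℕₚ.≤-reflexive (#-one P? a pa (λ x px → same x a px pa))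
  ... | no  none = ℕₚ.≤-trans (ℕₚ.≤-reflexive (#-none P? (λ x px → none (Any.map (λ { refl → px }) (complete x))))) z≤n

  #-≥one : {P : X → Set} (P? : ∀ x → Dec (P x)) → ∀ a → P a → 1 ≤ # P?
  #-≥one P? a pa = ℕₚ.≤-trans (ℕₚ.≤-reflexive (sym (#-singleton a))) (#-mono list (_≟ a) P? (λ { _ refl → pa }))

  exists? : {P : X → Set} → (∀ x → Dec (P x)) → Dec (∃ P)
  exists? P? with Any.any? P? list
  ... | yes some = yes (Any.satisfied some)
  ... | no  none = no (λ (x , px) → none (Any.map (λ { refl → px }) (complete x)))

  #-remove : {P : X → Set} (P? : ∀ x → Dec (P x)) → ∀ a → P a →
             # P? ≡ suc (# (λ x → P? x ×-dec ¬? (x ≟ a)))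
  #-remove P? a pa = trans (#-split list P? (_≟ a))
    (cong (_+ℕ # (λ x → P? x ×-dec ¬? (x ≟ a)))
      (#-one (λ x → P? x ×-dec (x ≟ a)) a (pa , refl) (λ _ → proj₂)))

module _ (EA : Enumeration X) (EB : Enumeration Y) where
  private
    module EA = Enumeration EA
    module EB = Enumeration EB

  module _ {P : X → Set} {Q : Y → Set} (P? : ∀ x → Dec (P x)) (Q? : ∀ y → Dec (Q y))
           (φ : X → Y) (maps : ∀ x → P x → Q (φ x)) where

    -- Double counting along the graph of `φ`: each row in `P` contains exactly one pair, so the
    -- sizes of the fibres decide.
    fiber-= : ∀ {l} → (∀ y → Q y → EA.# (λ x → P? x ×-dec (φ x EB.≟ y)) ≡ l) →
              EA.# P? ≡ EB.# Q? *ℕ l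
    fiber-= fib = trans (sym (ℕₚ.*-identityʳ _))
      (doubleCount EA.list EB.list P? Q? (λ x y → φ x EB.≟ y)
        (λ x p → EB.#-one _ (φ x) (maps x p , refl) (λ _ h → sym (proj₂ h))) fib)

    fiber-≤ : ∀ {l} → (∀ y → Q y → EA.# (λ x → P? x ×-dec (φ x EB.≟ y)) ≤ l) →
              EA.# P? ≤ EB.# Q? *ℕ l
    fiber-≤ fib = ℕₚ.≤-trans (ℕₚ.≤-reflexive (sym (ℕₚ.*-identityʳ _)))
      (doubleCount≤ EA.list EB.list P? Q? (λ x y → φ x EB.≟ y)
        (λ x p → EB.#-≥one _ (φ x) (maps x p , refl)) fib)

    bijection : (∀ x y → P x → P y → φ x ≡ φ y → x ≡ y) → (∀ y → Q y → ∃ λ x → P x × φ x ≡ y) →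
                EA.# P? ≡ EB.# Q?
    bijection inj sur = trans (fiber-= fib) (ℕₚ.*-identityʳ _)
      where
      fib : ∀ y → Q y → EA.# (λ x → P? x ×-dec (φ x EB.≟ y)) ≡ 1
      fib y qy with sur y qy
      ... | x , px , refl = EA.#-one _ x (px , refl) (λ z (pz , e) → inj z x pz px e)

    injection : (∀ x y → P x → P y → φ x ≡ φ y → x ≡ y) → EA.# P? ≤ EB.# Q?
    injection inj = ℕₚ.≤-trans (fiber-≤ (λ y _ → EA.#-≤one _ (λ x x' (p , e) (p' , e') → inj x x' p p' (trans e (sym e')))))
                      (ℕₚ.≤-reflexive (ℕₚ.*-identityʳ _))

concatMap-unique : (g : X → List Y) → (∀ x → Unique (g x)) →
                   (∀ {x y v} → v ∈ g x → v ∈ g y → x ≡ y) →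
                   ∀ {xs} → Unique xs → Unique (concatMap g xs)
concatMap-unique g ug dis []                     = []
concatMap-unique g ug dis {x ∷ xs} (ne ∷ u) =
  Uniqueₚ.++⁺ (ug x) (concatMap-unique g ug dis u)
    (λ (v∈x , v∈xs) → let some = ∈-concatMap⁻ g v∈xs in
       Allₚ.All¬⇒¬Any (All.map (λ x≢y v∈y → x≢y (dis v∈x v∈y)) ne) some)

concatMap-complete : (g : X → List Y) {v : Y} {x : X} {xs : List X} → x ∈ xs → v ∈ g x → v ∈ concatMap g xs
concatMap-complete g x∈xs v∈gx = ∈-concatMap⁺ g (Any.map (λ { refl → v∈gx }) x∈xs)

any-intro : (p : X → Bool) {xs : List X} {x : X} → x ∈ xs → T (p x) → T (any p xs)
any-intro p x∈xs px = Anyₚ.any⁺ p (Any.map (λ { refl → px }) x∈xs)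

any-elim : (p : X → Bool) {xs : List X} → T (any p xs) → ∃ λ x → T (p x)
any-elim p {xs} h = Any.satisfied (Anyₚ.any⁻ p xs h)

-- A ring solver with integer coefficients

module IntegerSolver {K : Set} {_+_ _*_ : K → K → K} { -_ : K → K} {0# 1# : K}
  (isCR : Algebra.Structures.IsCommutativeRing _≡_ _+_ _*_ -_ 0# 1#) where

  private
    open Int using (+_; -[1+_]; +[1+_])

    ring : CommutativeRing _ _
    ring = record { isCommutativeRing = isCR }
    open CommutativeRing ring using (semiring; +-assoc; +-comm; +-identityˡ; +-identityʳ; *-identityˡ; -‿inverseʳ; -‿inverseˡ)
    open Algebra.Properties.Ring (CommutativeRing.ring ring) using (-‿distribˡ-*; -‿distribʳ-*; -0#≈0#; -‿involutive)
    open Algebra.Properties.AbelianGroup (CommutativeRing.+-abelianGroup ring) using (⁻¹-∙-comm)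
    open Algebra.Properties.Semiring.Mult semiring using (×1-homo-*; ×-homo-+) renaming (_×_ to infixr 8 _·_)
    open ≡-Reasoning

    ⟦_⟧ : ℤ → K
    ⟦ + m ⟧      = m · 1#
    ⟦ -[1+ m ] ⟧ = - (suc m · 1#)

    ⊖-homo : ∀ m k → ⟦ m Int.⊖ k ⟧ ≡ (m · 1#) + (- (k · 1#))
    ⊖-homo m       zero    = trans (sym (+-identityʳ _)) (cong₂ _+_ refl (sym -0#≈0#))
    ⊖-homo zero    (suc k) = sym (+-identityˡ _)
    ⊖-homo (suc m) (suc k) rewrite ℤₚ.[1+m]⊖[1+n]≡m⊖n m k = trans (⊖-homo m k) (begin
      M + (- N)  ≡⟨ sym (+-identityˡ _) ⟩
      0# + (M + (- N))  ≡⟨ cong (_+ (M + (- N))) (sym (-‿inverseʳ 1#)) ⟩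
      (1# + (- 1#)) + (M + (- N))  ≡⟨ +-assoc _ _ _ ⟩
      1# + ((- 1#) + (M + (- N)))  ≡⟨ cong₂ _+_ refl (sym (+-assoc _ _ _)) ⟩
      1# + (((- 1#) + M) + (- N))  ≡⟨ cong (λ z → 1# + (z + (- N))) (+-comm _ _) ⟩
      1# + ((M + (- 1#)) + (- N))  ≡⟨ cong₂ _+_ refl (+-assoc _ _ _) ⟩
      1# + (M + ((- 1#) + (- N)))  ≡⟨ sym (+-assoc _ _ _) ⟩
      (1# + M) + ((- 1#) + (- N))  ≡⟨ cong₂ _+_ refl (⁻¹-∙-comm _ _) ⟩
      (1# + M) + (- (1# + N))  ∎)
      where
      M = m · 1#
      N = k · 1#

    +-homo : ∀ i j → ⟦ i Int.+ j ⟧ ≡ ⟦ i ⟧ + ⟦ j ⟧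
    +-homo (+ m)      (+ k)      = ×-homo-+ 1# m k
    +-homo (+ m)      -[1+ k ]   = ⊖-homo m (suc k)
    +-homo -[1+ m ]   (+ k)      = trans (⊖-homo k (suc m)) (+-comm _ _)
    +-homo -[1+ m ]   -[1+ k ]   = begin
      - ((2 +ℕ (m +ℕ k)) · 1#)  ≡⟨ cong (λ z → - (suc z · 1#)) (sym (ℕₚ.+-suc m k)) ⟩
      - ((suc m +ℕ suc k) · 1#)  ≡⟨ cong -_ (×-homo-+ 1# (suc m) (suc k)) ⟩
      - ((suc m · 1#) + (suc k · 1#))  ≡⟨ sym (⁻¹-∙-comm _ _) ⟩
      (- (suc m · 1#)) + (- (suc k · 1#)) ∎

    -‿homo : ∀ i → ⟦ Int.- i ⟧ ≡ - ⟦ i ⟧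
    -‿homo (+ zero)  = sym -0#≈0#
    -‿homo +[1+ m ]  = refl
    -‿homo -[1+ m ]  = sym (-‿involutive _)

    *-homo : ∀ i j → ⟦ i Int.* j ⟧ ≡ ⟦ i ⟧ * ⟦ j ⟧
    *-homo (+ m) (+ k) = trans (cong ⟦_⟧ (sym (ℤₚ.pos-* m k))) (×1-homo-* m k)
    *-homo (+ m) -[1+ k ] = begin
      ⟦ + m Int.* -[1+ k ] ⟧  ≡⟨ cong ⟦_⟧ (sym (ℤₚ.neg-distribʳ-* (+ m) (+ suc k))) ⟩
      ⟦ Int.- (+ m Int.* + suc k) ⟧  ≡⟨ -‿homo (+ m Int.* + suc k) ⟩
      - ⟦ + m Int.* + suc k ⟧  ≡⟨ cong -_ (*-homo (+ m) (+ suc k)) ⟩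
      - (⟦ + m ⟧ * ⟦ + suc k ⟧)  ≡⟨ -‿distribʳ-* _ _ ⟩
      ⟦ + m ⟧ * (- ⟦ + suc k ⟧)  ∎
    *-homo -[1+ m ] (+ k) = begin
      ⟦ -[1+ m ] Int.* + k ⟧  ≡⟨ cong ⟦_⟧ (sym (ℤₚ.neg-distribˡ-* (+ suc m) (+ k))) ⟩
      ⟦ Int.- (+ suc m Int.* + k) ⟧  ≡⟨ -‿homo (+ suc m Int.* + k) ⟩
      - ⟦ + suc m Int.* + k ⟧  ≡⟨ cong -_ (*-homo (+ suc m) (+ k)) ⟩
      - (⟦ + suc m ⟧ * ⟦ + k ⟧)  ≡⟨ -‿distribˡ-* _ _ ⟩
      (- ⟦ + suc m ⟧) * ⟦ + k ⟧  ∎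
    *-homo -[1+ m ] -[1+ k ] = begin
      ⟦ + (suc m *ℕ suc k) ⟧  ≡⟨ ×1-homo-* (suc m) (suc k) ⟩
      ⟦ + suc m ⟧ * ⟦ + suc k ⟧  ≡⟨ sym (-‿involutive _) ⟩
      - (- (⟦ + suc m ⟧ * ⟦ + suc k ⟧))  ≡⟨ cong -_ (-‿distribʳ-* _ _) ⟩
      - (⟦ + suc m ⟧ * (- ⟦ + suc k ⟧))  ≡⟨ -‿distribˡ-* _ _ ⟩
      (- ⟦ + suc m ⟧) * (- ⟦ + suc k ⟧)  ∎

    -- Agrees with ⟦_⟧, but sends 1 to 1# on the nose, so that 1# may occur in solver goals.
    ⟦_⟧′ : ℤ → K
    ⟦ + 1 ⟧′ = 1#
    ⟦ i ⟧′   = ⟦ i ⟧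

    ⟦⟧′≡⟦⟧ : ∀ i → ⟦ i ⟧′ ≡ ⟦ i ⟧
    ⟦⟧′≡⟦⟧ (+ zero)        = refl
    ⟦⟧′≡⟦⟧ (+ suc zero)    = sym (+-identityʳ 1#)
    ⟦⟧′≡⟦⟧ (+ suc (suc m)) = refl
    ⟦⟧′≡⟦⟧ -[1+ m ]        = refl

    almost : AlmostCommutativeRing _ _
    almost = fromCommutativeRing ring

    morphism : Int.+-*-rawRing -Raw-AlmostCommutative⟶ almost
    morphism = record
      { ⟦_⟧    = ⟦_⟧′
      ; +-homo = λ i j → trans (⟦⟧′≡⟦⟧ (i Int.+ j)) (trans (+-homo i j) (sym (cong₂ _+_ (⟦⟧′≡⟦⟧ i) (⟦⟧′≡⟦⟧ j))))
      ; *-homo = λ i j → trans (⟦⟧′≡⟦⟧ (i Int.* j)) (trans (*-homo i j) (sym (cong₂ _*_ (⟦⟧′≡⟦⟧ i) (⟦⟧′≡⟦⟧ j))))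
      ; -‿homo = λ i → trans (⟦⟧′≡⟦⟧ (Int.- i)) (trans (-‿homo i) (sym (cong -_ (⟦⟧′≡⟦⟧ i))))
      ; 0-homo = refl
      ; 1-homo = refl }

    coeff≟ : ∀ i j → Maybe (⟦ i ⟧′ ≡ ⟦ j ⟧′)
    coeff≟ i j with i Int.≟ j
    ... | yes eq = just (cong ⟦_⟧′ eq)
    ... | no  _  = nothing

  open Algebra.Solver.Ring Int.+-*-rawRing almost morphism coeff≟ public
    using (Polynomial; solve; _:=_; _:+_; _:*_; :-_; con)

  :1 :0 : ∀ {m} → Polynomial m
  :1 = con (Int.+ 1)
  :0 = con (Int.+ 0)

-- Finite fields

unique-↭ : {A : Set} {xs ys : List A} → Unique xs → Unique ys →
           (∀ {v} → v ∈ xs → v ∈ ys) → (∀ {v} → v ∈ ys → v ∈ xs) → xs ↭ ys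
unique-↭ ux uy f g = ∼bag⇒↭ (unique∧set⇒bag ux uy (mk⇔ f g))

prime∤! : ∀ {p} → Prime p → ∀ m → m < p → ¬ (p ∣ m !)
prime∤! {suc (suc _)} pp zero    m<p p∣1 with s≤s () ← ∣⇒≤ p∣1
prime∤! {suc zero} pp zero m<p p∣1 = ¬prime[1] pp
prime∤! pp (suc m) m<p p∣m! with euclidsLemma (suc m) (m !) pp p∣m!
... | inj₁ p∣1+m = ℕₚ.<⇒≱ m<p (∣⇒≤ p∣1+m)
... | inj₂ p∣m!′ = prime∤! pp m (ℕₚ.<-trans (ℕₚ.n<1+n m) m<p) p∣m!′

-- The prime p divides p! = C(p, k) · k! · (p - k)!, and by `prime∤!` it divides neither of the two
-- factorials.
prime∣C : ∀ {p k} → Prime p → 0 < k → k < p → p ∣ p C k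
prime∣C {p@(suc p′)} {k} pp 0<k k<p
  with euclidsLemma (p C k) (k ! *ℕ (p ∸ k) !) pp (subst (p ∣_) (sym factorials) (∣m⇒∣m*n (p′ !) (divides 1 (sym (ℕₚ.*-identityˡ p)))))
  where
  instance
    _ = k ℕₚ.!* (p ∸ k) !≢0
  factorials : (p C k) *ℕ (k ! *ℕ (p ∸ k) !) ≡ p !
  factorials = trans (cong (_*ℕ (k ! *ℕ (p ∸ k) !)) (nCk≡n!/k![n-k]! (ℕₚ.<⇒≤ k<p)))
                     (m/n*n≡m (k![n∸k]!∣n! (ℕₚ.<⇒≤ k<p)))
... | inj₁ p∣C = p∣C
... | inj₂ p∣d with euclidsLemma (k !) ((p ∸ k) !) pp p∣d
...   | inj₁ p∣k! = ⊥-elim (prime∤! pp k k<p p∣k!)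
...   | inj₂ p∣!  = ⊥-elim (prime∤! pp (p ∸ k) (ℕₚ.∸-monoʳ-< 0<k (ℕₚ.<⇒≤ k<p)) p∣!)

module FiniteField {q n : ℕ} (F : FieldOfOrder q n) where
  open Setup F public
  open IntegerSolver isCommutativeRing public

  ring : CommutativeRing _ _
  ring = record { isCommutativeRing = isCommutativeRing }

  open CommutativeRing ring public
    using (+-assoc; +-comm; +-identityˡ; +-identityʳ; -‿inverseʳ; -‿inverseˡ;
           *-assoc; *-comm; *-identityˡ; *-identityʳ; distribˡ; distribʳ; zeroˡ; zeroʳ;
           +-isCommutativeMonoid; *-isCommutativeMonoid)
  open Algebra.Properties.Ring (CommutativeRing.ring ring) public
    using (-‿distribˡ-*; -‿distribʳ-*; -0#≈0#; -‿involutive; +-cancelˡ; x∙y⁻¹≈ε⇒x≈y)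

  private
    module M = Algebra.Properties.Semiring.Mult (CommutativeRing.semiring ring)
    module E = Algebra.Properties.Semiring.Exp (CommutativeRing.semiring ring)
    module Sum = Algebra.Properties.Monoid.Sum (CommutativeRing.+-monoid ring)
    module Bin = Algebra.Properties.CommutativeSemiring.Binomial (CommutativeRing.commutativeSemiring ring)

  K-enum : Enumeration K
  K-enum = record { list = elems ; complete = elems-complete ; unique = elems-unique ; _≟_ = _≟_ }

  module EK = Enumeration K-enum

  ≢0? : ∀ x → Dec (x ≢ 0#)
  ≢0? x = ¬? (x ≟ 0#)

  #nonzero : suc (EK.# ≢0?) ≡ q ^ n
  #nonzero = trans (cong (_+ℕ EK.# ≢0?) (sym (EK.#-singleton 0#)))
                   (trans (#-complement elems (_≟ 0#)) elems-card)

  1≢0 : 1# ≢ 0#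
  1≢0 e = 0≢1 (sym e)

  -- Made total by the value `0#` at `0#`, so that quotients can be written down before their
  -- denominators are known to be nonzero.
  inv : K → K
  inv x with x ≟ 0#
  ... | yes _   = 0#
  ... | no  x≢0 = proj₁ (inverse x x≢0)

  inv-inverseʳ : ∀ {x} → x ≢ 0# → x * inv x ≡ 1#
  inv-inverseʳ {x} x≢0 with x ≟ 0#
  ... | yes x≡0 = ⊥-elim (x≢0 x≡0)
  ... | no  x≢0 = proj₂ (inverse x x≢0)

  inv-inverseˡ : ∀ {x} → x ≢ 0# → inv x * x ≡ 1#
  inv-inverseˡ x≢0 = trans (*-comm _ _) (inv-inverseʳ x≢0)

  *-inv-cancel : ∀ {x} y → x ≢ 0# → x * (inv x * y) ≡ y
  *-inv-cancel {x} y x≢0 = trans (sym (*-assoc _ _ _)) (trans (cong (_* y) (inv-inverseʳ x≢0)) (*-identityˡ y))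

  inv-*-cancel : ∀ {x} y → x ≢ 0# → inv x * (x * y) ≡ y
  inv-*-cancel {x} y x≢0 = trans (sym (*-assoc _ _ _)) (trans (cong (_* y) (inv-inverseˡ x≢0)) (*-identityˡ y))

  *-cancelˡ : ∀ {x y z} → x ≢ 0# → x * y ≡ x * z → y ≡ z
  *-cancelˡ {x} {y} {z} x≢0 e = trans (sym (inv-*-cancel y x≢0)) (trans (cong (inv x *_) e) (inv-*-cancel z x≢0))

  *≡0 : ∀ {x y} → x ≢ 0# → x * y ≡ 0# → y ≡ 0#
  *≡0 {x} x≢0 e = *-cancelˡ x≢0 (trans e (sym (zeroʳ x)))

  *-≢0 : ∀ {x y} → x ≢ 0# → y ≢ 0# → x * y ≢ 0#
  *-≢0 x≢0 y≢0 e = y≢0 (*≡0 x≢0 e)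

  inv-≢0 : ∀ {x} → x ≢ 0# → inv x ≢ 0#
  inv-≢0 {x} x≢0 e = 1≢0 (trans (sym (inv-inverseʳ x≢0)) (trans (cong (x *_) e) (zeroʳ x)))

  -‿≢0 : ∀ {x} → x ≢ 0# → - x ≢ 0#
  -‿≢0 {x} x≢0 e = x≢0 (trans (sym (-‿involutive x)) (trans (cong -_ e) -0#≈0#))

  x-y≡0⇒x≡y : ∀ {x y} → x + - y ≡ 0# → x ≡ y
  x-y≡0⇒x≡y {x} {y} = x∙y⁻¹≈ε⇒x≈y x y

  pow-+ : ∀ x i j → pow x (i +ℕ j) ≡ pow x i * pow x j
  pow-+ x zero    j = sym (*-identityˡ _)
  pow-+ x (suc i) j = trans (cong (x *_) (pow-+ x i j)) (sym (*-assoc _ _ _))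

  pow-1 : ∀ i → pow 1# i ≡ 1#
  pow-1 zero    = refl
  pow-1 (suc i) = trans (*-identityˡ _) (pow-1 i)

  pow-distrib-* : ∀ x y i → pow (x * y) i ≡ pow x i * pow y i
  pow-distrib-* x y zero    = sym (*-identityˡ _)
  pow-distrib-* x y (suc i) = trans (cong (x * y *_) (pow-distrib-* x y i))
    (solve 4 (λ x y a b → x :* y :* (a :* b) := x :* a :* (y :* b)) refl x y _ _)

  pow-* : ∀ x i j → pow x (i *ℕ j) ≡ pow (pow x i) j
  pow-* x i zero    = cong (pow x) (ℕₚ.*-zeroʳ i)
  pow-* x i (suc j) = trans (cong (pow x) (ℕₚ.*-suc i j))
    (trans (pow-+ x i (i *ℕ j)) (cong (pow x i *_) (pow-* x i j)))

  pow-≢0 : ∀ {x} i → x ≢ 0# → pow x i ≢ 0#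
  pow-≢0 zero    x≢0 = 1≢0
  pow-≢0 (suc i) x≢0 = *-≢0 x≢0 (pow-≢0 i x≢0)

  pow-0 : ∀ {i} → 0 < i → pow 0# i ≡ 0#
  pow-0 {suc i} _ = zeroˡ _

  module _ {_∙_ : K → K → K} {ε : K} (isCM : IsCommutativeMonoid _≡_ _∙_ ε) where

    fold-bijection : ∀ {xs} → Unique xs → (φ : K → K) → (∀ {x y} → φ x ≡ φ y → x ≡ y) →
                     (∀ {x} → x ∈ xs → φ x ∈ xs) → (∀ {y} → y ∈ xs → ∃ λ x → x ∈ xs × y ≡ φ x) →
                     foldr _∙_ ε (map φ xs) ≡ foldr _∙_ ε xs
    fold-bijection {xs} u φ inj into onto =
      ↭ₛ.foldr-commMonoid (setoid K) isCM (↭⇒↭ₛ (unique-↭ (Uniqueₚ.map⁺ inj u) u ⊆ ⊇))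
      where
      ⊆ : ∀ {v} → v ∈ map φ xs → v ∈ xs
      ⊆ v∈ with _ , x∈xs , refl ← ∈-map⁻ φ v∈ = into x∈xs
      ⊇ : ∀ {v} → v ∈ xs → v ∈ map φ xs
      ⊇ v∈ with _ , x∈xs , refl ← onto v∈ = ∈-map⁺ φ x∈xs

  private
    nonzeros : List K
    nonzeros = filter ≢0? elems

    ∏ : List K → K
    ∏ = foldr _*_ 1#

    ∏-map-* : ∀ x ys → ∏ (map (x *_) ys) ≡ pow x (length ys) * ∏ ys
    ∏-map-* x []       = sym (*-identityˡ _)
    ∏-map-* x (y ∷ ys) = trans (cong (x * y *_) (∏-map-* x ys))
      (solve 4 (λ x y a b → x :* y :* (a :* b) := x :* a :* (y :* b)) refl x y _ _)

    ∏-nonzero : ∀ ys → (∀ {y} → y ∈ ys → y ≢ 0#) → ∏ ys ≢ 0#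
    ∏-nonzero []       ne = 1≢0
    ∏-nonzero (y ∷ ys) ne = *-≢0 (ne (here refl)) (∏-nonzero ys (λ m → ne (there m)))

    nonzero⁻ : ∀ {y} → y ∈ nonzeros → y ≢ 0#
    nonzero⁻ m = proj₂ (∈-filter⁻ ≢0? {xs = elems} m)

    nonzero⁺ : ∀ {y} → y ≢ 0# → y ∈ nonzeros
    nonzero⁺ y≢0 = ∈-filter⁺ ≢0? (elems-complete _) y≢0

  -- Multiplication by `x` permutes the nonzero elements, so their product is multiplied by a power
  -- of `x` and yet unchanged.
  pow-#nonzero : ∀ {x} → x ≢ 0# → pow x (EK.# ≢0?) ≡ 1#
  pow-#nonzero {x} x≢0 = *-cancelˡ (∏-nonzero nonzeros nonzero⁻) (begin
    ∏ nonzeros * pow x (length nonzeros)  ≡⟨ *-comm _ _ ⟩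
    pow x (length nonzeros) * ∏ nonzeros  ≡⟨ sym (∏-map-* x nonzeros) ⟩
    ∏ (map (x *_) nonzeros)  ≡⟨ fold-bijection *-isCommutativeMonoid (Uniqueₚ.filter⁺ ≢0? elems-unique)
                    (x *_) (*-cancelˡ x≢0) (λ m → nonzero⁺ (*-≢0 x≢0 (nonzero⁻ m)))
                    (λ {y} m → inv x * y , nonzero⁺ (*-≢0 (inv-≢0 x≢0) (nonzero⁻ m)) , sym (*-inv-cancel y x≢0)) ⟩
    ∏ nonzeros  ≡⟨ sym (*-identityʳ _) ⟩
    ∏ nonzeros * 1#  ∎)
    where open ≡-Reasoning

  fermat : ∀ x → pow x (q ^ n) ≡ x
  fermat x with x ≟ 0#
  ... | yes refl = trans (cong (pow 0#) (sym #nonzero)) (zeroˡ _)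
  ... | no  x≢0  = trans (cong (pow x) (sym #nonzero)) (trans (cong (x *_) (pow-#nonzero x≢0)) (*-identityʳ x))

  private
    ∑ : List K → K
    ∑ = foldr _+_ 0#

    ∑-map-1+ : ∀ ys → ∑ (map (1# +_) ys) ≡ length ys M.× 1# + ∑ ys
    ∑-map-1+ []       = sym (+-identityˡ _)
    ∑-map-1+ (y ∷ ys) = trans (cong (1# + y +_) (∑-map-1+ ys))
      (solve 4 (λ x y a b → x :+ y :+ (a :+ b) := x :+ a :+ (y :+ b)) refl 1# y _ _)

    shift : ∀ y → 1# + (- 1# + y) ≡ y
    shift y = solve 1 (λ y → :1 :+ ((:- :1) :+ y) := y) refl y

    -- The translation y ↦ 1 + y permutes K, so the sum of all elements equals itself plus `q ^ n`
    -- copies of 1. Together with `^×1≡0` this determines the characteristic.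
    q^n×1≡0 : (q ^ n) M.× 1# ≡ 0#
    q^n×1≡0 = begin
      (q ^ n) M.× 1#  ≡⟨ cong (M._× 1#) (sym elems-card) ⟩
      k  ≡⟨ solve 2 (λ k s → k := k :+ s :+ (:- s)) refl k (∑ elems) ⟩
      k + ∑ elems + - ∑ elems  ≡⟨ cong (_+ - ∑ elems) (sym (∑-map-1+ elems)) ⟩
      ∑ (map (1# +_) elems) + - ∑ elems  ≡⟨ cong (_+ - ∑ elems) (fold-bijection +-isCommutativeMonoid elems-unique
                    (1# +_) (+-cancelˡ 1# _ _) (λ _ → elems-complete _)
                    (λ {y} _ → - 1# + y , elems-complete _ , sym (shift y))) ⟩
      ∑ elems + - ∑ elems  ≡⟨ -‿inverseʳ _ ⟩
      0#  ∎
      where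
      open ≡-Reasoning
      k = length elems M.× 1#

    ^×1≡0 : ∀ m i → (m ^ i) M.× 1# ≡ 0# → m M.× 1# ≡ 0#
    ^×1≡0 m zero    e = ⊥-elim (1≢0 (trans (sym (+-identityʳ 1#)) e))
    ^×1≡0 m (suc i) e with (m M.× 1#) ≟ 0#
    ... | yes z  = z
    ... | no  nz = ^×1≡0 m i (*≡0 nz (trans (sym (M.×1-homo-* m (m ^ i))) e))

    pow≡^ : ∀ x i → pow x i ≡ x E.^ i
    pow≡^ x zero    = refl
    pow≡^ x (suc i) = cong (x *_) (pow≡^ x i)

  module _ {p k : ℕ} (prime : Prime p) (q≡p^ : q ≡ p ^ suc k) where

    private
      p×1≡0 : p M.× 1# ≡ 0#
      p×1≡0 = ^×1≡0 p (suc k *ℕ n) (trans (cong (M._× 1#) (trans (sym (ℕₚ.^-*-assoc p (suc k) n)) (cong (_^ n) (sym q≡p^)))) q^n×1≡0)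

      p∣⇒×≡0 : ∀ {m} → p ∣ m → ∀ x → m M.× x ≡ 0#
      p∣⇒×≡0 (divides d refl) x = begin
        (d *ℕ p) M.× x  ≡⟨ cong ((d *ℕ p) M.×_) (sym (*-identityˡ x)) ⟩
        (d *ℕ p) M.× (1# * x)  ≡⟨ sym (M.×-assoc-* (d *ℕ p) 1# x) ⟩
        ((d *ℕ p) M.× 1#) * x  ≡⟨ cong (_* x) (M.×1-homo-* d p) ⟩
        (d M.× 1#) * (p M.× 1#) * x  ≡⟨ cong (λ z → (d M.× 1#) * z * x) p×1≡0 ⟩
        (d M.× 1#) * 0# * x  ≡⟨ cong (_* x) (zeroʳ _) ⟩
        0# * x  ≡⟨ zeroˡ x ⟩
        0#  ∎
        where open ≡-Reasoning

    -- The inner binomial coefficients are multiples of p, and p · 1 = 0 in K.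
    pow-p-+ : ∀ x y → pow (x + y) p ≡ pow x p + pow y p
    pow-p-+ x y = helper p prime (λ 0<k k<p → p∣⇒×≡0 (prime∣C prime 0<k k<p))
      where
      open ≡-Reasoning
      -- The exponent becomes a variable `m` so that it can be matched against a successor, as the
      -- indexing of the binomial sum requires; what is known of p enters through `z`.
      helper : ∀ m → Prime m → (∀ {k} → 0 < k → k < m → ∀ x → (m C k) M.× x ≡ 0#) → pow (x + y) m ≡ pow x m + pow y m
      helper zero    pr z = ⊥-elim (¬prime[0] pr)
      helper (suc m) pr z = begin
        pow (x + y) (suc m)  ≡⟨ pow≡^ _ (suc m) ⟩
        (x + y) E.^ suc m  ≡⟨ Bin.theorem (suc m) x y ⟩
        t fzero + Sum.sum (t ∘ fsuc)  ≡⟨ cong (t fzero +_) (Sum.sum-init-last (t ∘ fsuc)) ⟩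
        t fzero + (Sum.sum (λ i → t (fsuc (inject₁ i))) + t (fsuc (fromℕ m)))
          ≡⟨ cong₂ _+_ first (cong₂ _+_ (trans (Sum.sum-cong-≗ middle) (Sum.sum-replicate-zero m)) last) ⟩
        pow y (suc m) + (0# + pow x (suc m))  ≡⟨ solve 2 (λ a b → b :+ (:0 :+ a) := a :+ b) refl _ _ ⟩
        pow x (suc m) + pow y (suc m)  ∎
        where
        t : Fin (suc (suc m)) → K
        t = Bin.binomialTerm x y (suc m)
        first : t fzero ≡ pow y (suc m)
        first = trans (+-identityʳ _) (trans (*-identityˡ _) (sym (pow≡^ y (suc m))))
        middle : ∀ i → t (fsuc (inject₁ i)) ≡ 0#
        middle i = z (s≤s z≤n) (s≤s (subst (_< m) (sym (Finₚ.toℕ-inject₁ i)) (Finₚ.toℕ<n i))) _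
        last : t (fsuc (fromℕ m)) ≡ pow x (suc m)
        last = trans (cong (λ j → (suc m C j) M.× (x E.^ j * y E.^ (suc m ∸ j))) (cong suc (Finₚ.toℕ-fromℕ m)))
          (trans (cong₂ (λ c d → c M.× (x E.^ suc m * y E.^ d)) (nCn≡1 (suc m)) (ℕₚ.n∸n≡0 m))
            (trans (+-identityʳ _) (trans (*-identityʳ _) (sym (pow≡^ x (suc m))))))

    pow-p^-+ : ∀ i x y → pow (x + y) (p ^ i) ≡ pow x (p ^ i) + pow y (p ^ i)
    pow-p^-+ zero    x y = trans (*-identityʳ _) (cong₂ _+_ (sym (*-identityʳ x)) (sym (*-identityʳ y)))
    pow-p^-+ (suc i) x y = begin
      pow (x + y) (p *ℕ p ^ i)  ≡⟨ pow-* _ p (p ^ i) ⟩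
      pow (pow (x + y) p) (p ^ i)  ≡⟨ cong (λ z → pow z (p ^ i)) (pow-p-+ x y) ⟩
      pow (pow x p + pow y p) (p ^ i)  ≡⟨ pow-p^-+ i _ _ ⟩
      pow (pow x p) (p ^ i) + pow (pow y p) (p ^ i) ≡⟨ cong₂ _+_ (sym (pow-* x p (p ^ i))) (sym (pow-* y p (p ^ i))) ⟩
      pow x (p *ℕ p ^ i) + pow y (p *ℕ p ^ i)  ∎
      where open ≡-Reasoning

    pow-q-+ : ∀ x y → pow (x + y) q ≡ pow x q + pow y q
    pow-q-+ x y = subst (λ m → pow (x + y) m ≡ pow x m + pow y m) (sym q≡p^) (pow-p^-+ (suc k) x y)

-- Polynomials and multi-affine functions

module Polynomials {q n : ℕ} (F : FieldOfOrder q n) where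
  open FiniteField F

  -- Coefficient lists start with the constant term.
  eval : List K → K → K
  eval []       x = 0#
  eval (c ∷ cs) x = c + x * eval cs x

  -- Horner values of the proper tails: the coefficients of (f(x) − f(r)) / (x − r), up to the head of cs.
  hornerTails : K → List K → List K
  hornerTails r []       = []
  hornerTails r (c ∷ cs) = eval (c ∷ cs) r ∷ hornerTails r cs

  length-hornerTails : ∀ r cs → length (hornerTails r cs) ≡ length cs
  length-hornerTails r []       = refl
  length-hornerTails r (c ∷ cs) = cong suc (length-hornerTails r cs)

  -- Synthetic division by X - r, with the value at r as remainder.
  factor : ∀ r c cs x → eval (c ∷ cs) x ≡ eval (c ∷ cs) r + (x + - r) * eval (hornerTails r cs) x
  factor r c []       x = solve 3 (λ r c x → c :+ x :* :0 := c :+ r :* :0 :+ (x :+ :- r) :* :0) refl r c x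
  factor r c (d ∷ cs) x = trans (cong (λ z → c + x * z) (factor r d cs x))
    (solve 5 (λ r c x e t → c :+ x :* (e :+ (x :+ :- r) :* t) := c :+ r :* e :+ (x :+ :- r) :* (e :+ x :* t))
       refl r c x (eval (d ∷ cs) r) (eval (hornerTails r cs) x))

  hornerTails-zero : ∀ r cs → All (_≡ 0#) (hornerTails r cs) → All (_≡ 0#) cs
  hornerTails-zero r []           []       = []
  hornerTails-zero r (c ∷ [])     (e ∷ es) = trans (solve 2 (λ c r → c := c :+ r :* :0) refl c r) e ∷ []
  hornerTails-zero r (c ∷ d ∷ cs) (e ∷ es@(e′ ∷ _)) =
    trans (solve 2 (λ c r → c := c :+ r :* :0) refl c r) (trans (cong (λ z → c + r * z) (sym e′)) e) ∷ hornerTails-zero r (d ∷ cs) es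

  eval-zero : ∀ {cs} → All (_≡ 0#) cs → ∀ x → eval cs x ≡ 0#
  eval-zero []          x = refl
  eval-zero (refl ∷ zs) x = trans (+-identityˡ _) (trans (cong (x *_) (eval-zero zs x)) (zeroʳ x))

  -- Division by X - r removes one coefficient and one root; the remaining roots pass to the
  -- quotient because they differ from r.
  roots⇒zero : ∀ cs rs → Unique rs → length cs ≤ length rs → (∀ {r} → r ∈ rs → eval cs r ≡ 0#) → All (_≡ 0#) cs
  roots⇒zero []       rs       u            le root = []
  roots⇒zero (c ∷ cs) (r ∷ rs) (r∉rs ∷ u) (s≤s le) root = c≡0 ∷ cs≡0
    where
    open import Data.List.Relation.Unary.Any using (here; there)
    tails-root : ∀ {x} → x ∈ rs → eval (hornerTails r cs) x ≡ 0#
    tails-root {x} x∈ = *≡0 (λ e → All.lookup r∉rs x∈ (sym (x-y≡0⇒x≡y e)))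
      (trans (sym (+-identityˡ _)) (trans (cong (_+ (x + - r) * eval (hornerTails r cs) x) (sym (root (here refl))))
        (trans (sym (factor r c cs x)) (root (there x∈)))))
    cs≡0 : All (_≡ 0#) cs
    cs≡0 = hornerTails-zero r cs (roots⇒zero (hornerTails r cs) rs u
             (subst (_≤ length rs) (sym (length-hornerTails r cs)) le) tails-root)
    c≡0 : c ≡ 0#
    c≡0 = trans (solve 2 (λ c r → c := c :+ r :* :0) refl c r)
            (trans (cong (λ z → c + r * z) (sym (eval-zero cs≡0 r))) (root (here refl)))

  eval-++ : ∀ as bs x → eval (as ++ bs) x ≡ eval as x + pow x (length as) * eval bs x
  eval-++ []       bs x = solve 1 (λ b → b := :0 :+ :1 :* b) refl _
  eval-++ (a ∷ as) bs x = trans (cong (λ z → a + x * z) (eval-++ as bs x))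
    (solve 5 (λ a x e p b → a :+ x :* (e :+ p :* b) := a :+ x :* e :+ x :* p :* b) refl a x _ _ _)

  replicate-zero : ∀ k → All (_≡ 0#) (replicate k 0#)
  replicate-zero k = Allₚ.replicate⁺ k refl

  -- As a list, X^k - c has k + 1 coefficients, so k + 1 roots would annihilate all of them, the
  -- leading 1 included.
  #roots-pow : ∀ {k} c → 0 < k → EK.# (λ x → pow x k ≟ c) ≤ k
  #roots-pow {suc k} c _ with suc (suc k) ℕ.≤? length (filter (λ x → pow x (suc k) ≟ c) elems)
  ... | no  ¬le = ℕₚ.≤-pred (ℕₚ.≰⇒> ¬le)
  ... | yes le  = ⊥-elim (1≢0 (All.head (Allₚ.++⁻ʳ (replicate k 0#) (All.tail all-zero))))
    where
    cs : List K
    cs = - c ∷ replicate k 0# ++ 1# ∷ []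
    open import Data.List.Membership.Propositional.Properties using (∈-filter⁻)
    root : ∀ {r} → r ∈ filter (λ x → pow x (suc k) ≟ c) elems → eval cs r ≡ 0#
    root {r} r∈ = begin
      - c + r * eval (replicate k 0# ++ 1# ∷ []) r
        ≡⟨ cong (λ z → - c + r * z) (eval-++ (replicate k 0#) (1# ∷ []) r) ⟩
      - c + r * (eval (replicate k 0#) r + pow r (length (replicate k 0#)) * (1# + r * 0#))
        ≡⟨ cong₂ (λ y z → - c + r * (y + pow r z * (1# + r * 0#))) (eval-zero (replicate-zero k) r) (Listₚ.length-replicate k) ⟩
      - c + r * (0# + pow r k * (1# + r * 0#))
        ≡⟨ solve 3 (λ c r p → :- c :+ r :* (:0 :+ p :* (:1 :+ r :* :0)) := r :* p :+ :- c) refl c r (pow r k) ⟩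
      pow r (suc k) + - c
        ≡⟨ cong (_+ - c) (proj₂ (∈-filter⁻ (λ x → pow x (suc k) ≟ c) {xs = elems} r∈)) ⟩
      c + - c ≡⟨ -‿inverseʳ c ⟩
      0# ∎
      where open ≡-Reasoning
    all-zero : All (_≡ 0#) cs
    all-zero = roots⇒zero cs _ (Uniqueₚ.filter⁺ _ elems-unique)
      (subst (_≤ length (filter (λ x → pow x (suc k) ≟ c) elems))
        (sym (cong suc (trans (Listₚ.length-++ (replicate k 0#))
           (trans (cong (_+ℕ 1) (Listₚ.length-replicate k)) (ℕₚ.+-comm k 1))))) le) root

  -- Functions of many variables that are affine in each variable

  infixl 9 _[_≔_]
  _[_≔_] : (ℕ → K) → ℕ → K → ℕ → K
  (v [ i ≔ t ]) j with j ℕ.≟ i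
  ... | yes _ = t
  ... | no  _ = v j

  ≔-same : ∀ v i {t} → (v [ i ≔ t ]) i ≡ t
  ≔-same v i with i ℕ.≟ i
  ... | yes _  = refl
  ... | no i≢i = ⊥-elim (i≢i refl)

  ≔-other : ∀ v {i j t} → j ≢ i → (v [ i ≔ t ]) j ≡ v j
  ≔-other v {i} {j} j≢i with j ℕ.≟ i
  ... | yes j≡i = ⊥-elim (j≢i j≡i)
  ... | no  _   = refl

  ≔-self : ∀ v i j → v j ≡ (v [ i ≔ v i ]) j
  ≔-self v i j with j ℕ.≟ i
  ... | yes refl = refl
  ... | no  _    = refl

  ≔-comm : ∀ v {i k s t} → i ≢ k → ∀ j → (v [ i ≔ t ] [ k ≔ s ]) j ≡ (v [ k ≔ s ] [ i ≔ t ]) j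
  ≔-comm v {i} {k} {s} {t} i≢k j = cases (j ℕ.≟ i) (j ℕ.≟ k)
    where
    cases : Dec (j ≡ i) → Dec (j ≡ k) → (v [ i ≔ t ] [ k ≔ s ]) j ≡ (v [ k ≔ s ] [ i ≔ t ]) j
    cases (yes refl) (yes refl) = ⊥-elim (i≢k refl)
    cases (yes refl) (no j≢k)   = trans (≔-other (v [ j ≔ t ]) j≢k) (trans (≔-same v j) (sym (≔-same (v [ k ≔ s ]) j)))
    cases (no j≢i)   (yes refl) = trans (≔-same (v [ i ≔ t ]) j) (sym (trans (≔-other (v [ j ≔ s ]) j≢i) (≔-same v j)))
    cases (no j≢i)   (no j≢k)   = trans (≔-other (v [ i ≔ t ]) j≢k) (trans (≔-other v j≢i)
                    (sym (trans (≔-other (v [ k ≔ s ]) j≢i) (≔-other v j≢k))))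

  -- Degree at most one in the coordinate `i`, phrased through the values at 0 and 1 so that it
  -- applies to functions given without a polynomial expression.
  record AffineAt (i : ℕ) (G : (ℕ → K) → K) : Set where
    constructor affineAt
    field
      affineAt-≔ : ∀ v t → G (v [ i ≔ t ]) ≡ G (v [ i ≔ 0# ]) + t * (G (v [ i ≔ 1# ]) + - G (v [ i ≔ 0# ]))

  open AffineAt public

  record MultiAffine (k : ℕ) (G : (ℕ → K) → K) : Set where
    field
      ext    : ∀ {v w} → (∀ i → i < k → v i ≡ w i) → G v ≡ G w
      affine : ∀ {i} → i < k → AffineAt i G

  open MultiAffine

  -- For `G` affine in the coordinate `k` this is the coefficient of that coordinate.
  Δ : ℕ → ((ℕ → K) → K) → (ℕ → K) → K
  Δ k G v = G (v [ k ≔ 1# ]) + - G (v [ k ≔ 0# ])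

  module _ {k G} (ma : MultiAffine (suc k) G) where

    private
      ext-≔ : ∀ {v w s} → (∀ i → i < k → v i ≡ w i) → G (v [ k ≔ s ]) ≡ G (w [ k ≔ s ])
      ext-≔ {v} {w} eq = ext ma λ i i<1+k → pointwise i i<1+k
        where
        pointwise : ∀ i → i < suc k → (v [ k ≔ _ ]) i ≡ (w [ k ≔ _ ]) i
        pointwise i i<1+k with i ℕ.≟ k
        ... | yes _   = refl
        ... | no  i≢k = eq i (ℕₚ.≤∧≢⇒< (ℕₚ.≤-pred i<1+k) i≢k)

      affine-≔ : ∀ {i} → i < k → ∀ s v t → G (v [ i ≔ t ] [ k ≔ s ]) ≡
                 G (v [ i ≔ 0# ] [ k ≔ s ]) + t * (G (v [ i ≔ 1# ] [ k ≔ s ]) + - G (v [ i ≔ 0# ] [ k ≔ s ]))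
      affine-≔ {i} i<k s v t = begin
        G (v [ i ≔ t ] [ k ≔ s ])  ≡⟨ comm t ⟩
        G (v [ k ≔ s ] [ i ≔ t ])  ≡⟨ affineAt-≔ (affine ma (ℕₚ.m≤n⇒m≤1+n i<k)) (v [ k ≔ s ]) t ⟩
        G (v [ k ≔ s ] [ i ≔ 0# ]) + t * (G (v [ k ≔ s ] [ i ≔ 1# ]) + - G (v [ k ≔ s ] [ i ≔ 0# ]))
          ≡⟨ cong₂ (λ y z → y + t * (z + - y)) (sym (comm 0#)) (sym (comm 1#)) ⟩
        _ ∎
        where
        open ≡-Reasoning
        comm : ∀ t → G (v [ i ≔ t ] [ k ≔ s ]) ≡ G (v [ k ≔ s ] [ i ≔ t ])
        comm t = ext ma (λ j _ → ≔-comm v (ℕₚ.<⇒≢ i<k) j)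

    restrict-MultiAffine : ∀ s → MultiAffine k (λ v → G (v [ k ≔ s ]))
    restrict-MultiAffine s = record { ext = ext-≔ ; affine = λ i<k → affineAt (affine-≔ i<k s) }

    Δ-MultiAffine : MultiAffine k (Δ k G)
    Δ-MultiAffine = record
      { ext    = λ eq → cong₂ (λ y z → y + - z) (ext-≔ eq) (ext-≔ eq)
      ; affine = λ i<k → affineAt λ v t → trans (cong₂ (λ y z → y + - z) (affine-≔ i<k 1# v t) (affine-≔ i<k 0# v t))
          (solve 5 (λ t a b c d → a :+ t :* (b :+ :- a) :+ :- (c :+ t :* (d :+ :- c))
                    := a :+ :- c :+ t :* (b :+ :- d :+ :- (a :+ :- c))) refl t _ _ _ _) }

    expand : ∀ v → G v ≡ G (v [ k ≔ 0# ]) + v k * Δ k G v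
    expand v = trans (ext ma (λ i _ → ≔-self v k i)) (affineAt-≔ (affine ma ℕₚ.≤-refl) v (v k))

  -- For a multi-affine `G`, the coefficient of the product of all `k` variables. After the
  -- substitution v_i = X^(q^i) this is the only monomial of degree `geom k`; all others have
  -- smaller degree.
  topCoeff : ℕ → ((ℕ → K) → K) → K
  topCoeff zero    G = G (λ _ → 0#)
  topCoeff (suc k) G = topCoeff k (Δ k G)

  topCoeff-linear : ∀ k a b (G H : (ℕ → K) → K) →
                    topCoeff k (λ v → a * G v + - (b * H v)) ≡ a * topCoeff k G + - (b * topCoeff k H)
  topCoeff-linear zero    a b G H = refl
  topCoeff-linear (suc k) a b G H = trans (topCoeff-cong k λ v →
      solve 6 (λ a b g g′ h h′ → a :* g :+ :- (b :* h) :+ :- (a :* g′ :+ :- (b :* h′)) := a :* (g :+ :- g′) :+ :- (b :* (h :+ :- h′)))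
        refl a b _ _ _ _)
    (topCoeff-linear k a b (Δ k G) (Δ k H))
    where
    topCoeff-cong : ∀ k {G H} → (∀ v → G v ≡ H v) → topCoeff k G ≡ topCoeff k H
    topCoeff-cong zero    eq = eq _
    topCoeff-cong (suc k) eq = topCoeff-cong k (λ v → cong₂ (λ y z → y + - z) (eq _) (eq _))

  module _ (2≤q : 2 ≤ q) where

    -- The part of a multi-affine function without v_k has degree at most `geom k` in X, so it stays
    -- below X^(q^k), where the multiples of v_k begin.
    geom<q^ : ∀ k → geom k < q ^ k
    geom<q^ zero    = ℕₚ.≤-refl
    geom<q^ (suc k) = ℕₚ.≤-trans (ℕₚ.+-monoˡ-≤ (q ^ k) (geom<q^ k))
      (ℕₚ.≤-trans (ℕₚ.≤-reflexive (cong (q ^ k +ℕ_) (sym (ℕₚ.+-identityʳ _)))) (ℕₚ.*-monoˡ-≤ (q ^ k) 2≤q))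

    -- Filled up to `q ^ k` entries, so that appending a list of coefficients adds its polynomial
    -- times X^(q^k).
    padded : ℕ → List K → List K
    padded k cs = cs ++ replicate (q ^ k ∸ length cs) 0#

    -- The coefficients of G(X, X^q, …, X^{q^{k−1}}), a polynomial in X of degree at most geom k:
    -- the lower ones, and, in front of topCoeff, all of them.
    lowerCoeffs : ℕ → ((ℕ → K) → K) → List K
    coeffs      : ℕ → ((ℕ → K) → K) → List K
    lowerCoeffs zero    G = []
    lowerCoeffs (suc k) G = padded k (coeffs k (λ v → G (v [ k ≔ 0# ]))) ++ lowerCoeffs k (Δ k G)
    coeffs k G = lowerCoeffs k G ++ topCoeff k G ∷ []

    length-lowerCoeffs : ∀ k G → length (lowerCoeffs k G) ≡ geom k
    length-coeffs : ∀ k G → length (coeffs k G) ≡ suc (geom k)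
    length-padded : ∀ k G → length (padded k (coeffs k G)) ≡ q ^ k
    length-lowerCoeffs zero    G = refl
    length-lowerCoeffs (suc k) G = trans (Listₚ.length-++ (padded k (coeffs k (λ v → G (v [ k ≔ 0# ])))))
      (trans (cong₂ _+ℕ_ (length-padded k _) (length-lowerCoeffs k _)) (ℕₚ.+-comm (q ^ k) (geom k)))
    length-coeffs k G = trans (Listₚ.length-++ (lowerCoeffs k G))
      (trans (cong (_+ℕ 1) (length-lowerCoeffs k G)) (ℕₚ.+-comm _ 1))
    length-padded k G = trans (Listₚ.length-++ (coeffs k G))
      (trans (cong (length (coeffs k G) +ℕ_) (Listₚ.length-replicate (q ^ k ∸ length (coeffs k G))))
        (ℕₚ.m+[n∸m]≡n (subst (_≤ q ^ k) (sym (length-coeffs k G)) (geom<q^ k))))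

    powers : K → ℕ → K
    powers m i = pow m (q ^ i)

    eval-coeffs : ∀ k {G} → MultiAffine k G → ∀ m → eval (coeffs k G) m ≡ G (powers m)
    eval-coeffs zero    {G} ma m = trans (solve 2 (λ c m → c :+ m :* :0 := c) refl _ m) (ext ma λ _ ())
    eval-coeffs (suc k) {G} ma m = begin
      eval ((padded k G₀ ++ lowerCoeffs k (Δ k G)) ++ topCoeff k (Δ k G) ∷ []) m
        ≡⟨ cong (λ l → eval l m) (Listₚ.++-assoc (padded k G₀) _ _) ⟩
      eval (padded k G₀ ++ coeffs k (Δ k G)) m
        ≡⟨ eval-++ (padded k G₀) _ m ⟩
      eval (padded k G₀) m + pow m (length (padded k G₀)) * eval (coeffs k (Δ k G)) m
        ≡⟨ cong₂ _+_ (trans (eval-++ G₀ _ m) (trans (cong (λ z → eval G₀ m + pow m (length G₀) * z) (eval-zero (replicate-zero (q ^ k ∸ length G₀)) m))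
              (solve 2 (λ e p → e :+ p :* :0 := e) refl _ _)))
            (cong₂ _*_ (cong (pow m) (length-padded k _)) (eval-coeffs k (Δ-MultiAffine ma) m)) ⟩
      eval G₀ m + pow m (q ^ k) * Δ k G (powers m)
        ≡⟨ cong (_+ pow m (q ^ k) * Δ k G (powers m)) (eval-coeffs k (restrict-MultiAffine ma 0#) m) ⟩
      G (powers m [ k ≔ 0# ]) + pow m (q ^ k) * Δ k G (powers m)
        ≡⟨ sym (expand ma (powers m)) ⟩
      G (powers m) ∎
      where
      open ≡-Reasoning
      G₀ = coeffs k (λ v → G (v [ k ≔ 0# ]))

    -- Distinct squarefree monomials in v become distinct powers of X, because sums of distinct
    -- powers of q are distinct for q ≥ 2. No two coefficients are merged by the substitution, so a
    -- zero polynomial in X can only come from the zero function of v.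
    coeffs-zero : ∀ k {G} → MultiAffine k G → All (_≡ 0#) (coeffs k G) → ∀ v → G v ≡ 0#
    coeffs-zero zero    ma (e ∷ []) v = trans (ext ma λ _ ()) e
    coeffs-zero (suc k) {G} ma zs v = trans (expand ma v)
      (trans (cong₂ (λ y z → y + v k * z) (coeffs-zero k (restrict-MultiAffine ma 0#) (Allₚ.++⁻ˡ _ lower) v)
                    (coeffs-zero k (Δ-MultiAffine ma) upper v))
        (trans (+-identityˡ _) (zeroʳ _)))
      where
      zs′ : All (_≡ 0#) (padded k (coeffs k (λ v → G (v [ k ≔ 0# ]))) ++ coeffs k (Δ k G))
      zs′ = subst (All (_≡ 0#)) (Listₚ.++-assoc (padded k (coeffs k (λ v → G (v [ k ≔ 0# ])))) _ _) zs
      lower = Allₚ.++⁻ˡ (padded k (coeffs k (λ v → G (v [ k ≔ 0# ])))) zs′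
      upper = Allₚ.++⁻ʳ (padded k (coeffs k (λ v → G (v [ k ≔ 0# ])))) zs′

    -- Without its top coefficient the polynomial in X has only `geom k` coefficients, so `geom k`
    -- roots kill it. The gain is in the conclusion, which concerns independent variables instead of
    -- the powers of one element.
    multiAffine-vanishing : ∀ {k G} → MultiAffine k G → topCoeff k G ≡ 0# →
      ∀ ms → Unique ms → geom k ≤ length ms → (∀ {m} → m ∈ ms → G (powers m) ≡ 0#) → ∀ v → G v ≡ 0#
    multiAffine-vanishing {k} {G} ma top≡0 ms u le vanish =
      coeffs-zero k ma (Allₚ.++⁺ (roots⇒zero (lowerCoeffs k G) ms u
        (subst (_≤ length ms) (sym (length-lowerCoeffs k G)) le) root) (top≡0 ∷ []))
      where
      root : ∀ {m} → m ∈ ms → eval (lowerCoeffs k G) m ≡ 0#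
      root {m} m∈ = begin
        eval (lowerCoeffs k G) m
          ≡⟨ solve 3 (λ e p m → e := e :+ p :* (:0 :+ m :* :0)) refl _ (pow m (length (lowerCoeffs k G))) m ⟩
        eval (lowerCoeffs k G) m + pow m (length (lowerCoeffs k G)) * (0# + m * 0#)
          ≡⟨ cong (λ z → eval (lowerCoeffs k G) m + pow m (length (lowerCoeffs k G)) * (z + m * 0#)) (sym top≡0) ⟩
        eval (lowerCoeffs k G) m + pow m (length (lowerCoeffs k G)) * eval (topCoeff k G ∷ []) m
          ≡⟨ sym (eval-++ (lowerCoeffs k G) _ m) ⟩
        eval (coeffs k G) m  ≡⟨ eval-coeffs k ma m ⟩
        G (powers m)  ≡⟨ vanish m∈ ⟩
        0#  ∎
        where open ≡-Reasoning

-- Frobenius powers and the norm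

module Galois {q n : ℕ} (F : FieldOfOrder q n) 
  {p k : ℕ} (prime : Prime p) (q≡p^ : q ≡ p ^ suc k) (0<n : 0 < n) where
  open FiniteField F
  open Polynomials F

  2≤q : 2 ≤ q
  2≤q = subst (2 ≤_) (sym q≡p^) (ℕₚ.≤-trans (ℕ.nonTrivial⇒n>1 p) (ℕₚ.≤-trans (ℕₚ.≤-reflexive (sym (ℕₚ.*-identityʳ p)))
          (ℕₚ.*-monoʳ-≤ p (ℕₚ.m^n>0 p k))))
    where instance
      _ = prime⇒nonTrivial prime
      _ = ℕ.nonTrivial⇒nonZero p

  0<q : 0 < q
  0<q = ℕₚ.≤-trans (s≤s z≤n) 2≤q

  instance
    q-nonZero : NonZero q
    q-nonZero = >-nonZero 0<q

  φ : ℕ → K → K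
  φ i x = pow x (q ^ i)

  φ-zero : ∀ x → φ 0 x ≡ x
  φ-zero x = *-identityʳ x

  φ-suc : ∀ i x → φ (suc i) x ≡ φ i (pow x q)
  φ-suc i x = pow-* x q (q ^ i)

  φ-∘ : ∀ i j x → φ i (φ j x) ≡ φ (i +ℕ j) x
  φ-∘ i j x = trans (sym (pow-* x (q ^ j) (q ^ i)))
    (cong (pow x) (trans (sym (ℕₚ.^-distribˡ-+-* q j i)) (cong (q ^_) (ℕₚ.+-comm j i))))

  φ-* : ∀ i x y → φ i (x * y) ≡ φ i x * φ i y
  φ-* i x y = pow-distrib-* x y (q ^ i)

  φ-1 : ∀ i → φ i 1# ≡ 1#
  φ-1 i = pow-1 (q ^ i)

  φ-0 : ∀ i → φ i 0# ≡ 0#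
  φ-0 i = pow-0 (ℕₚ.m^n>0 q i)

  φ-+ : ∀ i x y → φ i (x + y) ≡ φ i x + φ i y
  φ-+ zero    x y = trans (φ-zero _) (cong₂ _+_ (sym (φ-zero x)) (sym (φ-zero y)))
  φ-+ (suc i) x y = begin
    φ (suc i) (x + y)  ≡⟨ φ-suc i _ ⟩
    φ i (pow (x + y) q)  ≡⟨ cong (φ i) (pow-q-+ {k = k} prime q≡p^ x y) ⟩
    φ i (pow x q + pow y q)  ≡⟨ φ-+ i _ _ ⟩
    φ i (pow x q) + φ i (pow y q)  ≡⟨ cong₂ _+_ (sym (φ-suc i x)) (sym (φ-suc i y)) ⟩
    φ (suc i) x + φ (suc i) y  ∎
    where open ≡-Reasoning

  φ-neg : ∀ i x → φ i (- x) ≡ - φ i x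
  φ-neg i x = begin
    φ i (- x)  ≡⟨ solve 2 (λ a b → a := a :+ b :+ :- b) refl _ (φ i x) ⟩
    φ i (- x) + φ i x + - φ i x  ≡⟨ cong (_+ - φ i x) (sym (φ-+ i (- x) x)) ⟩
    φ i (- x + x) + - φ i x  ≡⟨ cong (λ z → φ i z + - φ i x) (-‿inverseˡ x) ⟩
    φ i 0# + - φ i x  ≡⟨ cong (_+ - φ i x) (φ-0 i) ⟩
    0# + - φ i x  ≡⟨ +-identityˡ _ ⟩
    - φ i x  ∎
    where open ≡-Reasoning

  φ-≢0 : ∀ i {x} → x ≢ 0# → φ i x ≢ 0#
  φ-≢0 i = pow-≢0 (q ^ i)

  φ-inv : ∀ i {x} → x ≢ 0# → φ i (inv x) ≡ inv (φ i x)
  φ-inv i {x} x≢0 = *-cancelˡ (φ-≢0 i x≢0) (begin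
    φ i x * φ i (inv x)  ≡⟨ sym (φ-* i x (inv x)) ⟩
    φ i (x * inv x)  ≡⟨ cong (φ i) (inv-inverseʳ x≢0) ⟩
    φ i 1#  ≡⟨ φ-1 i ⟩
    1#  ≡⟨ sym (inv-inverseʳ (φ-≢0 i x≢0)) ⟩
    φ i x * inv (φ i x)  ∎)
    where open ≡-Reasoning

  φ-n : ∀ x → φ n x ≡ x
  φ-n = fermat

  φ-multiple : ∀ i {x} → φ i x ≡ x → ∀ m → φ (m *ℕ i) x ≡ x
  φ-multiple i {x} e zero    = φ-zero x
  φ-multiple i {x} e (suc m) = trans (sym (φ-∘ i (m *ℕ i) x)) (trans (cong (φ i) (φ-multiple i e m)) e)

  φ-n* : ∀ m x → φ (m *ℕ n) x ≡ x
  φ-n* m x = φ-multiple n (φ-n x) m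

  InFq? : ∀ x → Dec (InFq x)
  InFq? x = pow x q ≟ x

  φ1≡pow-q : ∀ x → φ 1 x ≡ pow x q
  φ1≡pow-q x = cong (pow x) (ℕₚ.*-identityʳ q)

  φ-fixes-Fq : ∀ i {x} → InFq x → φ i x ≡ x
  φ-fixes-Fq i {x} x∈Fq = trans (cong (λ m → φ m x) (sym (ℕₚ.*-identityʳ i))) (φ-multiple 1 (trans (φ1≡pow-q x) x∈Fq) i)

  -- Being fixed by the R-th and the n-th power of Frobenius, `x` is fixed by the first power, by
  -- Bézout; the two cases are the two signs of the Bézout identity.
  φ-fixed⇒Fq : ∀ {R} → Coprime n R → ∀ {x} → φ R x ≡ x → InFq x
  φ-fixed⇒Fq {R} co {x} e with coprime-Bézout co
  ... | Bézout.+- k l 1+lR≡kn = trans (sym (φ1≡pow-q x)) (begin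
    φ 1 x  ≡⟨ cong (φ 1) (sym (φ-multiple R e l)) ⟩
    φ 1 (φ (l *ℕ R) x)  ≡⟨ φ-∘ 1 (l *ℕ R) x ⟩
    φ (1 +ℕ l *ℕ R) x  ≡⟨ cong (λ m → φ m x) 1+lR≡kn ⟩
    φ (k *ℕ n) x  ≡⟨ φ-n* k x ⟩
    x  ∎)
    where open ≡-Reasoning
  ... | Bézout.-+ k l 1+kn≡lR = trans (sym (φ1≡pow-q x)) (begin
    φ 1 x  ≡⟨ cong (φ 1) (sym (φ-n* k x)) ⟩
    φ 1 (φ (k *ℕ n) x)  ≡⟨ φ-∘ 1 (k *ℕ n) x ⟩
    φ (1 +ℕ k *ℕ n) x  ≡⟨ cong (λ m → φ m x) 1+kn≡lR ⟩
    φ (l *ℕ R) x  ≡⟨ φ-multiple R e l ⟩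
    x  ∎)
    where open ≡-Reasoning

  Fq-+ : ∀ {x y} → InFq x → InFq y → InFq (x + y)
  Fq-+ {x} {y} ex ey = trans (pow-q-+ {k = k} prime q≡p^ x y) (cong₂ _+_ ex ey)

  Fq-* : ∀ {x y} → InFq x → InFq y → InFq (x * y)
  Fq-* {x} {y} ex ey = trans (pow-distrib-* x y q) (cong₂ _*_ ex ey)

  Fq-0 : InFq 0#
  Fq-0 = pow-0 0<q

  Fq-1 : InFq 1#
  Fq-1 = pow-1 q

  Fq-inv : ∀ {x} → x ≢ 0# → InFq x → InFq (inv x)
  Fq-inv {x} x≢0 ex = trans (sym (φ1≡pow-q _)) (trans (φ-inv 1 x≢0) (cong inv (trans (φ1≡pow-q x) ex)))

  N-* : ∀ x y → N (x * y) ≡ N x * N y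
  N-* x y = pow-distrib-* x y (geom n)

  N-≢0 : ∀ {x} → x ≢ 0# → N x ≢ 0#
  N-≢0 = pow-≢0 (geom n)

  1+geom*q : ∀ k → suc (geom k *ℕ q) ≡ geom (suc k)
  1+geom*q zero    = refl
  1+geom*q (suc k) = begin
    suc ((geom k +ℕ q ^ k) *ℕ q)  ≡⟨ cong suc (ℕₚ.*-distribʳ-+ q (geom k) (q ^ k)) ⟩
    suc (geom k *ℕ q) +ℕ q ^ k *ℕ q  ≡⟨ cong₂ _+ℕ_ (1+geom*q k) (ℕₚ.*-comm (q ^ k) q) ⟩
    geom (suc k) +ℕ q ^ suc k  ∎
    where open ≡-Reasoning

  0<geom-n : 0 < geom n
  0<geom-n = subst (λ m → 0 < geom m) (ℕₚ.suc-pred n {{>-nonZero 0<n}}) (subst (0 <_) (1+geom*q (ℕ.pred n)) (s≤s z≤n))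

  -- Both x · N(x)^q and N(x) · x^(q^n) are x to the power 1 + q + ⋯ + q^n. Since x^(q^n) = x, a
  -- nonzero x cancels.
  N∈Fq : ∀ x → InFq (N x)
  N∈Fq x with x ≟ 0#
  ... | yes refl = trans (cong (λ z → pow z q) e) (trans (pow-0 0<q) (sym e))
    where
    e : N 0# ≡ 0#
    e = pow-0 0<geom-n
  ... | no x≢0 = *-cancelˡ x≢0 (begin
    x * pow (N x) q  ≡⟨ cong (x *_) (sym (pow-* x (geom n) q)) ⟩
    pow x (suc (geom n *ℕ q))  ≡⟨ cong (pow x) (1+geom*q n) ⟩
    pow x (geom n +ℕ q ^ n)  ≡⟨ pow-+ x (geom n) (q ^ n) ⟩
    N x * pow x (q ^ n)  ≡⟨ cong (N x *_) (fermat x) ⟩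
    N x * x  ≡⟨ *-comm _ _ ⟩
    x * N x  ∎)
    where open ≡-Reasoning

  N-φ : ∀ i x → N (φ i x) ≡ N x
  N-φ i x = begin
    pow (pow x (q ^ i)) (geom n)  ≡⟨ sym (pow-* x (q ^ i) (geom n)) ⟩
    pow x (q ^ i *ℕ geom n)  ≡⟨ cong (pow x) (ℕₚ.*-comm (q ^ i) (geom n)) ⟩
    pow x (geom n *ℕ q ^ i)  ≡⟨ pow-* x (geom n) (q ^ i) ⟩
    φ i (N x)  ≡⟨ φ-fixes-Fq i (N∈Fq x) ⟩
    N x  ∎
    where open ≡-Reasoning

  q-1 : ℕ
  q-1 = q ∸ 1

  1+[q-1] : suc q-1 ≡ q
  1+[q-1] = ℕₚ.m+[n∸m]≡n 0<q

  0<q-1 : 0 < q-1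
  0<q-1 = ℕₚ.≤-pred (subst (2 ≤_) (sym 1+[q-1]) 2≤q)

  1+geom*[q-1] : ∀ k → suc (geom k *ℕ q-1) ≡ q ^ k
  1+geom*[q-1] k = ℕₚ.+-cancelˡ-≡ (geom k) _ _ (begin
    geom k +ℕ suc (geom k *ℕ q-1)  ≡⟨ ℕₚ.+-suc _ _ ⟩
    suc (geom k +ℕ geom k *ℕ q-1)  ≡⟨ cong suc (sym (ℕₚ.*-suc (geom k) q-1)) ⟩
    suc (geom k *ℕ suc q-1)  ≡⟨ cong (λ z → suc (geom k *ℕ z)) 1+[q-1] ⟩
    suc (geom k *ℕ q)  ≡⟨ 1+geom*q k ⟩
    geom (suc k)  ∎)
    where open ≡-Reasoning

  #K* : EK.# ≢0? ≡ geom n *ℕ q-1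
  #K* = ℕₚ.suc-injective (trans #nonzero (sym (1+geom*[q-1] n)))

  Fq*? : ∀ x → Dec (x ≢ 0# × InFq x)
  Fq*? x = ≢0? x ×-dec InFq? x

  -- At most q - 1, as roots of X^(q-1) - 1. At least q - 1, because the norm maps the geom n · (q -
  -- 1) nonzero elements of K into this set with fibres of at most geom n elements.
  #Fq* : EK.# Fq*? ≡ q-1
  #Fq* = ℕₚ.≤-antisym
    (ℕₚ.≤-trans (#-mono elems Fq*? (λ x → pow x q-1 ≟ 1#) (λ x (x≢0 , e) →
        *-cancelˡ x≢0 (trans (cong (pow x) 1+[q-1]) (trans e (sym (*-identityʳ x))))))
      (#roots-pow 1# 0<q-1))
    (ℕₚ.*-cancelˡ-≤ (geom n) {{>-nonZero 0<geom-n}} (begin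
      geom n *ℕ q-1  ≡⟨ sym #K* ⟩
      EK.# ≢0?  ≤⟨ fiber-≤ K-enum K-enum ≢0? Fq*? N (λ x x≢0 → N-≢0 x≢0 , N∈Fq x)
                    (λ y _ → ℕₚ.≤-trans (#-mono elems _ (λ x → N x ≟ y) (λ x → proj₂)) (#roots-pow y 0<geom-n)) ⟩
      EK.# Fq*? *ℕ geom n  ≡⟨ ℕₚ.*-comm _ (geom n) ⟩
      geom n *ℕ EK.# Fq*?  ∎))
    where open ℕₚ.≤-Reasoning

  #Fq : EK.# InFq? ≡ q
  #Fq = trans (EK.#-remove InFq? 0# Fq-0)
    (trans (cong suc (trans (#-cong elems _ Fq*? (λ x (a , b) → b , a) (λ x (a , b) → b , a)) #Fq*)) 1+[q-1])

  -- Hilbert's Theorem 90, with the number of solutions, for any Frobenius power whose fixed field is F_q.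
  module Hilbert90 (R : ℕ) (fixed : ∀ {x} → φ R x ≡ x → InFq x) where

    solution? : ∀ g x → Dec (x ≢ 0# × φ R x ≡ g * x)
    solution? g x = ≢0? x ×-dec (φ R x ≟ (g * x))

    ratio∈Fq : ∀ {g x y} → x ≢ 0# → φ R x ≡ g * x → φ R y ≡ g * y → InFq (y * inv x)
    ratio∈Fq {g} {x} {y} x≢0 ex ey = fixed (*-cancelˡ (φ-≢0 R x≢0) (begin
      φ R x * φ R (y * inv x)  ≡⟨ sym (φ-* R x _) ⟩
      φ R (x * (y * inv x))  ≡⟨ cong (φ R) cancel ⟩
      φ R y  ≡⟨ ey ⟩
      g * y  ≡⟨ cong (g *_) (sym cancel) ⟩
      g * (x * (y * inv x))  ≡⟨ sym (*-assoc g x _) ⟩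
      g * x * (y * inv x)  ≡⟨ cong (_* (y * inv x)) (sym ex) ⟩
      φ R x * (y * inv x)  ∎))
      where
      open ≡-Reasoning
      cancel : x * (y * inv x) ≡ y
      cancel = trans (cong (x *_) (*-comm y (inv x))) (*-inv-cancel y x≢0)

    #solutions-from : ∀ {g x} → x ≢ 0# → φ R x ≡ g * x → EK.# (solution? g) ≡ q-1
    #solutions-from {g} {x} x≢0 ex = trans (sym (bijection K-enum K-enum Fq*? (solution? g) (_* x)
      (λ c (c≢0 , c∈Fq) → *-≢0 c≢0 x≢0 ,
         trans (φ-* R c x) (trans (cong₂ _*_ (φ-fixes-Fq R c∈Fq) ex)
           (solve 3 (λ c g x → c :* (g :* x) := g :* (c :* x)) refl c g x)))
      (λ c d _ _ e → *-cancelˡ x≢0 (trans (*-comm x c) (trans e (*-comm d x))))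
      (λ y (y≢0 , ey) → y * inv x , (*-≢0 y≢0 (inv-≢0 x≢0) , ratio∈Fq x≢0 ex ey) ,
         trans (*-assoc y _ x) (trans (cong (y *_) (inv-inverseˡ x≢0)) (*-identityʳ y))))) #Fq*

    quotient : K → K
    quotient x = φ R x * inv x

    quotient-solves : ∀ {x g} → x ≢ 0# → quotient x ≡ g → φ R x ≡ g * x
    quotient-solves {x} x≢0 refl = sym (trans (*-assoc _ _ x) (trans (cong (φ R x *_) (inv-inverseˡ x≢0)) (*-identityʳ _)))

    N-quotient : ∀ {x} → x ≢ 0# → N (quotient x) ≡ 1#
    N-quotient {x} x≢0 = begin
      N (φ R x * inv x)  ≡⟨ N-* _ _ ⟩
      N (φ R x) * N (inv x)  ≡⟨ cong (_* N (inv x)) (N-φ R x) ⟩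
      N x * N (inv x)  ≡⟨ sym (N-* x (inv x)) ⟩
      N (x * inv x)  ≡⟨ cong N (inv-inverseʳ x≢0) ⟩
      N 1#  ≡⟨ pow-1 (geom n) ⟩
      1#  ∎
      where open ≡-Reasoning

    #fiber-≤ : ∀ g → EK.# (λ x → ≢0? x ×-dec (quotient x ≟ g)) ≤ q-1
    #fiber-≤ g with EK.exists? (solution? g)
    ... | yes (x , x≢0 , ex) = ℕₚ.≤-trans (#-mono elems _ (solution? g) (λ y (y≢0 , ey) → y≢0 , quotient-solves y≢0 ey))
                    (ℕₚ.≤-reflexive (#solutions-from x≢0 ex))
    ... | no none = ℕₚ.≤-trans (ℕₚ.≤-reflexive (EK.#-none _ (λ y (y≢0 , ey) → none (y , y≢0 , quotient-solves y≢0 ey)))) z≤n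

    -- If g were not a quotient φ R x / x, all these quotients would lie among fewer than geom n
    -- elements of norm 1, and each is taken at most q - 1 times: too few for the geom n · (q - 1)
    -- nonzero x.
    #solutions : ∀ {g} → N g ≡ 1# → EK.# (solution? g) ≡ q-1
    #solutions {g} Ng≡1 with EK.exists? (solution? g)
    ... | yes (x , x≢0 , ex) = #solutions-from x≢0 ex
    ... | no none = ⊥-elim (ℕₚ.<-irrefl refl (begin-strict
      geom n *ℕ q-1  ≡⟨ sym #K* ⟩
      EK.# ≢0?  ≤⟨ fiber-≤ K-enum K-enum ≢0? others? quotient
                    (λ x x≢0 → N-quotient x≢0 , λ e → none (x , x≢0 , quotient-solves x≢0 e))
                    (λ g _ → #fiber-≤ g) ⟩
      EK.# others? *ℕ q-1                <⟨ ℕₚ.*-monoˡ-< q-1 {{>-nonZero 0<q-1}} (ℕₚ.n<1+n (EK.# others?)) ⟩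
      suc (EK.# others?) *ℕ q-1  ≡⟨ cong (_*ℕ q-1) (sym (EK.#-remove (λ x → N x ≟ 1#) g Ng≡1)) ⟩
      EK.# (λ x → N x ≟ 1#) *ℕ q-1  ≤⟨ ℕₚ.*-monoˡ-≤ q-1 (#roots-pow 1# 0<geom-n) ⟩
      geom n *ℕ q-1  ∎))
      where
      open ℕₚ.≤-Reasoning
      others? : ∀ x → Dec (N x ≡ 1# × x ≢ g)
      others? x = (N x ≟ 1#) ×-dec ¬? (x ≟ g)

-- Vectors and spans

T-not-intro : ∀ {b} → ¬ T b → T (not b)
T-not-intro {true}  ¬t = ¬t tt
T-not-intro {false} ¬t = tt

T-not-elim : ∀ {b} → T (not b) → ¬ T b
T-not-elim {false} _ ()

T-≡ : ∀ {b c} → (T b → T c) → (T c → T b) → b ≡ c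
T-≡ {true}  {true}  f g = refl
T-≡ {true}  {false} f g = ⊥-elim (f tt)
T-≡ {false} {true}  f g = ⊥-elim (g tt)
T-≡ {false} {false} f g = refl

T-does-intro : {P : Set} (p? : Dec P) → P → T (does p?)
T-does-intro (yes _) _ = tt
T-does-intro (no ¬p) p = ¬p p

T-does-elim : {P : Set} (p? : Dec P) → T (does p?) → P
T-does-elim (yes p) _ = p

module Vectors {q n : ℕ} (F : FieldOfOrder q n) where
  open FiniteField F

  eqK-refl : ∀ x → T (eqK x x)
  eqK-refl x = T-does-intro (x ≟ x) refl

  eqK-sound : ∀ x y → T (eqK x y) → x ≡ y
  eqK-sound x y = T-does-elim (x ≟ y)

  eqV-refl : ∀ v → T (eqV v v)
  eqV-refl (v4 a b c d) = from (eqK-refl a , from (eqK-refl b , from (eqK-refl c , eqK-refl d)))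
    where
    from : ∀ {x y} → T x × T y → T (x ∧ y)
    from = Equivalence.from T-∧

  eqV-complete : ∀ {u v} → u ≡ v → T (eqV u v)
  eqV-complete {u} refl = eqV-refl u

  v4-cong : ∀ {a b c d a′ b′ c′ d′} → a ≡ a′ → b ≡ b′ → c ≡ c′ → d ≡ d′ → v4 a b c d ≡ v4 a′ b′ c′ d′
  v4-cong refl refl refl refl = refl

  eqV-sound : ∀ u v → T (eqV u v) → u ≡ v
  eqV-sound (v4 a b c d) (v4 a′ b′ c′ d′) h =
    let (ha , h′) = to h ; (hb , h″) = to h′ ; (hc , hd) = to h″
    in v4-cong (eqK-sound a a′ ha) (eqK-sound b b′ hb) (eqK-sound c c′ hc) (eqK-sound d d′ hd)
    where
    to : ∀ {x y} → T (x ∧ y) → T x × T y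
    to = Equivalence.to T-∧

  _≟V_ : DecidableEquality V4
  u ≟V v = map′ (eqV-sound u v) eqV-complete (T? (eqV u v))

  K²-enum : Enumeration (K × K)
  K²-enum = record
    { list     = pairs
    ; complete = λ (x , y) → concatMap-complete _ (elems-complete x) (∈-map⁺ _ (elems-complete y))
    ; unique   = concatMap-unique _ (λ x → Uniqueₚ.map⁺ (cong proj₂) elems-unique) same elems-unique
    ; _≟_      = ≡-dec _≟_ _≟_ }
    where
    same : ∀ {x y v} → v ∈ map (x ,_) elems → v ∈ map (y ,_) elems → x ≡ y
    same v∈ v∈′ with _ , _ , refl ← ∈-map⁻ _ v∈ | _ , _ , refl ← ∈-map⁻ _ v∈′ = refl

  V-enum : Enumeration V4
  V-enum = record
    { list     = allV
    ; complete = λ (v4 a b c d) → concatMap-complete _ (elems-complete a) (concatMap-complete _ (elems-complete b)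
                   (concatMap-complete _ (elems-complete c) (∈-map⁺ _ (elems-complete d))))
    ; unique   =
        concatMap-unique _ (λ a → concatMap-unique _ (λ b → concatMap-unique _ (λ c →
          Uniqueₚ.map⁺ (cong V4.c3) elems-unique)
          (λ m m′ → trans (sym (last-two m)) (last-two m′)) elems-unique)
          (λ m m′ → trans (sym (middle m)) (middle m′)) elems-unique)
          (λ m m′ → trans (sym (first m)) (first m′)) elems-unique
    ; _≟_      = _≟V_ }
    where
    last-two : ∀ {a b c v} → v ∈ map (v4 a b c) elems → V4.c2 v ≡ c
    last-two m with _ , _ , refl ← ∈-map⁻ _ m = refl
    row : K → K → K → List V4
    row a b c = map (v4 a b c) elems
    plane : K → K → List V4
    plane a b = concatMap (row a b) elems
    middle : ∀ {a b v} → v ∈ concatMap (λ c → map (v4 a b c) elems) elems → V4.c1 v ≡ b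
    middle {a} {b} m with _ , _ , m′ ← find (∈ₚ.∈-concatMap⁻ (row a b) {xs = elems} m)
                       with _ , _ , refl ← ∈-map⁻ _ m′ = refl
    first : ∀ {a v} → v ∈ concatMap (λ b → concatMap (λ c → map (v4 a b c) elems) elems) elems → V4.c0 v ≡ a
    first {a} m with b , _ , m′ ← find (∈ₚ.∈-concatMap⁻ (plane a) {xs = elems} m)
                 with _ , _ , m″ ← find (∈ₚ.∈-concatMap⁻ (row a b) {xs = elems} m′)
                 with _ , _ , refl ← ∈-map⁻ _ m″ = refl

  module E² = Enumeration K²-enum
  module EV = Enumeration V-enum

  #K² : length pairs ≡ q ^ n *ℕ q ^ n
  -- Any inhabited type can serve as the predicate that always holds; here it is `K`, with witness
  -- `0#`.
  #K² = trans (sym (#-all pairs {P = λ _ → K} (λ _ → yes 0#) (λ _ → 0#)))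
    (trans (fiber-= K²-enum K-enum (λ _ → yes 0#) (λ _ → yes 0#) proj₁ (λ _ _ → 0#) fib)
           (cong (_*ℕ q ^ n) (trans (#-all elems _ (λ _ → 0#)) elems-card)))
    where
    fib : ∀ y → K → E².# (λ x → yes 0# ×-dec (proj₁ x ≟ y)) ≡ q ^ n
    fib y _ = trans (sym (bijection K-enum K²-enum {P = λ _ → K} (λ _ → yes 0#) _ (y ,_) (λ _ _ → 0# , refl)
                (λ _ _ _ _ → cong proj₂) λ { (_ , z) (_ , refl) → z , 0# , refl }))
              (trans (#-all elems _ (λ _ → 0#)) elems-card)

  isZeroV-intro : ∀ {v} → v ≢ zeroV → T (not (isZeroV v))
  isZeroV-intro {v} v≢0 = T-not-intro (v≢0 ∘ eqV-sound v zeroV)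

  isZeroV-elim : ∀ {v} → T (not (isZeroV v)) → v ≢ zeroV
  isZeroV-elim h e = T-not-elim h (eqV-complete e)

  inSpan1-intro : ∀ {v u} c → scale c v ≡ u → T (inSpan1 v u)
  inSpan1-intro {v} {u} c e = any-intro (λ c → eqV (scale c v) u) (elems-complete c) (eqV-complete e)

  inSpan1-elim : ∀ {v u} → T (inSpan1 v u) → ∃ λ c → scale c v ≡ u
  inSpan1-elim {v} {u} h with c , t ← any-elim (λ c → eqV (scale c v) u) {elems} h = c , eqV-sound _ _ t

  _∙_⊕_∙_ : K → V4 → K → V4 → V4
  c ∙ v ⊕ d ∙ w = addV (scale c v) (scale d w)

  inSpan2-intro : ∀ {v w u} c d → c ∙ v ⊕ d ∙ w ≡ u → T (inSpan2 v w u)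
  inSpan2-intro c d e = any-intro _ (Enumeration.complete K²-enum (c , d)) (eqV-complete e)

  inSpan2-elim : ∀ {v w u} → T (inSpan2 v w u) → ∃ λ c → ∃ λ d → c ∙ v ⊕ d ∙ w ≡ u
  inSpan2-elim h with (c , d) , t ← any-elim _ {pairs} h = c , d , eqV-sound _ _ t

  scale-scale : ∀ c d v → scale c (scale d v) ≡ scale (c * d) v
  scale-scale c d (v4 x y z w) = v4-cong (sym (*-assoc c d x)) (sym (*-assoc c d y)) (sym (*-assoc c d z)) (sym (*-assoc c d w))

  scale-1 : ∀ v → scale 1# v ≡ v
  scale-1 (v4 x y z w) = v4-cong (*-identityˡ x) (*-identityˡ y) (*-identityˡ z) (*-identityˡ w)

  scale-0 : ∀ v → scale 0# v ≡ zeroV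
  scale-0 (v4 x y z w) = v4-cong (zeroˡ x) (zeroˡ y) (zeroˡ z) (zeroˡ w)

  scale-zeroV : ∀ c → scale c zeroV ≡ zeroV
  scale-zeroV c = v4-cong (zeroʳ c) (zeroʳ c) (zeroʳ c) (zeroʳ c)

  scale-inv : ∀ {c} v → c ≢ 0# → scale (inv c) (scale c v) ≡ v
  scale-inv {c} v c≢0 = trans (scale-scale (inv c) c v) (trans (cong (λ z → scale z v) (inv-inverseˡ c≢0)) (scale-1 v))

  scale-≢0 : ∀ {c v} → c ≢ 0# → v ≢ zeroV → scale c v ≢ zeroV
  scale-≢0 {c} {v} c≢0 v≢0 e = v≢0 (trans (sym (scale-inv v c≢0)) (trans (cong (scale (inv c)) e) (scale-zeroV (inv c))))

  scale≢0⇒≢0 : ∀ {c v} → scale c v ≢ zeroV → c ≢ 0#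
  scale≢0⇒≢0 {v = v} ne refl = ne (scale-0 v)

  scale-cancelʳ : ∀ {c d v} → v ≢ zeroV → scale c v ≡ scale d v → c ≡ d
  scale-cancelʳ {c} {d} {v} v≢0 e with (c + - d) ≟ 0#
  ... | yes z  = x-y≡0⇒x≡y z
  ... | no  nz = ⊥-elim (v≢0 (zero-coords v nz e))
    where
    coord : ∀ {x} → c + - d ≢ 0# → c * x ≡ d * x → x ≡ 0#
    coord {x} nz e = *≡0 nz (trans (solve 3 (λ c d x → (c :+ :- d) :* x := c :* x :+ :- (d :* x)) refl c d x)
                       (trans (cong (_+ - (d * x)) e) (-‿inverseʳ _)))
    zero-coords : ∀ v → c + - d ≢ 0# → scale c v ≡ scale d v → v ≡ zeroV
    zero-coords (v4 x y z w) nz e =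
      v4-cong (coord nz (cong V4.c0 e)) (coord nz (cong V4.c1 e)) (coord nz (cong V4.c2 e)) (coord nz (cong V4.c3 e))

-- The q-polynomial A and its homogeneity sets

-- The operator is a field with a defining equation, so that the one in the statement, whose
-- exponents depend on the sign and size of `r`, can be inserted unchanged. `R` and `R′` are
-- exponents of an automorphism and its inverse, and `h` records that n is odd.
record Setting {q n : ℕ} (F : FieldOfOrder q n) : Set where
  open FiniteField F
  field
    {p k}     : ℕ
    prime     : Prime p
    q≡p^      : q ≡ p ^ suc k
    0<n       : 0 < n
    h         : ℕ
    n≡1+2h    : n ≡ suc (h *ℕ 2)
    R R′ m    : ℕ
    coprime   : Coprime n R
    R+R′≡mn   : R +ℕ R′ ≡ m *ℕ n
    a         : K
    A         : K → K
    A-def     : ∀ x → A x ≡ pow x (q ^ R) + - (a * pow x (q ^ R′))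

module Operator {q n : ℕ} (F : FieldOfOrder q n) (S : Setting F) where
  open Setting S
  open FiniteField F
  open Polynomials F
  open Vectors F
  open Galois F {k = k} prime q≡p^ 0<n

  s t : K → K
  s = φ R
  t = φ R′

  s∘t : ∀ x → s (t x) ≡ x
  s∘t x = trans (φ-∘ R R′ x) (trans (cong (λ i → φ i x) R+R′≡mn) (φ-n* m x))

  t∘s : ∀ x → t (s x) ≡ x
  t∘s x = trans (φ-∘ R′ R x) (trans (cong (λ i → φ i x) (trans (ℕₚ.+-comm R′ R) R+R′≡mn)) (φ-n* m x))

  s-fixed : ∀ {x} → s x ≡ x → InFq x
  s-fixed = φ-fixed⇒Fq coprime

  s-injective : ∀ {x y} → s x ≡ s y → x ≡ y
  s-injective {x} {y} e = trans (sym (t∘s x)) (trans (cong t e) (t∘s y))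

  -- n is odd, so s and s² generate the same group.
  s²-fixed : ∀ {x} → φ (R +ℕ R) x ≡ x → InFq x
  s²-fixed {x} e = s-fixed (begin
    φ R x  ≡⟨ cong (φ R) (sym (φ-multiple (R +ℕ R) e h)) ⟩
    φ R (φ (h *ℕ (R +ℕ R)) x)  ≡⟨ φ-∘ R _ x ⟩
    φ (R +ℕ h *ℕ (R +ℕ R)) x  ≡⟨ cong (λ i → φ i x) exponent ⟩
    φ (R *ℕ n) x  ≡⟨ φ-n* R x ⟩
    x  ∎)
    where
    open ≡-Reasoning
    exponent : R +ℕ h *ℕ (R +ℕ R) ≡ R *ℕ n
    exponent = begin
      R +ℕ h *ℕ (R +ℕ R)  ≡⟨ cong (λ z → R +ℕ h *ℕ (R +ℕ z)) (sym (ℕₚ.+-identityʳ R)) ⟩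
      R +ℕ h *ℕ (2 *ℕ R)  ≡⟨ cong (R +ℕ_) (sym (ℕₚ.*-assoc h 2 R)) ⟩
      suc (h *ℕ 2) *ℕ R  ≡⟨ cong (_*ℕ R) (sym n≡1+2h) ⟩
      n *ℕ R  ≡⟨ ℕₚ.*-comm n R ⟩
      R *ℕ n  ∎

  -- N (-1) is a product of n conjugates of -1, each equal to -1 because Frobenius respects
  -- negation, and n is odd.
  N-neg : ∀ x → N (- x) ≡ - N x
  N-neg x = begin
    N (- x)  ≡⟨ cong N (solve 1 (λ x → :- x := (:- :1) :* x) refl x) ⟩
    N (- 1# * x)  ≡⟨ N-* _ x ⟩
    N (- 1#) * N x  ≡⟨ cong (_* N x) (trans (pow-geom n) (trans (cong (pow (- 1#)) n≡1+2h) odd)) ⟩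
    - 1# * N x  ≡⟨ solve 1 (λ x → (:- :1) :* x := :- x) refl (N x) ⟩
    - N x  ∎
    where
    open ≡-Reasoning
    pow-geom : ∀ i → pow (- 1#) (geom i) ≡ pow (- 1#) i
    pow-geom zero    = refl
    pow-geom (suc i) = trans (pow-+ (- 1#) (geom i) (q ^ i))
      (trans (cong₂ _*_ (pow-geom i) (trans (φ-neg i 1#) (cong -_ (φ-1 i)))) (*-comm _ _))
    even : ∀ i → pow (- 1#) (i *ℕ 2) ≡ 1#
    even zero    = refl
    even (suc i) = trans (cong (λ z → - 1# * (- 1# * z)) (even i)) (solve 0 ((:- :1) :* ((:- :1) :* :1) := :1) refl)
    odd : pow (- 1#) (suc (h *ℕ 2)) ≡ - 1#
    odd = trans (cong (- 1# *_) (even h)) (*-identityʳ _)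

  A-+ : ∀ x y → A (x + y) ≡ A x + A y
  A-+ x y = begin
    A (x + y)  ≡⟨ A-def _ ⟩
    s (x + y) + - (a * t (x + y))  ≡⟨ cong₂ (λ u v → u + - (a * v)) (φ-+ R x y) (φ-+ R′ x y) ⟩
    s x + s y + - (a * (t x + t y))  ≡⟨ solve 5 (λ u v a w z → u :+ v :+ :- (a :* (w :+ z)) := u :+ :- (a :* w) :+ (v :+ :- (a :* z)))
                    refl (s x) (s y) a (t x) (t y) ⟩
    s x + - (a * t x) + (s y + - (a * t y))  ≡⟨ cong₂ _+_ (sym (A-def x)) (sym (A-def y)) ⟩
    A x + A y  ∎
    where open ≡-Reasoning

  A-Fq* : ∀ {c} x → InFq c → A (c * x) ≡ c * A x
  A-Fq* {c} x c∈Fq = begin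
    A (c * x)  ≡⟨ A-def _ ⟩
    s (c * x) + - (a * t (c * x))  ≡⟨ cong₂ (λ u v → u + - (a * v)) (trans (φ-* R c x) (cong (_* s x) (φ-fixes-Fq R c∈Fq)))
                    (trans (φ-* R′ c x) (cong (_* t x) (φ-fixes-Fq R′ c∈Fq))) ⟩
    c * s x + - (a * (c * t x))  ≡⟨ solve 4 (λ c u a v → c :* u :+ :- (a :* (c :* v)) := c :* (u :+ :- (a :* v))) refl c (s x) a (t x) ⟩
    c * (s x + - (a * t x))  ≡⟨ cong (c *_) (sym (A-def x)) ⟩
    c * A x  ∎
    where open ≡-Reasoning

  A-0 : A 0# ≡ 0#
  A-0 = trans (cong A (sym (zeroˡ 0#))) (trans (A-Fq* 0# Fq-0) (zeroˡ _))

  -- The scalars that keep (x, A x) on the graph of A. They contain F_q, and those outside F_q are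
  -- the source of weights above one.
  W : K → K → Set
  W x l = A (l * x) ≡ l * A x

  W? : ∀ x l → Dec (W x l)
  W? x l = A (l * x) ≟ (l * A x)

  δ : K → K
  δ l = s l + - l

  δ-0⇒Fq : ∀ {l} → δ l ≡ 0# → InFq l
  δ-0⇒Fq e = s-fixed (x-y≡0⇒x≡y e)

  δ-≢0 : ∀ {l} → ¬ InFq l → δ l ≢ 0#
  δ-≢0 l∉Fq e = l∉Fq (δ-0⇒Fq e)

  δ-linear : ∀ {c} l l′ → InFq c → δ (l + - (c * l′)) ≡ δ l + - (c * δ l′)
  δ-linear {c} l l′ c∈Fq = trans
    (cong (_+ - (l + - (c * l′))) (trans (φ-+ R _ _) (cong (s l +_) (trans (φ-neg R _) (cong -_ (trans (φ-* R c l′) (cong (_* s l′) (φ-fixes-Fq R c∈Fq))))))))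
    (solve 5 (λ c l l′ u v → u :+ :- (c :* v) :+ :- (l :+ :- (c :* l′)) := u :+ :- l :+ :- (c :* (v :+ :- l′))) refl c l l′ (s l) (s l′))

  private
    -- Since `t` undoes `s`, one has t (δ l) = l - t l, which is the factor left over in the terms
    -- containing t x.
    defect : ∀ x l → A (l * x) + - (l * A x) ≡ δ l * s x + a * (t (δ l) * t x)
    defect x l = begin
      A (l * x) + - (l * A x)
        ≡⟨ cong₂ (λ u v → u + - (l * v)) (A-def (l * x)) (A-def x) ⟩
      s (l * x) + - (a * t (l * x)) + - (l * (s x + - (a * t x)))
        ≡⟨ cong₂ (λ u v → u + - (a * v) + - (l * (s x + - (a * t x)))) (φ-* R l x) (φ-* R′ l x) ⟩
      s l * s x + - (a * (t l * t x)) + - (l * (s x + - (a * t x)))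
        ≡⟨ solve 6 (λ l a sl tl sx tx → sl :* sx :+ :- (a :* (tl :* tx)) :+ :- (l :* (sx :+ :- (a :* tx)))
                    := (sl :+ :- l) :* sx :+ a :* ((l :+ :- tl) :* tx)) refl l a (s l) (t l) (s x) (t x) ⟩
      δ l * s x + a * ((l + - t l) * t x)
        ≡⟨ cong (λ z → δ l * s x + a * (z * t x)) (sym (trans (φ-+ R′ (s l) (- l)) (cong₂ _+_ (t∘s l) (φ-neg R′ l)))) ⟩
      δ l * s x + a * (t (δ l) * t x) ∎
      where open ≡-Reasoning

  W⇒δ : ∀ {x l} → W x l → δ l * s x ≡ - a * (t (δ l) * t x)
  W⇒δ {x} {l} w = trans (solve 3 (λ u a v → u := u :+ a :* v :+ :- a :* v) refl (δ l * s x) a (t (δ l) * t x))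
    (trans (cong (_+ - a * (t (δ l) * t x)) (trans (sym (defect x l)) (trans (cong (_+ - (l * A x)) w) (-‿inverseʳ _)))) (+-identityˡ _))

  δ⇒W : ∀ {x l} → δ l * s x ≡ - a * (t (δ l) * t x) → W x l
  δ⇒W {x} {l} e = x-y≡0⇒x≡y (trans (defect x l) (trans (cong (_+ a * (t (δ l) * t x)) e)
    (solve 2 (λ a v → :- a :* v :+ a :* v := :0) refl a (t (δ l) * t x))))

  W-Fq : ∀ x {l} → InFq l → W x l
  W-Fq x l∈Fq = A-Fq* x l∈Fq

  W-combination : ∀ {x l b c} → W x l → InFq b → InFq c → W x (b + c * l)
  W-combination {x} {l} {b} {c} w b∈ c∈ = begin
    A ((b + c * l) * x)  ≡⟨ cong A (solve 4 (λ b c l x → (b :+ c :* l) :* x := b :* x :+ c :* (l :* x)) refl b c l x) ⟩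
    A (b * x + c * (l * x))  ≡⟨ A-+ _ _ ⟩
    A (b * x) + A (c * (l * x))  ≡⟨ cong₂ _+_ (A-Fq* x b∈) (trans (A-Fq* (l * x) c∈) (cong (c *_) w)) ⟩
    b * A x + c * (l * A x)  ≡⟨ solve 4 (λ b c l x → b :* x :+ c :* (l :* x) := (b :+ c :* l) :* x) refl b c l (A x) ⟩
    (b + c * l) * A x  ∎
    where open ≡-Reasoning

  -- In the norm of `W⇒δ` the factors N (δ l) and N x occur on both sides, because the norm does not
  -- see `s` and `t`; only N (-a) is left.
  N-δ : ∀ {x l} → x ≢ 0# → ¬ InFq l → W x l → N (- a) ≡ 1#
  N-δ {x} {l} x≢0 l∉Fq w = *-cancelˡ (*-≢0 (N-≢0 (δ-≢0 l∉Fq)) (N-≢0 x≢0)) (begin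
    N (δ l) * N x * N (- a)  ≡⟨ cong₂ (λ u v → u * v * N (- a)) (sym (N-φ R′ (δ l))) (sym (N-φ R′ x)) ⟩
    N (t (δ l)) * N (t x) * N (- a)  ≡⟨ *-comm _ _ ⟩
    N (- a) * (N (t (δ l)) * N (t x))  ≡⟨ cong (N (- a) *_) (sym (N-* _ _)) ⟩
    N (- a) * N (t (δ l) * t x)  ≡⟨ sym (N-* _ _) ⟩
    N (- a * (t (δ l) * t x))  ≡⟨ cong N (sym (W⇒δ w)) ⟩
    N (δ l * s x)  ≡⟨ N-* _ _ ⟩
    N (δ l) * N (s x)  ≡⟨ cong (N (δ l) *_) (N-φ R x) ⟩
    N (δ l) * N x  ≡⟨ sym (*-identityʳ _) ⟩
    N (δ l) * N x * 1#  ∎)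
    where open ≡-Reasoning

  W⇒Fq : N a ≢ - 1# → ∀ {x l} → x ≢ 0# → W x l → InFq l
  W⇒Fq Na≢-1 {x} {l} x≢0 w with InFq? l
  ... | yes l∈Fq = l∈Fq
  ... | no  l∉Fq = ⊥-elim (Na≢-1 (trans (sym (-‿involutive _)) (cong -_ (trans (sym (N-neg a)) (N-δ x≢0 l∉Fq w)))))

  -- δ l / t (δ l) depends only on x, so δ l is determined up to a factor in F_q.
  W-span : ∀ {x l₀ l} → x ≢ 0# → ¬ InFq l₀ → W x l₀ → W x l →
           ∃ λ ((b , c) : K × K) → (InFq b × InFq c) × b + c * l₀ ≡ l
  W-span {x} {l₀} {l} x≢0 l₀∉Fq w₀ w = (b , c) , (b∈Fq , c∈Fq) , solve 3 (λ l c l₀ → l :+ :- (c :* l₀) :+ c :* l₀ := l) refl l c l₀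
    where
    open ≡-Reasoning
    δ₀≢0 = δ-≢0 l₀∉Fq
    c b : K
    c = inv (δ l₀) * δ l
    b = l + - (c * l₀)
    cδ₀ : δ l₀ * c ≡ δ l
    cδ₀ = *-inv-cancel (δ l) δ₀≢0
    cross : t (δ l₀) * δ l ≡ δ l₀ * t (δ l)
    cross = *-cancelˡ (φ-≢0 R x≢0) (begin
      s x * (t (δ l₀) * δ l)  ≡⟨ solve 3 (λ x u v → x :* (u :* v) := u :* (v :* x)) refl (s x) (t (δ l₀)) (δ l) ⟩
      t (δ l₀) * (δ l * s x)  ≡⟨ cong (t (δ l₀) *_) (W⇒δ w) ⟩
      t (δ l₀) * (- a * (t (δ l) * t x))  ≡⟨ solve 4 (λ a u v x → u :* (:- a :* (v :* x)) := v :* (:- a :* (u :* x))) refl a (t (δ l₀)) (t (δ l)) (t x) ⟩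
      t (δ l) * (- a * (t (δ l₀) * t x))  ≡⟨ cong (t (δ l) *_) (sym (W⇒δ w₀)) ⟩
      t (δ l) * (δ l₀ * s x)  ≡⟨ solve 3 (λ x u v → u :* (v :* x) := x :* (v :* u)) refl (s x) (t (δ l)) (δ l₀) ⟩
      s x * (δ l₀ * t (δ l))  ∎)
    tc≡c : t c ≡ c
    tc≡c = *-cancelˡ (*-≢0 δ₀≢0 (φ-≢0 R′ δ₀≢0)) (begin
      δ l₀ * t (δ l₀) * t c  ≡⟨ trans (*-assoc _ _ _) (cong (δ l₀ *_) (trans (sym (φ-* R′ (δ l₀) c)) (cong t cδ₀))) ⟩
      δ l₀ * t (δ l)  ≡⟨ sym cross ⟩
      t (δ l₀) * δ l  ≡⟨ cong (t (δ l₀) *_) (sym cδ₀) ⟩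
      t (δ l₀) * (δ l₀ * c)  ≡⟨ solve 3 (λ u v c → u :* (v :* c) := v :* u :* c) refl (t (δ l₀)) (δ l₀) c ⟩
      δ l₀ * t (δ l₀) * c  ∎)
    c∈Fq : InFq c
    c∈Fq = s-fixed (trans (cong s (sym tc≡c)) (s∘t c))
    b∈Fq : InFq b
    b∈Fq = δ-0⇒Fq (trans (δ-linear l l₀ c∈Fq) (trans (cong (λ z → δ l + - z) (trans (*-comm c (δ l₀)) cδ₀)) (-‿inverseʳ _)))

  -- With the same δ l in both equations, the ratio u = y / x satisfies s u = t u and is therefore
  -- fixed by s².
  W-common : ∀ {x y l} → x ≢ 0# → ¬ InFq l → W x l → W y l → InFq (y * inv x)
  W-common {x} {y} {l} x≢0 l∉Fq wx wy = s²-fixed (trans (sym (φ-∘ R R u)) (trans (cong s su≡tu) (s∘t u)))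
    where
    open ≡-Reasoning
    u = y * inv x
    δ≢0 = δ-≢0 l∉Fq
    y≡xu : y ≡ x * u
    y≡xu = sym (trans (cong (x *_) (*-comm y (inv x))) (*-inv-cancel y x≢0))
    e : δ l * (s x * s u) ≡ - a * (t (δ l) * (t x * t u))
    e = trans (cong (δ l *_) (trans (sym (φ-* R x u)) (cong s (sym y≡xu))))
          (trans (W⇒δ wy) (cong (λ z → - a * (t (δ l) * z)) (trans (cong t y≡xu) (φ-* R′ x u))))
    su≡tu : s u ≡ t u
    su≡tu = *-cancelˡ (*-≢0 δ≢0 (φ-≢0 R x≢0)) (begin
      δ l * s x * s u  ≡⟨ *-assoc _ _ _ ⟩
      δ l * (s x * s u)  ≡⟨ e ⟩
      - a * (t (δ l) * (t x * t u))  ≡⟨ solve 4 (λ a d x u → a :* (d :* (x :* u)) := a :* (d :* x) :* u) refl (- a) (t (δ l)) (t x) (t u) ⟩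
      - a * (t (δ l) * t x) * t u  ≡⟨ cong (_* t u) (sym (W⇒δ wx)) ⟩
      δ l * s x * t u  ∎)

  -- `P` is an F_q-space of scalars inside `W x`: either `W x` itself, or the scalars that serve
  -- both coordinates of a vector of U.
  module _ (P : K → Set) (P? : ∀ l → Dec (P l)) {x : K} (x≢0 : x ≢ 0#) (P⇒W : ∀ l → P l → W x l)
           (P-combination : ∀ {l b c} → P l → InFq b → InFq c → P (b + c * l)) where

    -- The map (b, c) ↦ b + c l₀ from F_q² to `P` is onto by `W-span`, and injective because l₀ is
    -- not in F_q.
    #W-large : ∀ {l₀} → P l₀ → ¬ InFq l₀ → EK.# P? ≡ q ^ 2
    #W-large {l₀} p₀ l₀∉Fq = trans (sym (bijection K²-enum K-enum Fq²? P? combine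
        (λ (b , c) (b∈ , c∈) → P-combination p₀ b∈ c∈) injective
        (λ l pl → W-span x≢0 l₀∉Fq (P⇒W l₀ p₀) (P⇒W l pl))))
      (trans (fiber-= K²-enum K-enum Fq²? InFq? proj₁ (λ _ → proj₁) fib)
             (cong₂ _*ℕ_ #Fq (sym (ℕₚ.*-identityʳ q))))
      where
      Fq²? : ∀ z → Dec (InFq (proj₁ z) × InFq (proj₂ z))
      Fq²? (b , c) = InFq? b ×-dec InFq? c
      combine : K × K → K
      combine (b , c) = b + c * l₀
      injective : ∀ z z′ → InFq (proj₁ z) × InFq (proj₂ z) → InFq (proj₁ z′) × InFq (proj₂ z′) →
                  combine z ≡ combine z′ → z ≡ z′
      injective (b , c) (b′ , c′) (b∈ , c∈) (b′∈ , c′∈) e with (c + - c′) ≟ 0#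
      ... | yes z = cong₂ _,_ (trans (solve 3 (λ b c l → b := b :+ c :* l :+ :- (c :* l)) refl b c l₀)
                      (trans (cong₂ (λ u v → u + - (v * l₀)) e c≡c′) (solve 3 (λ b c l → b :+ c :* l :+ :- (c :* l) := b) refl b′ c′ l₀))) c≡c′
        where c≡c′ = x-y≡0⇒x≡y z
      ... | no nz = ⊥-elim (l₀∉Fq (subst InFq (sym l₀≡) (Fq-* (Fq-inv nz (Fq-- c∈ c′∈)) (Fq-- b′∈ b∈))))
        where
        Fq-- : ∀ {x y} → InFq x → InFq y → InFq (x + - y)
        Fq-- ex ey = Fq-+ ex (trans (sym (φ1≡pow-q _)) (trans (φ-neg 1 _) (cong -_ (trans (φ1≡pow-q _) ey))))
        l₀≡ : l₀ ≡ inv (c + - c′) * (b′ + - b)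
        l₀≡ = trans (sym (inv-*-cancel l₀ nz)) (cong (inv (c + - c′) *_)
          (trans (solve 4 (λ b c c′ l → (c :+ :- c′) :* l := b :+ c :* l :+ :- b :+ :- (c′ :* l)) refl b c c′ l₀)
            (trans (cong (λ z → z + - b + - (c′ * l₀)) e) (solve 4 (λ b b′ c′ l → b′ :+ c′ :* l :+ :- b :+ :- (c′ :* l) := b′ :+ :- b) refl b b′ c′ l₀))))
      fib : ∀ y → InFq y → E².# (λ z → Fq²? z ×-dec (proj₁ z ≟ y)) ≡ q
      fib y y∈ = trans (sym (bijection K-enum K²-enum InFq? _ (y ,_) (λ c c∈ → (y∈ , c∈) , refl)
        (λ _ _ _ _ → cong proj₂) λ { (_ , c) ((_ , c∈) , refl) → c , c∈ , refl })) #Fq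

  H : K → Set
  H x = x ≢ 0# × ∃ λ l → ¬ InFq l × W x l

  H? : ∀ x → Dec (H x)
  H? x = ≢0? x ×-dec EK.exists? (λ l → ¬? (InFq? l) ×-dec W? x l)

  #W-H : ∀ {x} → H x → EK.# (W? x) ≡ q ^ 2
  #W-H {x} (x≢0 , l₀ , l₀∉Fq , w₀) = #W-large (W x) (W? x) x≢0 (λ _ w → w) W-combination w₀ l₀∉Fq

  module _ (N-a≡1 : N (- a) ≡ 1#) where

    -- Put x = s y. The equation of `W⇒δ` becomes s² y = g y with g = -a · t (δ l) / δ l, and N g =
    -- 1, so Hilbert 90 for s² applies.
    #x-for : ∀ {l} → ¬ InFq l → EK.# (λ x → ≢0? x ×-dec W? x l) ≡ q-1
    #x-for {l} l∉Fq = trans (sym (bijection K-enum K-enum (solution? g) (λ x → ≢0? x ×-dec W? x l) s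
        (λ y (y≢0 , e) → φ-≢0 R y≢0 , δ⇒W (begin
           μ * s (s y)  ≡⟨ cong (μ *_) (trans (φ-∘ R R y) e) ⟩
           μ * (g * y)  ≡⟨ cong (λ z → μ * (z * y)) (*-comm _ _) ⟩
           μ * (inv μ * (- a * t μ) * y)  ≡⟨ trans (cong (μ *_) (*-assoc _ _ y)) (*-inv-cancel _ μ≢0) ⟩
           - a * t μ * y  ≡⟨ *-assoc _ _ y ⟩
           - a * (t μ * y)  ≡⟨ cong (λ z → - a * (t μ * z)) (sym (t∘s y)) ⟩
           - a * (t μ * t (s y))  ∎))
        (λ _ _ _ _ → s-injective)
        (λ x (x≢0 , w) → t x , (φ-≢0 R′ x≢0 , *-cancelˡ μ≢0 (begin
           μ * φ (R +ℕ R) (t x)  ≡⟨ cong (μ *_) (trans (sym (φ-∘ R R (t x))) (cong s (s∘t x))) ⟩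
           μ * s x  ≡⟨ W⇒δ w ⟩
           - a * (t μ * t x)  ≡⟨ sym (*-assoc _ _ _) ⟩
           - a * t μ * t x  ≡⟨ sym (trans (cong (μ *_) (*-assoc _ _ _)) (*-inv-cancel _ μ≢0)) ⟩
           μ * (inv μ * (- a * t μ) * t x) ≡⟨ cong (λ z → μ * (z * t x)) (*-comm _ _) ⟩
           μ * (g * t x)  ∎)) , s∘t x)))
      (#solutions Ng≡1)
      where
      open ≡-Reasoning
      open Hilbert90 (R +ℕ R) s²-fixed
      μ = δ l
      μ≢0 = δ-≢0 l∉Fq
      g = - a * t μ * inv μ
      Ng≡1 : N g ≡ 1#
      Ng≡1 = begin
        N (- a * t μ * inv μ)  ≡⟨ trans (N-* _ _) (cong (_* N (inv μ)) (N-* _ _)) ⟩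
        N (- a) * N (t μ) * N (inv μ)  ≡⟨ cong₂ (λ u v → u * v * N (inv μ)) N-a≡1 (N-φ R′ μ) ⟩
        1# * N μ * N (inv μ)  ≡⟨ cong (_* N (inv μ)) (*-identityˡ _) ⟩
        N μ * N (inv μ)  ≡⟨ sym (N-* μ _) ⟩
        N (μ * inv μ)  ≡⟨ cong N (inv-inverseʳ μ≢0) ⟩
        N 1#  ≡⟨ pow-1 (geom n) ⟩
        1#  ∎

    -- Pairs (x, l) with l outside F_q and `W x l`: every x in `H` has q² - q such l, and each of
    -- the q^n - q elements l outside F_q has q - 1 such x.
    #H : suc (EK.# H?) *ℕ q ≡ q ^ n
    #H = trans (ℕₚ.+-comm q _) (ℕₚ.*-cancelʳ-≡ _ _ q-1 {{>-nonZero 0<q-1}} (begin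
      (EK.# H? *ℕ q +ℕ q) *ℕ q-1  ≡⟨ ℕₚ.*-distribʳ-+ q-1 (EK.# H? *ℕ q) q ⟩
      EK.# H? *ℕ q *ℕ q-1 +ℕ q *ℕ q-1  ≡⟨ cong (_+ℕ q *ℕ q-1) (ℕₚ.*-assoc (EK.# H?) q q-1) ⟩
      EK.# H? *ℕ (q *ℕ q-1) +ℕ q *ℕ q-1  ≡⟨ cong (_+ℕ q *ℕ q-1) incidences ⟩
      #outside *ℕ q-1 +ℕ q *ℕ q-1  ≡⟨ sym (ℕₚ.*-distribʳ-+ q-1 #outside q) ⟩
      (#outside +ℕ q) *ℕ q-1  ≡⟨ cong (_*ℕ q-1) (trans (ℕₚ.+-comm #outside q)
                    (trans (cong (_+ℕ #outside) (sym #Fq)) (trans (#-complement elems InFq?) elems-card))) ⟩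
      q ^ n *ℕ q-1  ∎))
      where
      open ≡-Reasoning
      #outside = EK.# (λ l → ¬? (InFq? l))
      outside-row : ∀ x → H x → EK.# (λ l → ¬? (InFq? l) ×-dec W? x l) ≡ q *ℕ q-1
      outside-row x hx = ℕₚ.+-cancelˡ-≡ q _ _ (begin
        q +ℕ EK.# (λ l → ¬? (InFq? l) ×-dec W? x l)
          ≡⟨ cong₂ _+ℕ_ (sym (trans (#-cong elems _ InFq? (λ _ → proj₂) (λ l l∈ → W-Fq x l∈ , l∈)) #Fq))
               (#-cong elems _ _ (λ _ (a , b) → b , a) (λ _ (a , b) → b , a)) ⟩
        EK.# (λ l → W? x l ×-dec InFq? l) +ℕ EK.# (λ l → W? x l ×-dec ¬? (InFq? l))
          ≡⟨ sym (#-split elems (W? x) InFq?) ⟩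
        EK.# (W? x)  ≡⟨ #W-H hx ⟩
        q ^ 2  ≡⟨ cong (q *ℕ_) (trans (ℕₚ.*-identityʳ q) (sym 1+[q-1])) ⟩
        q *ℕ suc q-1  ≡⟨ ℕₚ.*-suc q q-1 ⟩
        q +ℕ q *ℕ q-1  ∎)
      incidences : EK.# H? *ℕ (q *ℕ q-1) ≡ #outside *ℕ q-1
      incidences = doubleCount elems elems H? (λ l → ¬? (InFq? l)) W? outside-row
        (λ l l∉Fq → trans (#-cong elems _ _ (λ x ((x≢0 , _) , w) → x≢0 , w) (λ x (x≢0 , w) → (x≢0 , l , l∉Fq , w) , w)) (#x-for l∉Fq))

-- Points of the linear set and their weights

module Weights {q n : ℕ} (F : FieldOfOrder q n) (S : Setting F) (ξ : FieldOfOrder.K F) (ξ≢0 : ξ ≢ FieldOfOrder.0# F) where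
  open Setting S
  open FiniteField F
  open Vectors F
  open Galois F {k = k} prime q≡p^ 0<n
  open Operator F S

  f : K → K → V4
  f x y = v4 x y (A y) (ξ * A x)

  open LinearSet f

  private
    ∧-intro : ∀ {b c} → T b → T c → T (b ∧ c)
    ∧-intro x y = Equivalence.from T-∧ (x , y)
    ∧-elim : ∀ {b c} → T (b ∧ c) → T b × T c
    ∧-elim = Equivalence.to T-∧

  f-zero : f 0# 0# ≡ zeroV
  f-zero = v4-cong refl refl A-0 (trans (cong (ξ *_) A-0) (zeroʳ ξ))

  f-≢0ˡ : ∀ {x y} → x ≢ 0# → f x y ≢ zeroV
  f-≢0ˡ x≢0 e = x≢0 (cong V4.c0 e)

  f-≢0ʳ : ∀ {x y} → y ≢ 0# → f x y ≢ zeroV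
  f-≢0ʳ y≢0 e = y≢0 (cong V4.c1 e)

  f-injective : ∀ {x y x′ y′} → f x y ≡ f x′ y′ → (x , y) ≡ (x′ , y′)
  f-injective e = cong₂ _,_ (cong V4.c0 e) (cong V4.c1 e)

  nonzero-pair : ∀ {x y} → f x y ≢ zeroV → x ≢ 0# ⊎ y ≢ 0#
  nonzero-pair {x} {y} f≢0 with x ≟ 0# | y ≟ 0#
  ... | no x≢0   | _        = inj₁ x≢0
  ... | yes _    | no y≢0   = inj₂ y≢0
  ... | yes refl | yes refl = ⊥-elim (f≢0 f-zero)

  inU-intro : ∀ {u} x y → f x y ≡ u → T (inU u)
  inU-intro x y e = any-intro _ (E².complete (x , y)) (eqV-complete e)

  inU-elim : ∀ {u} → T (inU u) → ∃ λ x → ∃ λ y → f x y ≡ u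
  inU-elim h with (x , y) , t ← any-elim _ {pairs} h = x , y , eqV-sound _ _ t

  inL-intro : ∀ {v} x y c → v ≢ zeroV → f x y ≢ zeroV → scale c v ≡ f x y → T (inL v)
  inL-intro x y c v≢0 f≢0 e = ∧-intro (isZeroV-intro v≢0)
    (any-intro _ (E².complete (x , y)) (∧-intro (isZeroV-intro f≢0) (inSpan1-intro c e)))

  -- `inL` provides a scalar taking v into U; here it is inverted, so that matching on `v≡cf`
  -- replaces v by a multiple of a vector of U.
  record InL (v : V4) : Set where
    field
      x y c : K
      f≢0   : f x y ≢ zeroV
      c≢0   : c ≢ 0#
      v≡cf  : v ≡ scale c (f x y)

  inL-≢0 : ∀ {v} → T (inL v) → v ≢ zeroV
  inL-≢0 h = isZeroV-elim (proj₁ (∧-elim h))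

  inL-elim : ∀ {v} → T (inL v) → InL v
  inL-elim {v} h with (x , y) , t ← any-elim _ {pairs} (proj₂ (∧-elim {not (isZeroV v)} h))
    with c , e ← inSpan1-elim {v} (proj₂ (∧-elim {not (isZeroV (f x y))} t)) = record
      { x = x ; y = y ; c = inv c ; f≢0 = f≢0 ; c≢0 = inv-≢0 c≢0
      ; v≡cf = trans (sym (scale-inv v c≢0)) (cong (scale (inv c)) e) }
    where
    f≢0 : f x y ≢ zeroV
    f≢0 = isZeroV-elim (proj₁ (∧-elim {not (isZeroV (f x y))} t))
    c≢0 : c ≢ 0#
    c≢0 = scale≢0⇒≢0 {v = v} (λ z → f≢0 (trans (sym e) z))

  inL-scale-f : ∀ {x y c} → c ≢ 0# → f x y ≢ zeroV → T (inL (scale c (f x y)))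
  inL-scale-f {x} {y} {c} c≢0 f≢0 = inL-intro x y (inv c) (scale-≢0 c≢0 f≢0) f≢0 (scale-inv _ c≢0)

  inL-f : ∀ {x y} → f x y ≢ zeroV → T (inL (f x y))
  inL-f {x} {y} f≢0 = inL-intro x y 1# f≢0 f≢0 (scale-1 _)

  inL-scale : ∀ {c v} → c ≢ 0# → T (inL v) → T (inL (scale c v))
  inL-scale {c} {v} c≢0 h with record { x = x ; y = y ; c = d ; f≢0 = f≢0 ; c≢0 = d≢0 ; v≡cf = refl } ← inL-elim h =
    subst (T ∘ inL) (sym (scale-scale c d (f x y))) (inL-scale-f (*-≢0 c≢0 d≢0) f≢0)

  W₂ : K → K → K → Set
  W₂ x y l = W x l × W y l

  W₂? : ∀ x y l → Dec (W₂ x y l)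
  W₂? x y l = W? x l ×-dec W? y l

  W₂⇒∈U : ∀ {x y l} → W₂ x y l → f (l * x) (l * y) ≡ scale l (f x y)
  W₂⇒∈U {x} {y} {l} (wx , wy) = v4-cong refl refl wy
    (trans (cong (ξ *_) wx) (solve 3 (λ ξ l u → ξ :* (l :* u) := l :* (ξ :* u)) refl ξ l (A x)))

  ∈U⇒W₂ : ∀ {x y l x′ y′} → f x′ y′ ≡ scale l (f x y) → W₂ x y l
  ∈U⇒W₂ {x} {y} {l} {x′} {y′} e =
    *-cancelˡ ξ≢0 (trans (cong (λ z → ξ * A z) (sym (cong V4.c0 e)))
      (trans (cong V4.c3 e) (solve 3 (λ ξ l u → l :* (ξ :* u) := ξ :* (l :* u)) refl ξ l (A x)))) ,
    trans (cong A (sym (cong V4.c1 e))) (cong V4.c2 e)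

  -- The first two coordinates of l · f x y already determine which vector of U it would have to be;
  -- the last two then say exactly `W₂ x y l`.
  cntPt-f : ∀ {x y} → f x y ≢ zeroV → cntPt (f x y) ≡ EK.# (W₂? x y)
  cntPt-f {x} {y} f≢0 = sym (bijection K-enum V-enum (W₂? x y) (λ u → T? (inU u ∧ inSpan1 (f x y) u)) (λ l → scale l (f x y))
    (λ l w → ∧-intro (inU-intro (l * x) (l * y) (W₂⇒∈U w)) (inSpan1-intro l refl))
    (λ _ _ _ _ → scale-cancelʳ f≢0)
    surjective)
    where
    surjective : ∀ u → T (inU u ∧ inSpan1 (f x y) u) → ∃ λ l → W₂ x y l × scale l (f x y) ≡ u
    surjective u t with x′ , y′ , e ← inU-elim {u} (proj₁ (∧-elim {inU u} t))
      with l , e′ ← inSpan1-elim {f x y} (proj₂ (∧-elim {inU u} t)) = l , ∈U⇒W₂ (trans e (sym e′)) , e′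

  cntPt-scale : ∀ {c} v → c ≢ 0# → cntPt (scale c v) ≡ cntPt v
  cntPt-scale {c} v c≢0 = #-cong allV (λ u → T? (inU u ∧ inSpan1 (scale c v) u)) (λ u → T? (inU u ∧ inSpan1 v u))
    (λ u t → ∧-intro (proj₁ (∧-elim {inU u} t)) (down u (proj₂ (∧-elim {inU u} t))))
    (λ u t → ∧-intro (proj₁ (∧-elim {inU u} t)) (up u (proj₂ (∧-elim {inU u} t))))
    where
    down : ∀ u → T (inSpan1 (scale c v) u) → T (inSpan1 v u)
    down u t with l , e ← inSpan1-elim {scale c v} t = inSpan1-intro (l * c) (trans (sym (scale-scale l c v)) e)
    up : ∀ u → T (inSpan1 v u) → T (inSpan1 (scale c v) u)
    up u t with l , e ← inSpan1-elim {v} t = inSpan1-intro (l * inv c) (trans (scale-scale (l * inv c) c v)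
      (trans (cong (λ z → scale z v) (trans (*-assoc l _ c) (trans (cong (l *_) (inv-inverseˡ c≢0)) (*-identityʳ l)))) e))

  module _ {x y : K} (f≢0 : f x y ≢ zeroV) where

    cntPt-small : (∀ l → W₂ x y l → InFq l) → cntPt (f x y) ≡ q
    cntPt-small only = trans (cntPt-f f≢0) (trans (#-cong elems (W₂? x y) InFq? only (λ l l∈ → W-Fq x l∈ , W-Fq y l∈)) #Fq)

    cntPt-large : ∀ {l} → W₂ x y l → ¬ InFq l → cntPt (f x y) ≡ q ^ 2
    cntPt-large {l} w l∉ = trans (cntPt-f f≢0) (cases (nonzero-pair f≢0))
      where
      cases : x ≢ 0# ⊎ y ≢ 0# → EK.# (W₂? x y) ≡ q ^ 2
      cases (inj₁ x≢0) = #W-large (W₂ x y) (W₂? x y) x≢0 (λ _ → proj₁)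
                           (λ (wx , wy) b c → W-combination wx b c , W-combination wy b c) w l∉
      cases (inj₂ y≢0) = #W-large (W₂ x y) (W₂? x y) y≢0 (λ _ → proj₂)
                           (λ (wx , wy) b c → W-combination wx b c , W-combination wy b c) w l∉

  large? : ∀ x y → Dec (∃ λ l → ¬ InFq l × W₂ x y l)
  large? x y = EK.exists? (λ l → ¬? (InFq? l) ×-dec W₂? x y l)

  W₂-only : ∀ {x y} → ¬ (∃ λ l → ¬ InFq l × W₂ x y l) → ∀ l → W₂ x y l → InFq l
  W₂-only none l w with InFq? l
  ... | yes l∈ = l∈
  ... | no  l∉ = ⊥-elim (none (l , l∉ , w))

  cntPt-cases : ∀ {v} → T (inL v) → cntPt v ≡ q ⊎ cntPt v ≡ q ^ 2
  cntPt-cases {v} h with record { x = x ; y = y ; f≢0 = f≢0 ; c≢0 = c≢0 ; v≡cf = refl } ← inL-elim h with large? x y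
  ... | yes (l , l∉ , w) = inj₂ (trans (cntPt-scale _ c≢0) (cntPt-large f≢0 w l∉))
  ... | no none          = inj₁ (trans (cntPt-scale _ c≢0) (cntPt-small f≢0 (W₂-only none)))

  sizeU≡ : sizeU ≡ q ^ (2 *ℕ n)
  -- `f-zero` merely inhabits a predicate that holds for every pair.
  sizeU≡ = trans (sym (bijection K²-enum V-enum (λ _ → yes f-zero) (λ u → T? (inU u)) (uncurry f)
      (λ (x , y) _ → inU-intro x y refl) (λ _ _ _ _ → f-injective)
      (λ u t → let (x , y , e) = inU-elim {u} t in (x , y) , f-zero , e)))
    (trans (#-all pairs _ (λ _ → f-zero)) (trans #K² (sym (trans (cong (λ m → q ^ (n +ℕ m)) (ℕₚ.+-identityʳ n)) (ℕₚ.^-distribˡ-+-* q n n)))))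

  maximumScattered : N a ≢ - 1# → MaximumScattered
  maximumScattered Na≢-1 = scattered , sizeU≡
    where
    scattered : Scattered
    scattered v h with record { x = x ; y = y ; f≢0 = f≢0 ; c≢0 = c≢0 ; v≡cf = refl } ← inL-elim h =
      trans (cntPt-scale _ c≢0) (trans (cntPt-small f≢0 (only (nonzero-pair f≢0))) (sym (ℕₚ.*-identityʳ q)))
      where
      only : x ≢ 0# ⊎ y ≢ 0# → ∀ l → W₂ x y l → InFq l
      only (inj₁ x≢0) l (wx , _) = W⇒Fq Na≢-1 x≢0 wx
      only (inj₂ y≢0) l (_ , wy) = W⇒Fq Na≢-1 y≢0 wy

  weight≡2 : ∀ v w → T (inL v) → Weight v w → 1 < w → w ≡ 2
  weight≡2 v w h e 1<w with cntPt-cases h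
  ... | inj₁ e′ = ⊥-elim (ℕₚ.<⇒≢ 1<w (sym (^-injective w 1 (trans (sym e) (trans e′ (sym (ℕₚ.*-identityʳ q)))))))
    where
    ^-injective : ∀ i j → q ^ i ≡ q ^ j → i ≡ j
    ^-injective i j e with ℕₚ.<-cmp i j
    ... | tri< i<j _ _ = ⊥-elim (ℕₚ.<⇒≢ (ℕₚ.^-monoʳ-< q 2≤q i<j) e)
    ... | tri≈ _ i≡j _ = i≡j
    ... | tri> _ _ j<i = ⊥-elim (ℕₚ.<⇒≢ (ℕₚ.^-monoʳ-< q 2≤q j<i) (sym e))
  ... | inj₂ e′ = ℕₚ.≤-antisym (ℕₚ.≮⇒≥ (λ 2<w → ℕₚ.<⇒≢ (ℕₚ.^-monoʳ-< q 2≤q 2<w) (trans (sym e′) e))) 1<w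

  lineWeight-n : ∀ ℓ (φ : K → V4) → (∀ c → T (inU (φ c))) → (∀ c → T (onLine ℓ (φ c))) →
                 (∀ c d → φ c ≡ φ d → c ≡ d) → (∀ x y → T (onLine ℓ (f x y)) → ∃ λ c → φ c ≡ f x y) → LineWeight ℓ n
  lineWeight-n ℓ φ φ∈U φ∈ℓ φ-injective φ-onto = trans
    (sym (bijection K-enum V-enum (λ _ → yes f-zero) (λ u → T? (inU u ∧ onLine ℓ u)) φ
      (λ c _ → ∧-intro (φ∈U c) (φ∈ℓ c)) (λ c d _ _ → φ-injective c d) surjective))
    (trans (#-all elems _ (λ _ → f-zero)) elems-card)
    where
    surjective : ∀ u → T (inU u ∧ onLine ℓ u) → ∃ λ c → f 0# 0# ≡ zeroV × φ c ≡ u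
    surjective u h with x , y , refl ← inU-elim {u} (proj₁ (∧-elim {inU u} h)) =
      let (c , e) = φ-onto x y (proj₂ (∧-elim {inU u} h)) in c , f-zero , e

  -- Counts incident pairs (vector spanning a point of the class, nonzero vector of U on that point).
  module PointClass (Class : V4 → Set) (C? : ∀ v → Dec (Class v)) (C⇒L : ∀ v → Class v → T (inL v))
    (C-scale : ∀ c v → c ≢ 0# → Class v → Class (scale c v)) (w : ℕ) (cntPt-C : ∀ v → Class v → cntPt v ≡ suc w) where

    #pointClass : EV.# C? *ℕ w ≡ E².# (C? ∘ uncurry f) *ℕ EK.# ≢0?
    #pointClass = doubleCount allV pairs C? (C? ∘ uncurry f) (λ v z → T? (inSpan1 v (uncurry f z))) rows columns
      where
      rows : ∀ v → Class v → E².# (λ z → C? (uncurry f z) ×-dec T? (inSpan1 v (uncurry f z))) ≡ w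
      rows v cv = ℕₚ.suc-injective (begin
        suc (E².# (λ z → C? (uncurry f z) ×-dec T? (inSpan1 v (uncurry f z))))
          -- The pair (0, 0) is the only one whose vector lies in the span of v without belonging to
          -- the class; adding it back accounts for the successor.
          ≡⟨ cong suc (#-cong pairs _ _ (λ z (cz , t) → t , (λ { refl → inL-≢0 (C⇒L _ cz) f-zero })) back) ⟩
        suc (E².# (λ z → T? (inSpan1 v (uncurry f z)) ×-dec ¬? (z E².≟ (0# , 0#))))
          ≡⟨ sym (E².#-remove (λ z → T? (inSpan1 v (uncurry f z))) (0# , 0#) (inSpan1-intro 0# (trans (scale-0 v) (sym f-zero)))) ⟩
        E².# (λ z → T? (inSpan1 v (uncurry f z)))
          ≡⟨ bijection K²-enum V-enum _ (λ u → T? (inU u ∧ inSpan1 v u)) (uncurry f)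
               (λ (x , y) t → ∧-intro (inU-intro x y refl) t) (λ _ _ _ _ → f-injective) surjective ⟩
        cntPt v  ≡⟨ cntPt-C v cv ⟩
        suc w  ∎)
        where
        open ≡-Reasoning
        back : ∀ z → T (inSpan1 v (uncurry f z)) × z ≢ (0# , 0#) → Class (uncurry f z) × T (inSpan1 v (uncurry f z))
        back (x , y) (t , z≢0) with c , e ← inSpan1-elim {v} t = subst Class e (C-scale c v
          (scale≢0⇒≢0 {v = v} (λ e′ → z≢0 (f-injective (trans (trans (sym e) e′) (sym f-zero))))) cv) , t
        surjective : ∀ u → T (inU u ∧ inSpan1 v u) → ∃ λ z → T (inSpan1 v (uncurry f z)) × uncurry f z ≡ u
        surjective u t with x , y , refl ← inU-elim {u} (proj₁ (∧-elim {inU u} t)) = (x , y) , proj₂ (∧-elim {inU u} t) , refl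
      columns : ∀ z → Class (uncurry f z) → EV.# (λ v → C? v ×-dec T? (inSpan1 v (uncurry f z))) ≡ EK.# ≢0?
      columns (x , y) cf = sym (bijection K-enum V-enum ≢0? _ (λ c → scale c (f x y))
        (λ c c≢0 → C-scale c _ c≢0 cf , inSpan1-intro (inv c) (scale-inv _ c≢0))
        (λ _ _ _ _ → scale-cancelʳ (inL-≢0 (C⇒L _ cf)))
        surjective)
        where
        surjective : ∀ v → Class v × T (inSpan1 v (f x y)) → ∃ λ c → c ≢ 0# × scale c (f x y) ≡ v
        surjective v (cv , t) with c , e ← inSpan1-elim {v} t = inv c , inv-≢0 c≢0 , trans (cong (scale (inv c)) (sym e)) (scale-inv v c≢0)
          where
          c≢0 : c ≢ 0#
          c≢0 = scale≢0⇒≢0 {v = v} (λ z → inL-≢0 (C⇒L _ cf) (trans (sym e) z))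

-- The case N a = −1

private
  -- Identities over the natural numbers, kept free of subtraction: `e` stands for q - 1, `g` and
  -- `g′` for geom n and geom (n - 1), and in `square` the variable `w` stands for g′ q = g - 1.
  module CountArithmetic where
    open ℕSolver.+-*-Solver

    square-1 : ∀ e → suc e ^ 2 ≡ suc ((suc e +ℕ 1) *ℕ e)
    square-1 = solve 1 (λ e → (con 1 :+ e) :* ((con 1 :+ e) :* con 1) := con 1 :+ (con 1 :+ e :+ con 1) :* e) refl

    heavy-vectors : ∀ g g′ e q → (g′ *ℕ e +ℕ g′ *ℕ e *ℕ q) *ℕ (g *ℕ e) ≡ g′ *ℕ (g *ℕ e) *ℕ ((q +ℕ 1) *ℕ e)
    heavy-vectors = solve 4 (λ g g′ e q → (g′ :* e :+ g′ :* e :* q) :* (g :* e) := g′ :* (g :* e) :* ((q :+ con 1) :* e)) refl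

    regroup : ∀ g′ e q l → suc (g′ *ℕ q *ℕ e) +ℕ (g′ *ℕ e +ℕ l) ≡ suc (g′ *ℕ e +ℕ g′ *ℕ e *ℕ q +ℕ l)
    regroup = solve 4 (λ g′ e q l → con 1 :+ g′ :* q :* e :+ (g′ :* e :+ l) := con 1 :+ (g′ :* e :+ g′ :* e :* q :+ l)) refl

    square : ∀ w e → suc (suc w *ℕ e) *ℕ suc (suc w *ℕ e) ≡ suc (w *ℕ e) +ℕ (suc (suc w *ℕ e) *ℕ suc w +ℕ 1) *ℕ e
    square = solve 2 (λ w e → (con 1 :+ (con 1 :+ w) :* e) :* (con 1 :+ (con 1 :+ w) :* e)
               := con 1 :+ w :* e :+ ((con 1 :+ (con 1 :+ w) :* e) :* (con 1 :+ w) :+ con 1) :* e) refl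

    collect : ∀ g′ g e l → g′ *ℕ (g *ℕ e) +ℕ l *ℕ g ≡ (g′ *ℕ e +ℕ l) *ℕ g
    collect = solve 4 (λ g′ g e l → g′ :* (g :* e) :+ l :* g := (g′ :* e :+ l) :* g) refl

module HeavyPoints {q n : ℕ} (F : FieldOfOrder q n) (S : Setting F) (ξ : FieldOfOrder.K F) (ξ≢0 : ξ ≢ FieldOfOrder.0# F)
  (Na≡-1 : Setup.N F (Setting.a S) ≡ FieldOfOrder.-_ F (FieldOfOrder.1# F)) where
  open Setting S
  open FiniteField F
  open Vectors F
  open Galois F {k = k} prime q≡p^ 0<n
  open Operator F S
  open Weights F S ξ ξ≢0
  open LinearSet f

  private
    N-a≡1 : N (- a) ≡ 1#
    N-a≡1 = trans (N-neg a) (trans (cong -_ Na≡-1) (-‿involutive 1#))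

  q<q² : q < q ^ 2
  q<q² = ℕₚ.≤-trans (ℕₚ.≤-reflexive (cong suc (sym (ℕₚ.*-identityʳ q)))) (ℕₚ.^-monoʳ-< q 2≤q {1} {2} (s≤s (s≤s z≤n)))

  Heavy? : ∀ v → Dec (T (heavy v))
  Heavy? v = T? (heavy v)

  heavy-intro : ∀ {v} → T (inL v) → cntPt v ≢ q → T (heavy v)
  heavy-intro {v} l ne = Equivalence.from T-∧ (l , T-not-intro (ne ∘ ℕₚ.≡ᵇ⇒≡ (cntPt v) q))

  heavy-elim : ∀ {v} → T (heavy v) → T (inL v) × cntPt v ≢ q
  heavy-elim {v} t = let (l , ne) = Equivalence.to (T-∧ {inL v}) t in l , T-not-elim ne ∘ ℕₚ.≡⇒≡ᵇ (cntPt v) q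

  heavy-cntPt : ∀ {v} → T (heavy v) → cntPt v ≡ q ^ 2
  heavy-cntPt {v} t with l , ne ← heavy-elim {v} t with cntPt-cases l
  ... | inj₁ e = ⊥-elim (ne e)
  ... | inj₂ e = e

  heavy-f-intro : ∀ {x y l} → f x y ≢ zeroV → ¬ InFq l → W₂ x y l → T (heavy (f x y))
  heavy-f-intro f≢0 l∉ w = heavy-intro (inL-f f≢0) (λ e → ℕₚ.<⇒≢ q<q² (trans (sym e) (cntPt-large f≢0 w l∉)))

  heavy-f-elim : ∀ {x y} → T (heavy (f x y)) → f x y ≢ zeroV × ∃ λ l → ¬ InFq l × W₂ x y l
  heavy-f-elim {x} {y} t with large? x y
  ... | yes large = inL-≢0 (proj₁ (heavy-elim {f x y} t)) , large
  ... | no none   = ⊥-elim (proj₂ (heavy-elim {f x y} t) (cntPt-small (inL-≢0 (proj₁ (heavy-elim {f x y} t))) (W₂-only none)))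

  W-scaleˡ : ∀ {x l c} → InFq c → W x l → W (c * x) l
  W-scaleˡ {x} {l} {c} c∈ w = begin
    A (l * (c * x))  ≡⟨ cong A (solve 3 (λ l c x → l :* (c :* x) := c :* (l :* x)) refl l c x) ⟩
    A (c * (l * x))  ≡⟨ trans (A-Fq* _ c∈) (cong (c *_) w) ⟩
    c * (l * A x)  ≡⟨ solve 3 (λ l c x → c :* (l :* x) := l :* (c :* x)) refl l c (A x) ⟩
    l * (c * A x)  ≡⟨ cong (l *_) (sym (A-Fq* x c∈)) ⟩
    l * A (c * x)  ∎
    where open ≡-Reasoning

  W-0 : ∀ l → W 0# l
  W-0 l = trans (cong A (zeroʳ l)) (trans A-0 (sym (trans (cong (l *_) A-0) (zeroʳ l))))

  -- Pairs with x = 0 need y in `H`. For x ≠ 0, x must be in `H`, and by `W-common` the admissible y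
  -- are exactly the q multiples of x over F_q.
  #heavyPairs : E².# (Heavy? ∘ uncurry f) ≡ EK.# H? +ℕ EK.# H? *ℕ q
  #heavyPairs = trans (#-split pairs (Heavy? ∘ uncurry f) (λ z → proj₁ z ≟ 0#)) (cong₂ _+ℕ_ axis (fiber-= K²-enum K-enum _ H? proj₁ to-H fib))
    where
    axis : E².# (λ z → Heavy? (uncurry f z) ×-dec (proj₁ z ≟ 0#)) ≡ EK.# H?
    axis = sym (bijection K-enum K²-enum H? _ (0# ,_)
      (λ y (y≢0 , l , l∉ , w) → heavy-f-intro (f-≢0ʳ y≢0) l∉ (W-0 l , w) , refl)
      (λ _ _ _ _ → cong proj₂)
      λ { (_ , y) (t , refl) → let (f≢0 , l , l∉ , (_ , w)) = heavy-f-elim t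
                    in y , ((λ { refl → f≢0 f-zero }) , l , l∉ , w) , refl })
    to-H : ∀ z → T (heavy (uncurry f z)) × proj₁ z ≢ 0# → H (proj₁ z)
    to-H (x , y) (t , x≢0) = let (_ , l , l∉ , (w , _)) = heavy-f-elim t in x≢0 , l , l∉ , w
    fib : ∀ x → H x → E².# (λ z → (Heavy? (uncurry f z) ×-dec ¬? (proj₁ z ≟ 0#)) ×-dec (proj₁ z ≟ x)) ≡ q
    fib x (x≢0 , l , l∉ , w) = trans (sym (bijection K-enum K²-enum InFq? _ (λ c → x , c * x)
        (λ c c∈ → (heavy-f-intro (f-≢0ˡ x≢0) l∉ (w , W-scaleˡ c∈ w) , x≢0) , refl)
        (λ c d _ _ e → *-cancelˡ x≢0 (trans (*-comm x c) (trans (cong proj₂ e) (*-comm d x))))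
        λ { (_ , y) ((t , _) , refl) → let (_ , _ , l∉′ , (wx , wy)) = heavy-f-elim t
              in y * inv x , W-common x≢0 l∉′ wx wy ,
                 cong (x ,_) (trans (*-assoc y _ x) (trans (cong (y *_) (inv-inverseˡ x≢0)) (*-identityʳ y))) }))
      #Fq

  inL-f? : ∀ z → Dec (T (inL (uncurry f z)))
  inL-f? z = T? (inL (uncurry f z))

  #Lpairs : suc (E².# inL-f?) ≡ q ^ n *ℕ q ^ n
  #Lpairs = sym (trans (sym #K²) (trans (sym (#-all pairs (λ _ → yes f-zero) (λ _ → f-zero)))
    (trans (E².#-remove (λ _ → yes f-zero) (0# , 0#) f-zero)
      (cong suc (#-cong pairs _ inL-f? (λ (x , y) (_ , ne) → inL-f (λ e → ne (f-injective (trans e (sym f-zero)))))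
                    (λ z t → f-zero , λ { refl → inL-≢0 t f-zero }))))))

  Light? : ∀ v → Dec (T (inL v) × ¬ T (heavy v))
  Light? v = T? (inL v) ×-dec ¬? (Heavy? v)

  light-cntPt : ∀ v → T (inL v) × ¬ T (heavy v) → cntPt v ≡ q
  light-cntPt v (l , ¬h) with cntPt v ℕ.≟ q
  ... | yes e = e
  ... | no ne = ⊥-elim (¬h (heavy-intro l ne))

  heavy-scale : ∀ c v → c ≢ 0# → T (heavy v) → T (heavy (scale c v))
  heavy-scale c v c≢0 t = let (l , ne) = heavy-elim {v} t in heavy-intro (inL-scale c≢0 l) (λ e → ne (trans (sym (cntPt-scale v c≢0)) e))

  g g′ e hK hV lV lP : ℕ
  g  = geom n
  g′ = geom (ℕ.pred n)
  e  = q-1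
  hK = EK.# H?
  hV = countV heavy
  lV = EV.# Light?
  lP = E².# (Light? ∘ uncurry f)

  private
    n≡1+ : suc (ℕ.pred n) ≡ n
    n≡1+ = ℕₚ.suc-pred n {{>-nonZero 0<n}}

    hK≡ : hK ≡ g′ *ℕ e
    hK≡ = ℕₚ.suc-injective (ℕₚ.*-cancelʳ-≡ _ _ q (begin
      suc hK *ℕ q  ≡⟨ #H N-a≡1 ⟩
      q ^ n  ≡⟨ cong (q ^_) (sym n≡1+) ⟩
      q *ℕ q ^ ℕ.pred n  ≡⟨ ℕₚ.*-comm q _ ⟩
      q ^ ℕ.pred n *ℕ q  ≡⟨ cong (_*ℕ q) (sym (1+geom*[q-1] (ℕ.pred n))) ⟩
      suc (g′ *ℕ e) *ℕ q  ∎))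
      where open ≡-Reasoning

    1+g′q≡g : suc (g′ *ℕ q) ≡ g
    1+g′q≡g = trans (1+geom*q (ℕ.pred n)) (cong geom n≡1+)

    q²≡ : q ^ 2 ≡ suc ((q +ℕ 1) *ℕ e)
    q²≡ = subst (λ z → z ^ 2 ≡ suc ((z +ℕ 1) *ℕ e)) 1+[q-1]
      (CountArithmetic.square-1 e)

    -- A heavy point carries q² - 1 = (q + 1)(q - 1) nonzero vectors of U, and the number of heavy
    -- pairs is |H| (q + 1), so that (q + 1)(q - 1) cancels and g′ points remain.
    hV≡ : hV ≡ g′ *ℕ (g *ℕ e)
    hV≡ = ℕₚ.*-cancelʳ-≡ _ _ ((q +ℕ 1) *ℕ e) {{>-nonZero (ℕₚ.*-mono-≤ (ℕₚ.m≤n+m 1 q) 0<q-1)}} (begin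
      hV *ℕ ((q +ℕ 1) *ℕ e)  ≡⟨ PointClass.#pointClass (T ∘ heavy) Heavy? (λ v t → proj₁ (heavy-elim {v} t))
                    heavy-scale ((q +ℕ 1) *ℕ e) (λ v t → trans (heavy-cntPt {v} t) q²≡) ⟩
      E².# (Heavy? ∘ uncurry f) *ℕ EK.# ≢0?  ≡⟨ cong₂ _*ℕ_ (trans #heavyPairs (cong (λ z → z +ℕ z *ℕ q) hK≡)) #K* ⟩
      (g′ *ℕ e +ℕ g′ *ℕ e *ℕ q) *ℕ (g *ℕ e)  ≡⟨ CountArithmetic.heavy-vectors g g′ e q ⟩
      g′ *ℕ (g *ℕ e) *ℕ ((q +ℕ 1) *ℕ e)  ∎)
      where open ≡-Reasoning

    lV≡ : lV ≡ lP *ℕ g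
    lV≡ = ℕₚ.*-cancelʳ-≡ _ _ e {{>-nonZero 0<q-1}} (begin
      lV *ℕ e  ≡⟨ PointClass.#pointClass (λ v → T (inL v) × ¬ T (heavy v)) Light? (λ _ → proj₁)
                    (λ c v c≢0 (l , ¬h) → inL-scale c≢0 l , λ t → ¬h (subst (T ∘ heavy) (scale-inv v c≢0) (heavy-scale (inv c) _ (inv-≢0 c≢0) t)))
                    e (λ v t → trans (light-cntPt v t) (sym 1+[q-1])) ⟩
      lP *ℕ EK.# ≢0?  ≡⟨ cong (lP *ℕ_) #K* ⟩
      lP *ℕ (g *ℕ e)  ≡⟨ sym (ℕₚ.*-assoc lP g e) ⟩
      lP *ℕ g *ℕ e  ∎)
      where open ≡-Reasoning

    q^n≡ : q ^ n ≡ suc (g *ℕ e)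
    q^n≡ = sym (1+geom*[q-1] n)

    lP-sum : suc (g′ *ℕ e +ℕ g′ *ℕ e *ℕ q +ℕ lP) ≡ suc (g *ℕ e) *ℕ suc (g *ℕ e)
    lP-sum = begin
      suc (g′ *ℕ e +ℕ g′ *ℕ e *ℕ q +ℕ lP)
        ≡⟨ cong (λ z → suc (z +ℕ lP)) (sym (trans #heavyPairs (cong (λ z → z +ℕ z *ℕ q) hK≡))) ⟩
      suc (E².# (Heavy? ∘ uncurry f) +ℕ lP)
        ≡⟨ cong (λ z → suc (z +ℕ lP)) (#-cong pairs _ _ (λ z t → proj₁ (heavy-elim {uncurry f z} t) , t) (λ _ → proj₂)) ⟩
      suc (E².# (λ z → inL-f? z ×-dec Heavy? (uncurry f z)) +ℕ lP)
        ≡⟨ cong suc (sym (#-split pairs inL-f? (Heavy? ∘ uncurry f))) ⟩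
      suc (E².# inL-f?)  ≡⟨ #Lpairs ⟩
      q ^ n *ℕ q ^ n  ≡⟨ cong₂ _*ℕ_ q^n≡ q^n≡ ⟩
      suc (g *ℕ e) *ℕ suc (g *ℕ e) ∎
      where open ≡-Reasoning

    -- This is `lP-sum` after cancelling 1 + g′ q e. The left side is the combination that `collect`
    -- produces from the heavy and the light vectors together.
    g′e+lP : g′ *ℕ e +ℕ lP ≡ (suc (g *ℕ e) *ℕ g +ℕ 1) *ℕ e
    g′e+lP = ℕₚ.+-cancelˡ-≡ (suc (g′ *ℕ q *ℕ e)) _ _ (begin
      suc (g′ *ℕ q *ℕ e) +ℕ (g′ *ℕ e +ℕ lP)
        ≡⟨ CountArithmetic.regroup g′ e q lP ⟩
      suc (g′ *ℕ e +ℕ g′ *ℕ e *ℕ q +ℕ lP)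
        ≡⟨ lP-sum ⟩
      suc (g *ℕ e) *ℕ suc (g *ℕ e)
        ≡⟨ subst (λ z → suc (z *ℕ e) *ℕ suc (z *ℕ e) ≡ suc (g′ *ℕ q *ℕ e) +ℕ (suc (z *ℕ e) *ℕ z +ℕ 1) *ℕ e) 1+g′q≡g
             (CountArithmetic.square (g′ *ℕ q) e) ⟩
      suc (g′ *ℕ q *ℕ e) +ℕ (suc (g *ℕ e) *ℕ g +ℕ 1) *ℕ e ∎)
      where open ≡-Reasoning

    q^n∸1 : q ^ n ∸ 1 ≡ g *ℕ e
    q^n∸1 = cong (_∸ 1) q^n≡

  #heavyPoints : Σ ℕ λ m → NumPoints heavy m × m *ℕ (q ∸ 1) ≡ q ^ (n ∸ 1) ∸ 1
  #heavyPoints = g′ , trans hV≡ (cong (g′ *ℕ_) (sym q^n∸1)) , cong (_∸ 1) (1+geom*[q-1] (ℕ.pred n))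

  #points : Σ ℕ λ m → NumPoints inL m × m *ℕ (q ∸ 1) ≡ (q ^ (2 *ℕ n) ∸ q ^ n) +ℕ (q ∸ 1)
  #points = q ^ n *ℕ g +ℕ 1 , number , sum
    where
    open ≡-Reasoning
    number : countV inL ≡ (q ^ n *ℕ g +ℕ 1) *ℕ (q ^ n ∸ 1)
    number = begin
      countV inL
        ≡⟨ #-split allV (λ v → T? (inL v)) Heavy? ⟩
      EV.# (λ v → T? (inL v) ×-dec Heavy? v) +ℕ lV
        ≡⟨ cong₂ _+ℕ_ (trans (#-cong allV _ Heavy? (λ _ → proj₂) (λ v t → proj₁ (heavy-elim {v} t) , t)) hV≡) lV≡ ⟩
      g′ *ℕ (g *ℕ e) +ℕ lP *ℕ g
        ≡⟨ CountArithmetic.collect g′ g e lP ⟩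
      (g′ *ℕ e +ℕ lP) *ℕ g
        ≡⟨ cong (_*ℕ g) g′e+lP ⟩
      (suc (g *ℕ e) *ℕ g +ℕ 1) *ℕ e *ℕ g
        ≡⟨ trans (ℕₚ.*-assoc (suc (g *ℕ e) *ℕ g +ℕ 1) e g) (cong ((suc (g *ℕ e) *ℕ g +ℕ 1) *ℕ_) (ℕₚ.*-comm e g)) ⟩
      (suc (g *ℕ e) *ℕ g +ℕ 1) *ℕ (g *ℕ e)
        ≡⟨ cong₂ (λ u v → (u *ℕ g +ℕ 1) *ℕ v) (sym q^n≡) (sym q^n∸1) ⟩
      (q ^ n *ℕ g +ℕ 1) *ℕ (q ^ n ∸ 1) ∎
    sum : (q ^ n *ℕ g +ℕ 1) *ℕ (q ∸ 1) ≡ (q ^ (2 *ℕ n) ∸ q ^ n) +ℕ (q ∸ 1)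
    sum = begin
      (q ^ n *ℕ g +ℕ 1) *ℕ e  ≡⟨ ℕₚ.*-distribʳ-+ e (q ^ n *ℕ g) 1 ⟩
      q ^ n *ℕ g *ℕ e +ℕ 1 *ℕ e  ≡⟨ cong₂ _+ℕ_ (ℕₚ.*-assoc (q ^ n) g e) (ℕₚ.*-identityˡ e) ⟩
      q ^ n *ℕ (g *ℕ e) +ℕ e  ≡⟨ cong (λ z → q ^ n *ℕ z +ℕ e) (sym q^n∸1) ⟩
      q ^ n *ℕ (q ^ n ∸ 1) +ℕ e  ≡⟨ cong (_+ℕ e) (trans (ℕₚ.*-distribˡ-∸ (q ^ n) (q ^ n) 1)
                    (cong₂ _∸_ (sym (trans (cong (λ z → q ^ (n +ℕ z)) (ℕₚ.+-identityʳ n)) (ℕₚ.^-distribˡ-+-* q n n))) (ℕₚ.*-identityʳ (q ^ n)))) ⟩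
      (q ^ (2 *ℕ n) ∸ q ^ n) +ℕ e  ∎

-- Reordering the powers of Frobenius

module _ {n : ℕ} .{{_ : NonZero n}} where

  %-*ˡ : ∀ x y → (x % n *ℕ y) % n ≡ (x *ℕ y) % n
  %-*ˡ x y = trans (%-distribˡ-* (x % n) y n) (trans (cong (λ z → (z *ℕ (y % n)) % n) (m%n%n≡m%n x n)) (sym (%-distribˡ-* x y n)))

  inverse-mod : ∀ {R} → Coprime n R → ∃ λ R* → (R *ℕ R*) % n ≡ 1 % n
  inverse-mod {R} co with coprime-Bézout co
  ... | Bézout.-+ k l 1+kn≡lR = l , trans (cong (_% n) (trans (ℕₚ.*-comm R l) (sym 1+kn≡lR))) ([m+kn]%n≡m%n 1 k n)
  -- Here -l is an inverse of R; modulo n it is represented by l (n - 1).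
  ... | Bézout.+- k l 1+lR≡kn = l *ℕ ℕ.pred n , (begin
    (R *ℕ (l *ℕ ℕ.pred n)) % n  ≡⟨ sym ([m+kn]%n≡m%n _ k n) ⟩
    (R *ℕ (l *ℕ ℕ.pred n) +ℕ k *ℕ n) % n  ≡⟨ cong (_% n) sums ⟩
    (1 +ℕ (R *ℕ l) *ℕ n) % n  ≡⟨ [m+kn]%n≡m%n 1 (R *ℕ l) n ⟩
    1 % n  ∎)
    where
    open ≡-Reasoning
    sums : R *ℕ (l *ℕ ℕ.pred n) +ℕ k *ℕ n ≡ 1 +ℕ (R *ℕ l) *ℕ n
    sums = begin
      R *ℕ (l *ℕ ℕ.pred n) +ℕ k *ℕ n  ≡⟨ cong₂ _+ℕ_ (sym (ℕₚ.*-assoc R l _)) (sym 1+lR≡kn) ⟩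
      (R *ℕ l) *ℕ ℕ.pred n +ℕ suc (l *ℕ R)  ≡⟨ ℕₚ.+-suc _ _ ⟩
      suc ((R *ℕ l) *ℕ ℕ.pred n +ℕ l *ℕ R)  ≡⟨ cong (λ z → suc ((R *ℕ l) *ℕ ℕ.pred n +ℕ z)) (ℕₚ.*-comm l R) ⟩
      suc ((R *ℕ l) *ℕ ℕ.pred n +ℕ R *ℕ l)  ≡⟨ cong suc (trans (ℕₚ.+-comm _ (R *ℕ l)) (sym (ℕₚ.*-suc (R *ℕ l) (ℕ.pred n)))) ⟩
      suc ((R *ℕ l) *ℕ suc (ℕ.pred n))  ≡⟨ cong (λ z → suc ((R *ℕ l) *ℕ z)) (ℕₚ.suc-pred n) ⟩
      suc ((R *ℕ l) *ℕ n)  ∎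

  *-inverse-mod : ∀ {R R*} → (R *ℕ R*) % n ≡ 1 % n → ∀ {j} → j < n → ((j *ℕ R) % n *ℕ R*) % n ≡ j
  *-inverse-mod {R} {R*} inverse {j} j<n = begin
    ((j *ℕ R) % n *ℕ R*) % n  ≡⟨ %-*ˡ (j *ℕ R) R* ⟩
    (j *ℕ R *ℕ R*) % n  ≡⟨ cong (_% n) (trans (ℕₚ.*-assoc j R R*) (ℕₚ.*-comm j _)) ⟩
    (R *ℕ R* *ℕ j) % n  ≡⟨ sym (%-*ˡ (R *ℕ R*) j) ⟩
    ((R *ℕ R*) % n *ℕ j) % n  ≡⟨ cong (λ z → (z *ℕ j) % n) inverse ⟩
    (1 % n *ℕ j) % n  ≡⟨ %-*ˡ 1 j ⟩
    (1 *ℕ j) % n  ≡⟨ cong (_% n) (ℕₚ.*-identityˡ j) ⟩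
    j % n  ≡⟨ m<n⇒m%n≡m j<n ⟩
    j  ∎
    where open ≡-Reasoning

module Reordering {q n : ℕ} (F : FieldOfOrder q n) (S : Setting F) where
  open Setting S
  open FiniteField F
  open Galois F {k = k} prime q≡p^ 0<n

  private instance
    n-nonZero : NonZero n
    n-nonZero = >-nonZero 0<n

  -- Multiplication by R modulo n: the j-th power of s is the `π j`-th power of Frobenius. Transfer
  -- matrices come in the order of powers of s, whereas degrees in μ are controlled in the order of
  -- powers of Frobenius.
  π π⁻¹ : ℕ → ℕ
  π j = (j *ℕ R) % n
  π⁻¹ i = (i *ℕ proj₁ (inverse-mod coprime)) % n

  π<n : ∀ j → π j < n
  π<n j = m%n<n (j *ℕ R) n

  π⁻¹<n : ∀ i → π⁻¹ i < n
  π⁻¹<n i = m%n<n _ n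

  π⁻¹∘π : ∀ {j} → j < n → π⁻¹ (π j) ≡ j
  π⁻¹∘π = *-inverse-mod {R = R} {R* = proj₁ (inverse-mod coprime)} (proj₂ (inverse-mod coprime))

  π∘π⁻¹ : ∀ {i} → i < n → π (π⁻¹ i) ≡ i
  π∘π⁻¹ = *-inverse-mod {R = proj₁ (inverse-mod coprime)} {R* = R} (trans (cong (_% n) (ℕₚ.*-comm _ R)) (proj₂ (inverse-mod coprime)))

  π-permutes : map π (downFrom n) ↭ downFrom n
  π-permutes = unique-↭ unique-map (Uniqueₚ.downFrom⁺ n)
    (λ v∈ → let (j , _ , e) = ∈-map⁻ π v∈ in subst (_∈ downFrom n) (sym e) (∈-downFrom⁺ (π<n j)))
    (λ {v} v∈ → subst (_∈ map π (downFrom n)) (π∘π⁻¹ (∈-downFrom⁻ v∈)) (∈-map⁺ π (∈-downFrom⁺ (π⁻¹<n v))))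
    where
    unique-map : Unique (map π (downFrom n))
    -- Repetitions are excluded after applying `π⁻¹`, which restores the original list.
    unique-map = Uniqueₚ.map⁻ {f = π⁻¹} (subst Unique
      (trans (sym (Listₚ.map-id (downFrom n))) (trans (map-cong-∈ (downFrom n) (λ j∈ → sym (π⁻¹∘π (∈-downFrom⁻ j∈)))) (Listₚ.map-∘ (downFrom n))))
      (Uniqueₚ.downFrom⁺ n))
      where
      open import Data.List.Relation.Unary.Any using (here; there)
      map-cong-∈ : ∀ {f g : ℕ → ℕ} xs → (∀ {x} → x ∈ xs → f x ≡ g x) → map f xs ≡ map g xs
      map-cong-∈ []       eq = refl
      map-cong-∈ (x ∷ xs) eq = cong₂ _∷_ (eq (here refl)) (map-cong-∈ xs (λ m → eq (there m)))

  φ-% : ∀ i x → φ (i % n) x ≡ φ i x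
  φ-% i x = begin
    φ (i % n) x  ≡⟨ cong (φ (i % n)) (sym (φ-n* (i / n) x)) ⟩
    φ (i % n) (φ ((i / n) *ℕ n) x)  ≡⟨ φ-∘ (i % n) _ x ⟩
    φ (i % n +ℕ (i / n) *ℕ n) x  ≡⟨ cong (λ j → φ j x) (sym (m≡m%n+[m/n]*n i n)) ⟩
    φ i x  ∎
    where open ≡-Reasoning

  ∏< : ℕ → (ℕ → K) → K
  ∏< zero    f = 1#
  ∏< (suc i) f = f i * ∏< i f

  ∏<-cong : ∀ i {f g} → (∀ j → f j ≡ g j) → ∏< i f ≡ ∏< i g
  ∏<-cong zero    eq = refl
  ∏<-cong (suc i) eq = cong₂ _*_ (eq i) (∏<-cong i eq)

  ∏<-π : ∀ f → ∏< n (λ j → f (π j)) ≡ ∏< n f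
  ∏<-π f = begin
    ∏< n (λ j → f (π j))  ≡⟨ as-fold n (λ j → f (π j)) ⟩
    foldr _*_ 1# (map (λ j → f (π j)) (downFrom n)) ≡⟨ cong (foldr _*_ 1#) (Listₚ.map-∘ (downFrom n)) ⟩
    foldr _*_ 1# (map f (map π (downFrom n)))  ≡⟨ ↭ₛ.foldr-commMonoid (setoid K) *-isCommutativeMonoid (↭⇒↭ₛ (↭ₚ.map⁺ f π-permutes)) ⟩
    foldr _*_ 1# (map f (downFrom n))  ≡⟨ sym (as-fold n f) ⟩
    ∏< n f  ∎
    where
    open ≡-Reasoning
    as-fold : ∀ i f → ∏< i f ≡ foldr _*_ 1# (map f (downFrom i))
    as-fold zero    f = refl
    as-fold (suc i) f = cong (f i *_) (as-fold i f)

  N≡∏ : ∀ x → N x ≡ ∏< n (λ i → φ i x)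
  N≡∏ x = go n
    where
    go : ∀ i → pow x (geom i) ≡ ∏< i (λ i → φ i x)
    go zero    = refl
    go (suc i) = trans (pow-+ x (geom i) (q ^ i)) (trans (*-comm _ _) (cong (φ i x *_) (go i)))

  -- R is prime to n, so the powers of s run through the same conjugates as the powers of Frobenius.
  N≡∏-φR : ∀ x → N x ≡ ∏< n (λ j → φ (j *ℕ R) x)
  N≡∏-φR x = trans (N≡∏ x) (trans (sym (∏<-π (λ i → φ i x))) (∏<-cong n (λ j → φ-% (j *ℕ R) x)))

-- The case n = 3

lookup-injective : {X : Set} {xs : List X} → Unique xs → ∀ i j → lookup xs i ≡ lookup xs j → i ≡ j
lookup-injective (ne ∷ u) fzero    fzero    e = refl
lookup-injective (ne ∷ u) fzero    (fsuc j) e = ⊥-elim (All.lookup ne (∈-lookup j) e)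
lookup-injective (ne ∷ u) (fsuc i) fzero    e = ⊥-elim (All.lookup ne (∈-lookup i) (sym e))
lookup-injective (ne ∷ u) (fsuc i) (fsuc j) e = cong fsuc (lookup-injective u i j e)

-- Lines as spans of two vectors

module LineGeometry {q n : ℕ} (F : FieldOfOrder q n) where
  open FiniteField F
  open Vectors F

  onLine-combination : ∀ {v w u₁ u₂} → T (inSpan2 v w u₁) → T (inSpan2 v w u₂) → ∀ c d → T (inSpan2 v w (c ∙ u₁ ⊕ d ∙ u₂))
  onLine-combination {v} {w} h₁ h₂ c d with c₁ , d₁ , refl ← inSpan2-elim {v} {w} h₁ | c₂ , d₂ , refl ← inSpan2-elim {v} {w} h₂ =
    inSpan2-intro (c * c₁ + d * c₂) (c * d₁ + d * d₂) (v4-cong (coord _ _) (coord _ _) (coord _ _) (coord _ _))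
    where
    coord : ∀ x y → (c * c₁ + d * c₂) * x + (c * d₁ + d * d₂) * y ≡ c * (c₁ * x + d₁ * y) + d * (c₂ * x + d₂ * y)
    coord = solve 8 (λ c d c₁ c₂ d₁ d₂ x y → (c :* c₁ :+ d :* c₂) :* x :+ (c :* d₁ :+ d :* d₂) :* y
                    := c :* (c₁ :* x :+ d₁ :* y) :+ d :* (c₂ :* x :+ d₂ :* y)) refl c d c₁ c₂ d₁ d₂

  -- Cramer's rule: two independent vectors of a line span it.
  spans-line : ∀ {v w u₁ u₂} → Indep v w → T (inSpan2 v w u₁) → T (inSpan2 v w u₂) → Indep u₁ u₂ →
               ∀ {u} → T (inSpan2 v w u) → T (inSpan2 u₁ u₂ u)
  spans-line {v} {w} indep h₁ h₂ indep′ {u} h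
    with α , β , refl ← inSpan2-elim {v} {w} h₁ | γ , δ , refl ← inSpan2-elim {v} {w} h₂ | c , d , refl ← inSpan2-elim {v} {w} h =
    inSpan2-intro ((c * δ + - (d * γ)) * inv D) ((d * α + - (c * β)) * inv D) (v4-cong (coord _ _) (coord _ _) (coord _ _) (coord _ _))
    where
    D = α * δ + - (β * γ)
    D≢0 : D ≢ 0#
    -- If D vanished, the combinations of u₁ and u₂ with coefficients (-γ, α) and (δ, -β) would be
    -- zero, so α = β = 0 and u₁ itself would be zero.
    D≢0 D≡0 = 1≢0 (proj₁ (indep′ 1# 0# (v4-cong (zero-coord _ _) (zero-coord _ _) (zero-coord _ _) (zero-coord _ _))))
      where
      vanish₁ : ∀ x y → δ * (α * x + β * y) + - β * (γ * x + δ * y) ≡ 0#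
      vanish₁ x y = trans (solve 6 (λ α β γ δ x y → δ :* (α :* x :+ β :* y) :+ :- β :* (γ :* x :+ δ :* y) := (α :* δ :+ :- (β :* γ)) :* x) refl α β γ δ x y)
                      (trans (cong (_* x) D≡0) (zeroˡ x))
      vanish₂ : ∀ x y → - γ * (α * x + β * y) + α * (γ * x + δ * y) ≡ 0#
      vanish₂ x y = trans (solve 6 (λ α β γ δ x y → :- γ :* (α :* x :+ β :* y) :+ α :* (γ :* x :+ δ :* y) := (α :* δ :+ :- (β :* γ)) :* y) refl α β γ δ x y)
                      (trans (cong (_* y) D≡0) (zeroˡ y))
      α≡0 : α ≡ 0#
      α≡0 = proj₂ (indep′ (- γ) α (v4-cong (vanish₂ _ _) (vanish₂ _ _) (vanish₂ _ _) (vanish₂ _ _)))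
      β≡0 : β ≡ 0#
      β≡0 = trans (sym (-‿involutive β)) (trans (cong -_ (proj₂ (indep′ δ (- β) (v4-cong (vanish₁ _ _) (vanish₁ _ _) (vanish₁ _ _) (vanish₁ _ _))))) -0#≈0#)
      zero-coord : ∀ x y → 1# * (α * x + β * y) + 0# * (γ * x + δ * y) ≡ 0#
      zero-coord x y = trans (cong₂ (λ a b → 1# * (a * x + b * y) + 0# * (γ * x + δ * y)) α≡0 β≡0)
        (solve 4 (λ γ δ x y → :1 :* (:0 :* x :+ :0 :* y) :+ :0 :* (γ :* x :+ δ :* y) := :0) refl γ δ x y)
    coord : ∀ x y → ((c * δ + - (d * γ)) * inv D) * (α * x + β * y) + ((d * α + - (c * β)) * inv D) * (γ * x + δ * y) ≡ c * x + d * y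
    coord x y = trans (solve 9 (λ c d α β γ δ i x y →
          ((c :* δ :+ :- (d :* γ)) :* i) :* (α :* x :+ β :* y) :+ ((d :* α :+ :- (c :* β)) :* i) :* (γ :* x :+ δ :* y)
            := ((α :* δ :+ :- (β :* γ)) :* i) :* (c :* x :+ d :* y)) refl c d α β γ δ (inv D) x y)
      (trans (cong (_* (c * x + d * y)) (inv-inverseʳ D≢0)) (*-identityˡ _))

  sameLine : ∀ {v w u₁ u₂} → Indep v w → T (inSpan2 v w u₁) → T (inSpan2 v w u₂) → Indep u₁ u₂ → SameLine (v , w) (u₁ , u₂)
  sameLine {v} {w} {u₁} {u₂} indep h₁ h₂ indep′ u = T-≡ (spans-line indep h₁ h₂ indep′ {u})
    λ t → let (c , d , e) = inSpan2-elim {u₁} {u₂} {u} t in subst (T ∘ inSpan2 v w) e (onLine-combination {v} {w} h₁ h₂ c d)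

-- The pseudoregulus and its two transversals

module Pseudoregulus {q n : ℕ} (F : FieldOfOrder q n) (S : Setting F) (ξ : FieldOfOrder.K F) (ξ≢0 : ξ ≢ FieldOfOrder.0# F)
  (Na≢-1 : Setup.N F (Setting.a S) ≢ FieldOfOrder.-_ F (FieldOfOrder.1# F)) (n≡3 : n ≡ 3) where
  open Setting S
  open FiniteField F
  open Vectors F
  open Galois F {k = k} prime q≡p^ 0<n
  open Operator F S
  open Reordering F S
  open LineGeometry F
  open Weights F S ξ ξ≢0
  open LinearSet f

  s∘s : ∀ x → s (s x) ≡ t x
  s∘s x = s-injective (begin
    s (s (s x))  ≡⟨ cong s (φ-∘ R R x) ⟩
    φ R (φ (R +ℕ R) x)  ≡⟨ φ-∘ R _ x ⟩
    φ (R +ℕ (R +ℕ R)) x  ≡⟨ cong (λ i → φ (R +ℕ (R +ℕ i)) x) (sym (ℕₚ.+-identityʳ R)) ⟩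
    φ (3 *ℕ R) x  ≡⟨ cong (λ i → φ i x) (trans (ℕₚ.*-comm 3 R) (cong (R *ℕ_) (sym n≡3))) ⟩
    φ (R *ℕ n) x  ≡⟨ φ-n* R x ⟩
    x  ≡⟨ sym (s∘t x) ⟩
    s (t x)  ∎)
    where open ≡-Reasoning

  t∘t : ∀ x → t (t x) ≡ s x
  t∘t x = trans (cong t (sym (s∘s x))) (t∘s (s x))

  -- Coefficients of the change of variables (x, A x) ↦ (x - b A x, c x + A x), with determinant
  -- `δ₀` and its inverse `g`. They are chosen so that the second component is the image of the
  -- first under s.
  b c δ₀ g : K
  b  = t a
  c  = a * s a
  δ₀ = 1# + c * b
  g  = inv δ₀

  δ₀≡1+Na : δ₀ ≡ 1# + N a
  δ₀≡1+Na = cong (1# +_) (begin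
    a * s a * t a  ≡⟨ cong (a * s a *_) (trans (sym (s∘s a)) (trans (φ-∘ R R a) (cong (λ i → φ (R +ℕ i) a) (sym (ℕₚ.+-identityʳ R))))) ⟩
    a * s a * φ (2 *ℕ R) a  ≡⟨ solve 3 (λ a u v → a :* u :* v := v :* (u :* (a :* :1))) refl a (s a) _ ⟩
    φ (2 *ℕ R) a * (s a * (a * 1#))  ≡⟨ cong₂ (λ u v → φ (2 *ℕ R) a * (u * (v * 1#))) (cong (λ i → φ i a) (sym (ℕₚ.+-identityʳ R))) (sym (φ-zero a)) ⟩
    ∏< 3 (λ j → φ (j *ℕ R) a)  ≡⟨ cong (λ i → ∏< i (λ j → φ (j *ℕ R) a)) (sym n≡3) ⟩
    ∏< n (λ j → φ (j *ℕ R) a)  ≡⟨ sym (N≡∏-φR a) ⟩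
    N a  ∎)
    where open ≡-Reasoning

  δ₀≢0 : δ₀ ≢ 0#
  δ₀≢0 e = Na≢-1 (begin
    N a  ≡⟨ solve 1 (λ x → x := :1 :+ x :+ :- :1) refl (N a) ⟩
    1# + N a + - 1#  ≡⟨ cong (_+ - 1#) (trans (sym δ₀≡1+Na) e) ⟩
    0# + - 1#  ≡⟨ +-identityˡ _ ⟩
    - 1#  ∎)
    where open ≡-Reasoning

  g∈Fq : InFq g
  g∈Fq = Fq-inv δ₀≢0 (subst InFq (sym δ₀≡1+Na) (Fq-+ Fq-1 (N∈Fq a)))

  g-cancel : ∀ x → g * (δ₀ * x) ≡ x
  g-cancel x = inv-*-cancel x δ₀≢0

  -- In the coordinates (P, Q, P′, Q′) the subspace U becomes {(z, w, z^s, w^s)}.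
  Ψ : V4 → V4
  Ψ (v4 P Q P′ Q′) = v4 (g * (P + b * P′)) (g * (Q + b * Q′)) (g * (Q′ + - (c * Q))) (ξ * (g * (P′ + - (c * P))))

  Ψ-linear : ∀ c d u w → Ψ (c ∙ u ⊕ d ∙ w) ≡ c ∙ Ψ u ⊕ d ∙ Ψ w
  Ψ-linear c′ d (v4 P Q P′ Q′) (v4 X Y X′ Y′) = v4-cong (lin₁ P P′ X X′) (lin₁ Q Q′ Y Y′) (lin₂ Q Q′ Y Y′)
      (trans (cong (ξ *_) (lin₂ P P′ X X′)) (solve 5 (λ ξ c d x y → ξ :* (c :* x :+ d :* y) := c :* (ξ :* x) :+ d :* (ξ :* y)) refl ξ c′ d _ _))
    where
    lin₁ : ∀ P P′ X X′ → g * ((c′ * P + d * X) + b * (c′ * P′ + d * X′)) ≡ c′ * (g * (P + b * P′)) + d * (g * (X + b * X′))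
    lin₁ = solve 8 (λ g b c d P P′ X X′ → g :* ((c :* P :+ d :* X) :+ b :* (c :* P′ :+ d :* X′))
                      := c :* (g :* (P :+ b :* P′)) :+ d :* (g :* (X :+ b :* X′))) refl g b c′ d
    lin₂ : ∀ P P′ X X′ → g * ((c′ * P′ + d * X′) + - (c * (c′ * P + d * X))) ≡ c′ * (g * (P′ + - (c * P))) + d * (g * (X′ + - (c * X)))
    lin₂ = solve 8 (λ g k c d P P′ X X′ → g :* ((c :* P′ :+ d :* X′) :+ :- (k :* (c :* P :+ d :* X)))
                      := c :* (g :* (P′ :+ :- (k :* P))) :+ d :* (g :* (X′ :+ :- (k :* X)))) refl g c c′ d

  Ψ-zeroV : Ψ zeroV ≡ zeroV
  Ψ-zeroV = v4-cong (lin₁ b) (lin₁ b) (lin₂ c) (trans (cong (ξ *_) (lin₂ c)) (zeroʳ ξ))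
    where
    lin₁ : ∀ b → g * (0# + b * 0#) ≡ 0#
    lin₁ b = solve 2 (λ g b → g :* (:0 :+ b :* :0) := :0) refl g b
    lin₂ : ∀ c → g * (0# + - (c * 0#)) ≡ 0#
    lin₂ c = solve 2 (λ g b → g :* (:0 :+ :- (b :* :0)) := :0) refl g c

  Ψ-injective : ∀ {u w} → Ψ u ≡ Ψ w → u ≡ w
  Ψ-injective {v4 P Q P′ Q′} {v4 X Y X′ Y′} e = v4-cong (first e0′ e3′) (first e1′ e2′) (second e0′ e3′) (second e1′ e2′)
    where
    e0′ = cong V4.c0 e
    e1′ = cong V4.c1 e
    e2′ = cong V4.c2 e
    e3′ = *-cancelˡ ξ≢0 (cong V4.c3 e)
    -- P = u − b v and P′ = v + c u for u = g (P + b P′), v = g (P′ − c P).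
    first : ∀ {P P′ X X′} → g * (P + b * P′) ≡ g * (X + b * X′) → g * (P′ + - (c * P)) ≡ g * (X′ + - (c * X)) → P ≡ X
    first {P} {P′} {X} {X′} u v = trans (recover P P′) (trans (cong₂ (λ u v → u + - (b * v)) u v) (sym (recover X X′)))
      where
      recover : ∀ P P′ → P ≡ g * (P + b * P′) + - (b * (g * (P′ + - (c * P))))
      recover P P′ = trans (sym (g-cancel P)) (solve 5 (λ g b c P P′ → g :* ((:1 :+ c :* b) :* P) := g :* (P :+ b :* P′) :+ :- (b :* (g :* (P′ :+ :- (c :* P))))) refl g b c P P′)
    second : ∀ {P P′ X X′} → g * (P + b * P′) ≡ g * (X + b * X′) → g * (P′ + - (c * P)) ≡ g * (X′ + - (c * X)) → P′ ≡ X′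
    second {P} {P′} {X} {X′} u v = trans (recover P P′) (trans (cong₂ (λ u v → v + c * u) u v) (sym (recover X X′)))
      where
      recover : ∀ P P′ → P′ ≡ g * (P′ + - (c * P)) + c * (g * (P + b * P′))
      recover P P′ = trans (sym (g-cancel P′)) (solve 5 (λ g b c P P′ → g :* ((:1 :+ c :* b) :* P′) := g :* (P′ :+ :- (c :* P)) :+ c :* (g :* (P :+ b :* P′))) refl g b c P P′)

  L : K → K
  L x = x + - (b * A x)

  -- For n = 3, s² = t gives s (A x) = t x - s(a) x. The choice b = t a multiplies this by a, and
  -- the t x produced is precisely the one in A x.
  s-L : ∀ x → s (L x) ≡ A x + c * x
  s-L x = begin
    s (x + - (b * A x))  ≡⟨ trans (φ-+ R x _) (cong (s x +_) (trans (φ-neg R _) (cong -_ (φ-* R b (A x))))) ⟩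
    s x + - (s (t a) * s (A x))  ≡⟨ cong₂ (λ u v → s x + - (u * v)) (s∘t a) sA ⟩
    s x + - (a * (t x + - (s a * x)))  ≡⟨ solve 5 (λ y a z u x → y :+ :- (a :* (z :+ :- (u :* x))) := y :+ :- (a :* z) :+ a :* u :* x) refl (s x) a (t x) (s a) x ⟩
    s x + - (a * t x) + c * x  ≡⟨ cong (_+ c * x) (sym (A-def x)) ⟩
    A x + c * x  ∎
    where
    open ≡-Reasoning
    sA : s (A x) ≡ t x + - (s a * x)
    sA = begin
      s (A x)  ≡⟨ cong s (A-def x) ⟩
      s (s x + - (a * t x))  ≡⟨ trans (φ-+ R _ _) (cong₂ _+_ (s∘s x) (trans (φ-neg R _) (cong -_ (trans (φ-* R a _) (cong (s a *_) (s∘t x)))))) ⟩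
      t x + - (s a * x)  ∎

  f≡Ψ : ∀ x y → f x y ≡ Ψ (v4 (L x) (L y) (s (L x)) (s (L y)))
  f≡Ψ x y = v4-cong (part₁ x) (part₁ y) (part₂ y) (cong (ξ *_) (part₂ x))
    where
    part₁ : ∀ x → x ≡ g * (L x + b * s (L x))
    part₁ x = trans (sym (g-cancel x)) (trans (solve 5 (λ g b c x A → g :* ((:1 :+ c :* b) :* x) := g :* (x :+ :- (b :* A) :+ b :* (A :+ c :* x))) refl g b c x (A x))
                (cong (λ z → g * (L x + b * z)) (sym (s-L x))))
    part₂ : ∀ x → A x ≡ g * (s (L x) + - (c * L x))
    part₂ x = trans (sym (g-cancel (A x))) (trans (solve 5 (λ g b c x A → g :* ((:1 :+ c :* b) :* A) := g :* (A :+ c :* x :+ :- (c :* (x :+ :- (b :* A))))) refl g b c x (A x))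
                (cong (λ z → g * (z + - (c * L x))) (sym (s-L x))))

  -- First row of the inverse of the matrix that takes (x, A x) to (L x, s (L x)).
  L⁻¹ : K → K
  L⁻¹ z = g * (z + b * s z)

  L∘L⁻¹ : ∀ z → L (L⁻¹ z) ≡ z
  L∘L⁻¹ z = begin
    x + - (b * A x)  ≡⟨ cong (λ y → x + - (b * y)) Ax ⟩
    x + - (b * (g * (s z + - (c * z))))  ≡⟨ solve 5 (λ g b c z y → g :* (z :+ b :* y) :+ :- (b :* (g :* (y :+ :- (c :* z)))) := g :* ((:1 :+ c :* b) :* z)) refl g b c z (s z) ⟩
    g * (δ₀ * z)  ≡⟨ g-cancel z ⟩
    z  ∎
    where
    open ≡-Reasoning
    x = L⁻¹ z
    sx : s x ≡ g * (s z + a * t z)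
    sx = trans (φ-* R g _) (cong₂ _*_ (φ-fixes-Fq R g∈Fq) (trans (φ-+ R z _) (cong (s z +_) (trans (φ-* R b (s z)) (cong₂ _*_ (s∘t a) (s∘s z))))))
    tx : t x ≡ g * (t z + s a * z)
    tx = trans (φ-* R′ g _) (cong₂ _*_ (φ-fixes-Fq R′ g∈Fq) (trans (φ-+ R′ z _) (cong (t z +_) (trans (φ-* R′ b (s z)) (cong₂ _*_ (t∘t a) (t∘s z))))))
    Ax : A x ≡ g * (s z + - (c * z))
    Ax = trans (A-def x) (trans (cong₂ (λ u v → u + - (a * v)) sx tx)
      (solve 6 (λ g a y u v z → g :* (y :+ a :* u) :+ :- (a :* (g :* (u :+ v :* z))) := g :* (y :+ :- (a :* v :* z))) refl g a (s z) (t z) (s a) z))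

  graph∈U : ∀ z w → f (L⁻¹ z) (L⁻¹ w) ≡ Ψ (v4 z w (s z) (s w))
  graph∈U z w = trans (f≡Ψ _ _) (cong Ψ (v4-cong (L∘L⁻¹ z) (L∘L⁻¹ w) (cong s (L∘L⁻¹ z)) (cong s (L∘L⁻¹ w))))

  point : K → K → K → K → V4
  point α β c d = Ψ (v4 (c * α) (c * β) (d * s α) (d * s β))

  -- Joins the point (α, β) of one transversal to its image under s on the other. The vectors c(α,
  -- β), d(s α, s β) on it belong to U when d = s c.
  longLine : K → K → Line
  longLine α β = Ψ (v4 α β 0# 0#) , Ψ (v4 0# 0# (s α) (s β))

  point-combination : ∀ α β c d → c ∙ Ψ (v4 α β 0# 0#) ⊕ d ∙ Ψ (v4 0# 0# (s α) (s β)) ≡ point α β c d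
  point-combination α β c d = trans (sym (Ψ-linear c d _ _)) (cong Ψ (v4-cong (left α) (left β) (right (s α)) (right (s β))))
    where
    left : ∀ x → c * x + d * 0# ≡ c * x
    left x = solve 3 (λ c d x → c :* x :+ d :* :0 := c :* x) refl c d x
    right : ∀ x → c * 0# + d * x ≡ d * x
    right x = solve 3 (λ c d x → c :* :0 :+ d :* x := d :* x) refl c d x

  on-longLine : ∀ {α β u} → T (onLine (longLine α β) u) → ∃ λ c → ∃ λ d → u ≡ point α β c d
  on-longLine {α} {β} {u} h = let (c , d , e) = inSpan2-elim {Ψ (v4 α β 0# 0#)} {Ψ (v4 0# 0# (s α) (s β))} {u} h
                    in c , d , trans (sym e) (point-combination α β c d)

  point-on : ∀ α β c d → T (onLine (longLine α β) (point α β c d))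
  point-on α β c d = inSpan2-intro c d (point-combination α β c d)

  module _ {α β : K} (αβ≢0 : α ≢ 0# ⊎ β ≢ 0#) where

    factor-zero : ∀ {c} → c * α ≡ 0# → c * β ≡ 0# → c ≡ 0#
    factor-zero cα cβ = [ (λ α≢0 → *≡0 α≢0 (trans (*-comm _ _) cα)) , (λ β≢0 → *≡0 β≢0 (trans (*-comm _ _) cβ)) ]′ αβ≢0

    factor-zero-s : ∀ {c} → c * s α ≡ 0# → c * s β ≡ 0# → c ≡ 0#
    factor-zero-s cα cβ = [ (λ α≢0 → *≡0 (φ-≢0 R α≢0) (trans (*-comm _ _) cα)) , (λ β≢0 → *≡0 (φ-≢0 R β≢0) (trans (*-comm _ _) cβ)) ]′ αβ≢0

    factor-unique : ∀ {c d} → c * α ≡ d * α → c * β ≡ d * β → c ≡ d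
    factor-unique cα cβ = [ (λ α≢0 → *-cancelˡ α≢0 (trans (*-comm _ _) (trans cα (*-comm _ _)))) , (λ β≢0 → *-cancelˡ β≢0 (trans (*-comm _ _) (trans cβ (*-comm _ _)))) ]′ αβ≢0

    point-zero : ∀ {c d} → point α β c d ≡ zeroV → c ≡ 0# × d ≡ 0#
    point-zero {c} {d} e = factor-zero (cong V4.c0 e′) (cong V4.c1 e′) , factor-zero-s (cong V4.c2 e′) (cong V4.c3 e′)
      where
      e′ : v4 (c * α) (c * β) (d * s α) (d * s β) ≡ zeroV
      e′ = Ψ-injective (trans e (sym Ψ-zeroV))

    longLine-isLong : LongLine (longLine α β)
    longLine-isLong = (λ c d e → point-zero {c} {d} (trans (sym (point-combination α β c d)) e)) ,
      lineWeight-n (longLine α β) (λ c → point α β c (s c)) ∈U (λ c → point-on α β c (s c)) injective onto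
      where
      ∈U : ∀ c → T (inU (point α β c (s c)))
      ∈U c = inU-intro (L⁻¹ (c * α)) (L⁻¹ (c * β)) (trans (graph∈U (c * α) (c * β)) (cong Ψ (v4-cong refl refl (φ-* R c α) (φ-* R c β))))
      injective : ∀ c d → point α β c (s c) ≡ point α β d (s d) → c ≡ d
      injective c d e = factor-unique (cong V4.c0 e′) (cong V4.c1 e′)
        where
        e′ : v4 (c * α) (c * β) (s c * s α) (s c * s β) ≡ v4 (d * α) (d * β) (s d * s α) (s d * s β)
        e′ = Ψ-injective e
      graph : ∀ x y c d → v4 (L x) (L y) (s (L x)) (s (L y)) ≡ v4 (c * α) (c * β) (d * s α) (d * s β) → point α β c (s c) ≡ f x y
      graph x y c d e = trans (cong Ψ (v4-cong (sym Lx) (sym Ly) (trans (sym (φ-* R c α)) (cong s (sym Lx))) (trans (sym (φ-* R c β)) (cong s (sym Ly)))))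
                        (sym (f≡Ψ x y))
        where
        Lx = cong V4.c0 e
        Ly = cong V4.c1 e
      on-graph : ∀ x y → (∃ λ c → ∃ λ d → f x y ≡ point α β c d) → ∃ λ c → point α β c (s c) ≡ f x y
      on-graph x y (c , d , e) = c , graph x y c d (Ψ-injective (trans (sym (f≡Ψ x y)) e))
      onto : ∀ x y → T (onLine (longLine α β) (f x y)) → ∃ λ c → point α β c (s c) ≡ f x y
      onto x y h = on-graph x y (on-longLine {α} {β} {f x y} h)

  -- A common vector has both its first two and its last two coordinates proportional to two
  -- independent directions; the second determinant is the image of the first under s.
  longLines-disjoint : ∀ {α β α′ β′} → α * β′ + - (β * α′) ≢ 0# → DisjointLines (longLine α β) (longLine α′ β′)
  longLines-disjoint {α} {β} {α′} {β′} det≢0 u h h′ = points-zero (on-longLine {α} {β} {u} h) (on-longLine {α′} {β′} {u} h′)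
    where
    zero-l : ∀ {c x} → c ≡ 0# → c * x ≡ 0#
    zero-l refl = zeroˡ _
    eliminate : ∀ {α β α′ β′ c c′} → c * α ≡ c′ * α′ → c * β ≡ c′ * β′ → (α * β′ + - (β * α′)) * c ≡ 0#
    eliminate {α} {β} {α′} {β′} {c} {c′} p q = begin
      (α * β′ + - (β * α′)) * c  ≡⟨ solve 5 (λ α β α′ β′ c → (α :* β′ :+ :- (β :* α′)) :* c := c :* α :* β′ :+ :- (c :* β :* α′)) refl α β α′ β′ c ⟩
      c * α * β′ + - (c * β * α′)  ≡⟨ cong₂ (λ u v → u * β′ + - (v * α′)) p q ⟩
      c′ * α′ * β′ + - (c′ * β′ * α′)  ≡⟨ solve 3 (λ c x y → c :* x :* y :+ :- (c :* y :* x) := :0) refl c′ α′ β′ ⟩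
      0#  ∎
      where open ≡-Reasoning
    s-det : s (α * β′ + - (β * α′)) ≡ s α * s β′ + - (s β * s α′)
    s-det = trans (φ-+ R _ _) (cong₂ _+_ (φ-* R α β′) (trans (φ-neg R _) (cong -_ (φ-* R β α′))))
    same-point : ∀ {c d c′ d′} → v4 (c * α) (c * β) (d * s α) (d * s β) ≡ v4 (c′ * α′) (c′ * β′) (d′ * s α′) (d′ * s β′) → point α β c d ≡ zeroV
    same-point {c} {d} e = trans (cong Ψ (v4-cong (zero-l c≡0) (zero-l c≡0) (zero-l d≡0) (zero-l d≡0))) Ψ-zeroV
      where
      c≡0 : c ≡ 0#
      c≡0 = *≡0 det≢0 (eliminate (cong V4.c0 e) (cong V4.c1 e))
      d≡0 : d ≡ 0#
      d≡0 = *≡0 (λ z → φ-≢0 R det≢0 (trans s-det z)) (eliminate (cong V4.c2 e) (cong V4.c3 e))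
    points-zero : (∃ λ c → ∃ λ d → u ≡ point α β c d) → (∃ λ c → ∃ λ d → u ≡ point α′ β′ c d) → u ≡ zeroV
    points-zero (c , d , e) (c′ , d′ , e′) = trans e (same-point (Ψ-injective (trans (sym e) e′)))

  transversal₁ transversal₂ : Line
  transversal₁ = Ψ e0 , Ψ e1
  transversal₂ = Ψ e2 , Ψ e3

  private
    combination₁ : ∀ c d → c ∙ Ψ e0 ⊕ d ∙ Ψ e1 ≡ Ψ (v4 c d 0# 0#)
    combination₁ c d = trans (sym (Ψ-linear c d e0 e1)) (cong Ψ (v4-cong
      (solve 2 (λ c d → c :* :1 :+ d :* :0 := c) refl c d) (solve 2 (λ c d → c :* :0 :+ d :* :1 := d) refl c d)
      (solve 2 (λ c d → c :* :0 :+ d :* :0 := :0) refl c d) (solve 2 (λ c d → c :* :0 :+ d :* :0 := :0) refl c d)))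

    combination₂ : ∀ c d → c ∙ Ψ e2 ⊕ d ∙ Ψ e3 ≡ Ψ (v4 0# 0# c d)
    combination₂ c d = trans (sym (Ψ-linear c d e2 e3)) (cong Ψ (v4-cong
      (solve 2 (λ c d → c :* :0 :+ d :* :0 := :0) refl c d) (solve 2 (λ c d → c :* :0 :+ d :* :0 := :0) refl c d)
      (solve 2 (λ c d → c :* :1 :+ d :* :0 := c) refl c d) (solve 2 (λ c d → c :* :0 :+ d :* :1 := d) refl c d)))

    Ψ-zero : ∀ {u} → Ψ u ≡ zeroV → u ≡ zeroV
    Ψ-zero e = Ψ-injective (trans e (sym Ψ-zeroV))

    scaled-graph : ∀ {u} → InL u → ∃ λ z → ∃ λ w → ∃ λ c → c ≢ 0# × (z ≢ 0# ⊎ w ≢ 0#) × u ≡ Ψ (v4 (c * z) (c * w) (c * s z) (c * s w))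
    scaled-graph record { x = x ; y = y ; c = c ; f≢0 = f≢0 ; c≢0 = c≢0 ; v≡cf = refl } =
      L x , L y , c , c≢0 , nonzero , (begin
        scale c (f x y)  ≡⟨ cong (scale c) (f≡Ψ x y) ⟩
        scale c (Ψ w)  ≡⟨ v4-cong (drop c) (drop c) (drop c) (drop c) ⟩
        c ∙ Ψ w ⊕ 0# ∙ Ψ w  ≡⟨ sym (Ψ-linear c 0# w w) ⟩
        Ψ (c ∙ w ⊕ 0# ∙ w)  ≡⟨ cong Ψ (v4-cong (sym (drop c)) (sym (drop c)) (sym (drop c)) (sym (drop c))) ⟩
        Ψ (scale c w)  ∎)
      where
      open ≡-Reasoning
      w = v4 (L x) (L y) (s (L x)) (s (L y))
      drop : ∀ c {x} → c * x ≡ c * x + 0# * x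
      drop c {x} = solve 2 (λ c x → c :* x := c :* x :+ :0 :* x) refl c x
      nonzero : L x ≢ 0# ⊎ L y ≢ 0#
      nonzero with L x ≟ 0# | L y ≟ 0#
      ... | no ne  | _      = inj₁ ne
      ... | yes _  | no ne  = inj₂ ne
      ... | yes e₁ | yes e₂ = ⊥-elim (f≢0 (trans (f≡Ψ x y) (trans (cong Ψ (v4-cong e₁ e₂ (trans (cong s e₁) (φ-0 R)) (trans (cong s e₂) (φ-0 R)))) Ψ-zeroV)))

  Transversal : Line → Set
  Transversal m = IsLine m × LineDisjointFromL m × (∀ α β → α ≢ 0# ⊎ β ≢ 0# → MeetLines m (longLine α β))

  transversal₁-is : Transversal transversal₁
  transversal₁-is = (λ c d e → let e′ = Ψ-zero (trans (sym (combination₁ c d)) e) in cong V4.c0 e′ , cong V4.c1 e′) , disjoint ,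
    λ α β ne → Ψ (v4 α β 0# 0#) ,
      isZeroV-intro (λ e → nonzero ne (Ψ-zero e)) ,
      inSpan2-intro α β (combination₁ α β) ,
      subst (T ∘ onLine (longLine α β)) (cong Ψ (v4-cong (*-identityˡ α) (*-identityˡ β) (zeroˡ _) (zeroˡ _))) (point-on α β 1# 0#)
    where
    nonzero : ∀ {α β} → α ≢ 0# ⊎ β ≢ 0# → v4 α β 0# 0# ≢ zeroV
    nonzero (inj₁ ne) e = ne (cong V4.c0 e)
    nonzero (inj₂ ne) e = ne (cong V4.c1 e)
    disjoint : LineDisjointFromL transversal₁
    disjoint u h hL = contradict (inSpan2-elim {Ψ e0} {Ψ e1} {u} h) (scaled-graph (inL-elim hL))
      where
      coordinates : ∀ {z w k c d} → k ≢ 0# → z ≢ 0# ⊎ w ≢ 0# → v4 c d 0# 0# ≡ v4 (k * z) (k * w) (k * s z) (k * s w) → ⊥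
      coordinates k≢0 (inj₁ z≢0) e′ = *-≢0 k≢0 (φ-≢0 R z≢0) (sym (cong V4.c2 e′))
      coordinates k≢0 (inj₂ w≢0) e′ = *-≢0 k≢0 (φ-≢0 R w≢0) (sym (cong V4.c3 e′))
      contradict : (∃ λ c → ∃ λ d → c ∙ Ψ e0 ⊕ d ∙ Ψ e1 ≡ u) →
                   (∃ λ z → ∃ λ w → ∃ λ k → k ≢ 0# × (z ≢ 0# ⊎ w ≢ 0#) × u ≡ Ψ (v4 (k * z) (k * w) (k * s z) (k * s w))) → ⊥
      contradict (c , d , e₁) (z , w , k , k≢0 , ne , e₂) =
        coordinates k≢0 ne (Ψ-injective (trans (sym (combination₁ c d)) (trans e₁ e₂)))

  transversal₂-is : Transversal transversal₂
  transversal₂-is = (λ c d e → let e′ = Ψ-zero (trans (sym (combination₂ c d)) e) in cong V4.c2 e′ , cong V4.c3 e′) , disjoint ,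
    λ α β ne → Ψ (v4 0# 0# (s α) (s β)) ,
      isZeroV-intro (λ e → nonzero ne (Ψ-zero e)) ,
      inSpan2-intro (s α) (s β) (combination₂ (s α) (s β)) ,
      subst (T ∘ onLine (longLine α β)) (cong Ψ (v4-cong (zeroˡ _) (zeroˡ _) (*-identityˡ _) (*-identityˡ _))) (point-on α β 0# 1#)
    where
    nonzero : ∀ {α β} → α ≢ 0# ⊎ β ≢ 0# → v4 0# 0# (s α) (s β) ≢ zeroV
    nonzero (inj₁ ne) e = φ-≢0 R ne (cong V4.c2 e)
    nonzero (inj₂ ne) e = φ-≢0 R ne (cong V4.c3 e)
    disjoint : LineDisjointFromL transversal₂
    disjoint u h hL = contradict (inSpan2-elim {Ψ e2} {Ψ e3} {u} h) (scaled-graph (inL-elim hL))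
      where
      coordinates : ∀ {z w k c d} → k ≢ 0# → z ≢ 0# ⊎ w ≢ 0# → v4 0# 0# c d ≡ v4 (k * z) (k * w) (k * s z) (k * s w) → ⊥
      coordinates k≢0 (inj₁ z≢0) e′ = *-≢0 k≢0 z≢0 (sym (cong V4.c0 e′))
      coordinates k≢0 (inj₂ w≢0) e′ = *-≢0 k≢0 w≢0 (sym (cong V4.c1 e′))
      contradict : (∃ λ c → ∃ λ d → c ∙ Ψ e2 ⊕ d ∙ Ψ e3 ≡ u) →
                   (∃ λ z → ∃ λ w → ∃ λ k → k ≢ 0# × (z ≢ 0# ⊎ w ≢ 0#) × u ≡ Ψ (v4 (k * z) (k * w) (k * s z) (k * s w))) → ⊥
      contradict (c , d , e₁) (z , w , k , k≢0 , ne , e₂) =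
        coordinates k≢0 ne (Ψ-injective (trans (sym (combination₂ c d)) (trans e₁ e₂)))

  transversals-differ : ¬ SameLine transversal₁ transversal₂
  transversals-differ same = contradict (inSpan2-elim {Ψ e2} {Ψ e3} {Ψ e0}
      (subst T (same (Ψ e0)) (inSpan2-intro 1# 0# (combination₁ 1# 0#))))
    where
    contradict : ¬ (∃ λ c → ∃ λ d → c ∙ Ψ e2 ⊕ d ∙ Ψ e3 ≡ Ψ e0)
    contradict (c , d , e) = 1≢0 (sym (cong V4.c0 (Ψ-injective (trans (sym (combination₂ c d)) e))))

  outside-Fq : ∃ λ β → ¬ InFq β
  outside-Fq with EK.exists? (λ β → ¬? (InFq? β))
  ... | yes found = found
  ... | no  none  = ⊥-elim (ℕₚ.<⇒≢ (ℕₚ.^-monoʳ-< q 2≤q {1} {n} (subst (1 <_) (sym n≡3) (s≤s (s≤s z≤n))))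
      (trans (ℕₚ.*-identityʳ q) (trans (sym #Fq) (trans (#-all elems InFq? all) elems-card))))
    where
    all : ∀ x → InFq x
    all x with InFq? x
    ... | yes x∈ = x∈
    ... | no x∉  = ⊥-elim (none (x , x∉))

  MeetingPoint : Line → K → K → Set
  MeetingPoint m α β = ∃ λ c → ∃ λ d → (c ≢ 0# ⊎ d ≢ 0#) × T (onLine m (point α β c d))

  meetingPoint : ∀ {m α β} → MeetLines m (longLine α β) → MeetingPoint m α β
  meetingPoint {m} {α} {β} (u , u≢0 , h₁ , h₂) = from (on-longLine {α} {β} {u} h₂)
    where
    nonzero : ∀ c d → u ≡ point α β c d → c ≢ 0# ⊎ d ≢ 0#
    nonzero c d e with c ≟ 0# | d ≟ 0#
    ... | no c≢0   | _        = inj₁ c≢0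
    ... | yes _    | no d≢0   = inj₂ d≢0
    ... | yes refl | yes refl = ⊥-elim (isZeroV-elim u≢0 (trans e (trans (cong Ψ (v4-cong (zeroˡ _) (zeroˡ _) (zeroˡ _) (zeroˡ _))) Ψ-zeroV)))
    from : (∃ λ c → ∃ λ d → u ≡ point α β c d) → MeetingPoint m α β
    from (c , d , e) = c , d , nonzero c d e , subst (T ∘ onLine m) e h₁

  private
    axis-combination : ∀ κ μ c d e f → κ ∙ Ψ (v4 c 0# d 0#) ⊕ μ ∙ Ψ (v4 0# e 0# f) ≡ Ψ (v4 (κ * c) (μ * e) (κ * d) (μ * f))
    axis-combination κ μ c d e f = trans (sym (Ψ-linear κ μ _ _)) (cong Ψ (v4-cong (left c) (right e) (left d) (right f)))
      where
      left : ∀ x → κ * x + μ * 0# ≡ κ * x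
      left x = solve 3 (λ κ μ x → κ :* x :+ μ :* :0 := κ :* x) refl κ μ x
      right : ∀ x → κ * 0# + μ * x ≡ μ * x
      right x = solve 3 (λ κ μ x → κ :* :0 :+ μ :* x := μ :* x) refl κ μ x

    pair-cancel : ∀ {κ c d} → c ≢ 0# ⊎ d ≢ 0# → κ * c ≡ 0# → κ * d ≡ 0# → κ ≡ 0#
    pair-cancel (inj₁ c≢0) e _ = *≡0 c≢0 (trans (*-comm _ _) e)
    pair-cancel (inj₂ d≢0) _ e = *≡0 d≢0 (trans (*-comm _ _) e)

    coefficient-≢0 : ∀ {κ c d g h} → g ≢ 0# ⊎ h ≢ 0# → κ * c ≡ g → κ * d ≡ h → κ ≢ 0#
    coefficient-≢0 (inj₁ g≢0) e _ refl = g≢0 (trans (sym e) (zeroˡ _))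
    coefficient-≢0 (inj₂ h≢0) _ e refl = h≢0 (trans (sym e) (zeroˡ _))

  -- A transversal meets ⟨(1,0)⟩ and ⟨(0,1)⟩ in points (c,0,d,0) and (0,e,0,f), proportional because of ⟨(1,1)⟩;
  -- a further point on the line of (1,β) then forces β^s = β unless c = 0 or d = 0.
  module _ {m : Line} (line : IsLine m) {β : K} (β∉Fq : ¬ InFq β)
    {c d e f g h k l : K} (cd≢0 : c ≢ 0# ⊎ d ≢ 0#) (ef≢0 : e ≢ 0# ⊎ f ≢ 0#) (gh≢0 : g ≢ 0# ⊎ h ≢ 0#) (kl≢0 : k ≢ 0# ⊎ l ≢ 0#)
    (on₁ : T (onLine m (Ψ (v4 c 0# d 0#)))) (on₂ : T (onLine m (Ψ (v4 0# e 0# f))))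
    (on₃ : T (onLine m (Ψ (v4 g g h h)))) (on₄ : T (onLine m (Ψ (v4 k (k * β) l (l * s β))))) where

    private
      u₁ u₂ : V4
      u₁ = Ψ (v4 c 0# d 0#)
      u₂ = Ψ (v4 0# e 0# f)

      indep : Indep u₁ u₂
      indep κ μ z = pair-cancel cd≢0 (cong V4.c0 z′) (cong V4.c2 z′) , pair-cancel ef≢0 (cong V4.c1 z′) (cong V4.c3 z′)
        where
        z′ : v4 (κ * c) (μ * e) (κ * d) (μ * f) ≡ zeroV
        z′ = Ψ-zero (trans (sym (axis-combination κ μ c d e f)) z)

      coordinates : ∀ {w} → T (onLine m (Ψ w)) → ∃ λ κ → ∃ λ μ → v4 (κ * c) (μ * e) (κ * d) (μ * f) ≡ w
      coordinates {w} h = from (inSpan2-elim {u₁} {u₂} {Ψ w} (spans-line {u₁ = u₁} {u₂ = u₂} line on₁ on₂ indep h))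
        where
        from : (∃ λ κ → ∃ λ μ → κ ∙ u₁ ⊕ μ ∙ u₂ ≡ Ψ w) → ∃ λ κ → ∃ λ μ → v4 (κ * c) (μ * e) (κ * d) (μ * f) ≡ w
        from (κ , μ , z) = κ , μ , Ψ-injective (trans (sym (axis-combination κ μ c d e f)) z)

      same : ∀ {v w} → Indep v w → T (onLine (v , w) u₁) → T (onLine (v , w) u₂) → SameLine m (v , w)
      same {v} {w} vw h₁ h₂ u = trans (sameLine {u₁ = u₁} {u₂ = u₂} line on₁ on₂ indep u) (sym (sameLine {v} {w} {u₁} {u₂} vw h₁ h₂ indep u))

      not-both : ∀ {κ μ κ′ μ′} → v4 (κ * c) (μ * e) (κ * d) (μ * f) ≡ v4 g g h h →
                 v4 (κ′ * c) (μ′ * e) (κ′ * d) (μ′ * f) ≡ v4 k (k * β) l (l * s β) → c ≢ 0# → d ≢ 0# → ⊥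
      -- The ratio μ′ κ / (κ′ μ) equals β when computed from the first two coordinates, which needs
      -- c ≠ 0, and s β when computed from the last two, which needs d ≠ 0.
      not-both {κ} {μ} {κ′} {μ′} z z′ c≢0 d≢0 = β∉Fq (s-fixed (*-cancelˡ (*-≢0 κ′≢0 μ≢0) (trans
          (slope d≢0 (trans (cong V4.c3 z) (sym (cong V4.c2 z))) (cong V4.c2 z′) (cong V4.c3 z′))
          (sym (slope c≢0 (trans (cong V4.c1 z) (sym (cong V4.c0 z))) (cong V4.c0 z′) (cong V4.c1 z′))))))
        where
        κ′≢0 : κ′ ≢ 0#
        κ′≢0 = coefficient-≢0 kl≢0 (cong V4.c0 z′) (cong V4.c2 z′)
        μ≢0 : μ ≢ 0#
        μ≢0 = coefficient-≢0 gh≢0 (cong V4.c1 z) (cong V4.c3 z)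
        slope : ∀ {c e k β} → c ≢ 0# → μ * e ≡ κ * c → κ′ * c ≡ k → μ′ * e ≡ k * β → κ′ * μ * β ≡ μ′ * κ
        slope {c} {e} {k} {β} c≢0 e₁ refl e₂ = *-cancelˡ c≢0 (begin
          c * (κ′ * μ * β)  ≡⟨ solve 4 (λ c κ μ β → c :* (κ :* μ :* β) := μ :* (κ :* c :* β)) refl c κ′ μ β ⟩
          μ * (κ′ * c * β)  ≡⟨ cong (μ *_) (sym e₂) ⟩
          μ * (μ′ * e)  ≡⟨ solve 3 (λ μ ν e → μ :* (ν :* e) := ν :* (μ :* e)) refl μ μ′ e ⟩
          μ′ * (μ * e)  ≡⟨ cong (μ′ *_) e₁ ⟩
          μ′ * (κ * c)  ≡⟨ solve 3 (λ ν κ c → ν :* (κ :* c) := c :* (ν :* κ)) refl μ′ κ c ⟩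
          c * (μ′ * κ)  ∎)
          where open ≡-Reasoning

      partner-zero : ∀ {κ μ d f h} → μ ≢ 0# → κ * d ≡ h → μ * f ≡ h → d ≡ 0# → f ≡ 0#
      partner-zero μ≢0 e₁ e₂ refl = *≡0 μ≢0 (trans e₂ (trans (sym e₁) (zeroʳ _)))

      cases : ∀ {κ μ κ′ μ′} → v4 (κ * c) (μ * e) (κ * d) (μ * f) ≡ v4 g g h h →
              v4 (κ′ * c) (μ′ * e) (κ′ * d) (μ′ * f) ≡ v4 k (k * β) l (l * s β) →
              Dec (c ≡ 0#) → Dec (d ≡ 0#) → SameLine m transversal₁ ⊎ SameLine m transversal₂
      cases z z′ (no c≢0)  (no d≢0)  = ⊥-elim (not-both z z′ c≢0 d≢0)
      cases z z′ _         (yes d≡0) = inj₁ (same (proj₁ transversal₁-is)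
        (inSpan2-intro c 0# (trans (combination₁ c 0#) (cong Ψ (v4-cong refl refl (sym d≡0) refl))))
        (inSpan2-intro 0# e (trans (combination₁ 0# e) (cong Ψ (v4-cong refl refl refl
          (sym (partner-zero (coefficient-≢0 gh≢0 (cong V4.c1 z) (cong V4.c3 z)) (cong V4.c2 z) (cong V4.c3 z) d≡0)))))))
      cases z z′ (yes c≡0) (no d≢0)  = inj₂ (same (proj₁ transversal₂-is)
        (inSpan2-intro d 0# (trans (combination₂ d 0#) (cong Ψ (v4-cong (sym c≡0) refl refl refl))))
        (inSpan2-intro 0# f (trans (combination₂ 0# f) (cong Ψ (v4-cong refl
          (sym (partner-zero (coefficient-≢0 gh≢0 (cong V4.c1 z) (cong V4.c3 z)) (cong V4.c0 z) (cong V4.c1 z) c≡0)) refl refl)))))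

    four-points : SameLine m transversal₁ ⊎ SameLine m transversal₂
    four-points = from (coordinates on₃) (coordinates on₄)
      where
      from : (∃ λ κ → ∃ λ μ → v4 (κ * c) (μ * e) (κ * d) (μ * f) ≡ v4 g g h h) →
             (∃ λ κ → ∃ λ μ → v4 (κ * c) (μ * e) (κ * d) (μ * f) ≡ v4 k (k * β) l (l * s β)) →
             SameLine m transversal₁ ⊎ SameLine m transversal₂
      from (_ , _ , z) (_ , _ , z′) = cases z z′ (c ≟ 0#) (d ≟ 0#)

  transversal-unique : ∀ m → IsLine m → MeetLines m (longLine 0# 1#) → (∀ β → MeetLines m (longLine 1# β)) →
                       SameLine m transversal₁ ⊎ SameLine m transversal₂
  transversal-unique m line meets₀₁ meets₁ = from outside-Fq
      (meetingPoint {m} (meets₁ 0#)) (meetingPoint {m} meets₀₁) (meetingPoint {m} (meets₁ 1#))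
    where
    s1 : s 1# ≡ 1#
    s1 = φ-1 R
    times-1 : ∀ {c} → c * s 1# ≡ c
    times-1 = trans (cong (_ *_) s1) (*-identityʳ _)
    times-0 : ∀ {c} → c * s 0# ≡ 0#
    times-0 = trans (cong (_ *_) (φ-0 R)) (zeroʳ _)
    on : ∀ {u w} → u ≡ w → T (onLine m (Ψ u)) → T (onLine m (Ψ w))
    on refl h = h
    from : (∃ λ β → ¬ InFq β) → MeetingPoint m 1# 0# → MeetingPoint m 0# 1# → MeetingPoint m 1# 1# →
           SameLine m transversal₁ ⊎ SameLine m transversal₂
    from (β , β∉Fq) (c , d , cd , on₁) (e , f , ef , on₂) (g , h , gh , on₃) = last (meetingPoint {m} (meets₁ β))
      where
      last : MeetingPoint m 1# β → SameLine m transversal₁ ⊎ SameLine m transversal₂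
      last (k , l , kl , on₄) = four-points line β∉Fq cd ef gh kl
        (on (v4-cong (*-identityʳ c) (zeroʳ c) times-1 times-0) on₁)
        (on (v4-cong (zeroʳ e) (*-identityʳ e) times-0 times-1) on₂)
        (on (v4-cong (*-identityʳ g) (*-identityʳ g) times-1 times-1) on₃)
        (on (v4-cong (*-identityʳ k) refl times-1 refl) on₄)

  -- Representatives of the points of the projective line over K: (0, 1), and (1, β) for every β in
  -- the enumeration of K.
  direction : Fin (suc (q ^ n)) → K × K
  direction fzero    = 0# , 1#
  direction (fsuc i) = 1# , lookup elems (cast (sym elems-card) i)

  direction-nonzero : ∀ i → proj₁ (direction i) ≢ 0# ⊎ proj₂ (direction i) ≢ 0#
  direction-nonzero fzero    = inj₂ 1≢0
  direction-nonzero (fsuc i) = inj₁ 1≢0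

  directions-independent : ∀ i j → i ≢ j →
    proj₁ (direction i) * proj₂ (direction j) + - (proj₂ (direction i) * proj₁ (direction j)) ≢ 0#
  directions-independent fzero    fzero    i≢j = ⊥-elim (i≢j refl)
  directions-independent fzero    (fsuc j) i≢j e = -‿≢0 1≢0 (trans (solve 1 (λ x → :- :1 := :0 :* x :+ :- (:1 :* :1)) refl _) e)
  directions-independent (fsuc i) fzero    i≢j e = 1≢0 (trans (solve 1 (λ x → :1 := :1 :* :1 :+ :- (x :* :0)) refl _) e)
  directions-independent (fsuc i) (fsuc j) i≢j e = i≢j (cong fsuc (cast-injective (lookup-injective elems-unique _ _
      (sym (x-y≡0⇒x≡y (trans (solve 2 (λ x y → y :+ :- x := :1 :* y :+ :- (x :* :1)) refl _ _) e))))))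
    where
    cast-injective : cast (sym elems-card) i ≡ cast (sym elems-card) j → i ≡ j
    cast-injective e = Finₚ.toℕ-injective (trans (sym (Finₚ.toℕ-cast _ i)) (trans (cong toℕ e) (Finₚ.toℕ-cast _ j)))

  direction-slope : ∀ β → ∃ λ i → direction i ≡ (1# , β)
  direction-slope β = fsuc (cast elems-card i) , cong (1# ,_) (trans
      (cong (lookup elems) (trans (Finₚ.cast-trans elems-card (sym elems-card) i) (Finₚ.cast-is-id _ i)))
      (sym (lookup-index (elems-complete β))))
    where i = index (elems-complete β)

  pseudoregulusType : PseudoregulusType
  pseudoregulusType = (λ i → lineOf (direction i)) ,
    (λ i → longLine-isLong (direction-nonzero i)) ,
    (λ i j i≢j → longLines-disjoint (directions-independent i j i≢j)) ,
    transversal₁ , transversal₂ , good transversal₁-is , good transversal₂-is , transversals-differ ,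
    λ m (line , _ , meets) → transversal-unique m line (meets fzero)
      (λ β → let (i , e) = direction-slope β in subst (MeetLines m ∘ lineOf) e (meets i))
    where
    lineOf : K × K → Line
    lineOf (α , β) = longLine α β
    good : ∀ {m} → Transversal m → IsLine m × LineDisjointFromL m × (∀ i → MeetLines m (lineOf (direction i)))
    good (line , disjoint , meets) = line , disjoint , λ i → meets _ _ (direction-nonzero i)

-- The case n > 3

module AffineFunctions {q n : ℕ} (F : FieldOfOrder q n) where
  open FiniteField F
  open Polynomials F

  ConstantAt : ℕ → ((ℕ → K) → K) → Set
  ConstantAt i G = ∀ v t → G (v [ i ≔ t ]) ≡ G v

  constant-affine : ∀ {i G} → ConstantAt i G → AffineAt i G
  constant-affine {i} {G} const = affineAt λ v t → begin
    G (v [ i ≔ t ])  ≡⟨ const v t ⟩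
    G v  ≡⟨ solve 2 (λ g t → g := g :+ t :* (g :+ :- g)) refl (G v) t ⟩
    G v + t * (G v + - G v)  ≡⟨ cong₂ (λ x y → x + t * (y + - x)) (sym (const v 0#)) (sym (const v 1#)) ⟩
    _  ∎
    where open ≡-Reasoning

  coordinate-affine : ∀ i → AffineAt i (λ v → v i)
  coordinate-affine i = affineAt λ v t → trans (≔-same v i)
    (trans (solve 1 (λ t → t := :0 :+ t :* (:1 :+ :- :0)) refl t)
      (cong₂ (λ x y → x + t * (y + - x)) (sym (≔-same v i)) (sym (≔-same v i))))

  *-affine : ∀ {i G H} → ConstantAt i G → AffineAt i H → AffineAt i (λ v → G v * H v)
  *-affine {i} {G} {H} const affine = affineAt λ v t → begin
    G (v [ i ≔ t ]) * H (v [ i ≔ t ])  ≡⟨ cong₂ _*_ (const v t) (affineAt-≔ affine v t) ⟩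
    G v * (H (v [ i ≔ 0# ]) + t * (H (v [ i ≔ 1# ]) + - H (v [ i ≔ 0# ])))
      ≡⟨ solve 4 (λ g h₀ h₁ t → g :* (h₀ :+ t :* (h₁ :+ :- h₀)) := g :* h₀ :+ t :* (g :* h₁ :+ :- (g :* h₀))) refl (G v) _ _ t ⟩
    G v * H (v [ i ≔ 0# ]) + t * (G v * H (v [ i ≔ 1# ]) + - (G v * H (v [ i ≔ 0# ])))
      ≡⟨ cong₂ (λ x y → x * H (v [ i ≔ 0# ]) + t * (y * H (v [ i ≔ 1# ]) + - (x * H (v [ i ≔ 0# ])))) (sym (const v 0#)) (sym (const v 1#)) ⟩
    _ ∎
    where open ≡-Reasoning

  +-affine : ∀ {i G H} → AffineAt i G → AffineAt i H → AffineAt i (λ v → G v + H v)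
  +-affine affine affine′ = affineAt λ v t → trans (cong₂ _+_ (affineAt-≔ affine v t) (affineAt-≔ affine′ v t))
    (solve 5 (λ g₀ g₁ h₀ h₁ t → g₀ :+ t :* (g₁ :+ :- g₀) :+ (h₀ :+ t :* (h₁ :+ :- h₀))
                            := g₀ :+ h₀ :+ t :* (g₁ :+ h₁ :+ :- (g₀ :+ h₀))) refl _ _ _ _ t)

  neg-affine : ∀ {i G} → AffineAt i G → AffineAt i (λ v → - G v)
  neg-affine affine = affineAt λ v t → trans (cong -_ (affineAt-≔ affine v t))
    (solve 3 (λ g₀ g₁ t → :- (g₀ :+ t :* (g₁ :+ :- g₀)) := :- g₀ :+ t :* (:- g₁ :+ :- (:- g₀))) refl _ _ t)

  affine-cong : ∀ {i} {G H : (ℕ → K) → K} → (∀ v → G v ≡ H v) → AffineAt i G → AffineAt i H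
  affine-cong eq affine = affineAt λ v t → trans (sym (eq _)) (trans (affineAt-≔ affine v t) (cong₂ (λ x y → x + t * (y + - x)) (eq _) (eq _)))

  linearCombination-MultiAffine : ∀ {k G H} a b → MultiAffine k G → MultiAffine k H → MultiAffine k (λ v → a * G v + - (b * H v))
  linearCombination-MultiAffine a b maG maH = record
    { ext    = λ eq → cong₂ (λ x y → a * x + - (b * y)) (MultiAffine.ext maG eq) (MultiAffine.ext maH eq)
    ; affine = λ i<k → +-affine (*-affine (λ _ _ → refl) (MultiAffine.affine maG i<k))
                    (neg-affine (*-affine (λ _ _ → refl) (MultiAffine.affine maH i<k))) }

-- Transfer matrices, eigenvalues and products of linear factors

module NotPseudoregulus {q n : ℕ} (F : FieldOfOrder q n) (S : Setting F)
  (a≢0 : Setting.a S ≢ FieldOfOrder.0# F)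
  (Na≢-1 : Setup.N F (Setting.a S) ≢ FieldOfOrder.-_ F (FieldOfOrder.1# F)) (3<n : 3 < n) where
  open Setting S
  open FiniteField F
  open Vectors F
  open Polynomials F
  open AffineFunctions F
  open Galois F {k = k} prime q≡p^ 0<n
  open Operator F S
  open Reordering F S

  ∏<-ext : ∀ k {f g} → (∀ j → j < k → f j ≡ g j) → ∏< k f ≡ ∏< k g
  ∏<-ext zero    eq = refl
  ∏<-ext (suc k) eq = cong₂ _*_ (eq k ℕₚ.≤-refl) (∏<-ext k (λ j j<k → eq j (ℕₚ.m≤n⇒m≤1+n j<k)))

  ∏<-zero : ∀ k {f j} → j < k → f j ≡ 0# → ∏< k f ≡ 0#
  ∏<-zero (suc k) {f} {j} j<1+k e with j ℕ.≟ k
  ... | yes refl = trans (cong (_* ∏< k f) e) (zeroˡ _)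
  ... | no  j≢k  = trans (cong (f k *_) (∏<-zero k (ℕₚ.≤∧≢⇒< (ℕₚ.≤-pred j<1+k) j≢k) e)) (zeroʳ _)

  -- A product of factors each depending on at most one of two variables satisfies F(0,0) F(1,1) =
  -- F(1,0) F(0,1); this is the identity that `D` will violate.
  ∏<-rank-one : ∀ k {f g f′ g′} → (∀ j → f j * g j ≡ f′ j * g′ j) → ∏< k f * ∏< k g ≡ ∏< k f′ * ∏< k g′
  ∏<-rank-one zero    eq = refl
  ∏<-rank-one (suc k) {f} {g} {f′} {g′} eq = begin
    f k * ∏< k f * (g k * ∏< k g)  ≡⟨ interchange _ _ _ _ ⟩
    f k * g k * (∏< k f * ∏< k g)  ≡⟨ cong₂ _*_ (eq k) (∏<-rank-one k eq) ⟩
    f′ k * g′ k * (∏< k f′ * ∏< k g′)  ≡⟨ sym (interchange _ _ _ _) ⟩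
    f′ k * ∏< k f′ * (g′ k * ∏< k g′)  ∎
    where
    open ≡-Reasoning
    interchange : ∀ x y z w → x * y * (z * w) ≡ x * z * (y * w)
    interchange = solve 4 (λ x y z w → x :* y :* (z :* w) := x :* z :* (y :* w)) refl

  product : (ℕ → K) → (ℕ → K) → (ℕ → K) → K
  product α β v = ∏< n (λ i → α i + β i * v i)

  product-MultiAffine : ∀ α β → MultiAffine n (product α β)
  product-MultiAffine α β = record { ext = λ eq → ∏<-ext n (λ j j<n → cong (λ x → α j + β j * x) (eq j j<n)) ; affine = affine n }
    where
    partial : ℕ → (ℕ → K) → K
    partial k v = ∏< k (λ i → α i + β i * v i)
    affine : ∀ k {i} → i < k → AffineAt i (partial k)
    affine (suc k) {i} i<1+k with i ℕ.≟ k
    ... | yes refl = affine-cong (λ v → *-comm (partial i v) _)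
          (*-affine (λ v t → ∏<-ext i (λ j j<i → cong (λ x → α j + β j * x) (≔-other v (ℕₚ.<⇒≢ j<i))))
            (+-affine (constant-affine {G = λ _ → α i} (λ _ _ → refl)) (*-affine (λ _ _ → refl) (coordinate-affine i))))
    ... | no i≢k = *-affine (λ v t → cong (λ x → α k + β k * x) (≔-other v (i≢k ∘ sym)))
          (affine k (ℕₚ.≤∧≢⇒< (ℕₚ.≤-pred i<1+k) i≢k))

  -- If A x = μ x, then (x^{s^j}, x^{s^{j−1}}) evolves by the matrices ((μ^{s^j}, a^{s^j}), (1, 0)), and returns after n steps.
  a_ : ℕ → K
  a_ j = φ (j *ℕ R) a

  a_≢0 : ∀ j → a_ j ≢ 0#
  a_≢0 j = φ-≢0 (j *ℕ R) a≢0

  step : K → K → K × K → K × K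
  step w b (y , y′) = w * y + b * y′ , y

  state : (ℕ → K) → K × K → ℕ → K × K
  state w y zero    = y
  state w y (suc j) = step (w j) (a_ j) (state w y j)

  state-ext : ∀ {w w′} y k → (∀ j → j < k → w j ≡ w′ j) → state w y k ≡ state w′ y k
  state-ext y zero    eq = refl
  state-ext y (suc k) eq = cong₂ (λ x z → step x (a_ k) z) (eq k ℕₚ.≤-refl) (state-ext y k (λ j j<k → eq j (ℕₚ.m≤n⇒m≤1+n j<k)))

  -- The columns of the product of the first transfer matrices.
  U V : (ℕ → K) → ℕ → K × K
  U w = state w (1# , 0#)
  V w = state w (0# , 1#)

  state-linear : ∀ w x x′ j → state w (x , x′) j ≡
    (proj₁ (U w j) * x + proj₁ (V w j) * x′ , proj₂ (U w j) * x + proj₂ (V w j) * x′)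
  state-linear w x x′ zero    = cong₂ _,_ (solve 2 (λ x x′ → x := :1 :* x :+ :0 :* x′) refl x x′)
                    (solve 2 (λ x x′ → x′ := :0 :* x :+ :1 :* x′) refl x x′)
  state-linear w x x′ (suc j) = trans (cong (step (w j) (a_ j)) (state-linear w x x′ j))
    (cong₂ _,_ (solve 8 (λ w b u u′ v v′ x x′ → w :* (u :* x :+ v :* x′) :+ b :* (u′ :* x :+ v′ :* x′)
                    := (w :* u :+ b :* u′) :* x :+ (w :* v :+ b :* v′) :* x′) refl (w j) (a_ j) _ _ _ _ x x′) refl)

  det : (ℕ → K) → ℕ → K
  det w j = proj₁ (U w j) * proj₂ (V w j) + - (proj₁ (V w j) * proj₂ (U w j))

  -- A single transfer matrix with rows (w, b) and (1, 0) has determinant -b, whatever w is.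
  det-product : ∀ w k → det w k ≡ ∏< k (λ j → φ (j *ℕ R) (- a))
  det-product w zero    = solve 0 (:1 :* :1 :+ :- (:0 :* :0) := :1) refl
  det-product w (suc k) = trans
    (solve 6 (λ w b u u′ v v′ → (w :* u :+ b :* u′) :* v :+ :- ((w :* v :+ b :* v′) :* u) := :- b :* (u :* v′ :+ :- (v :* u′)))
       refl (w k) (a_ k) (proj₁ (U w k)) (proj₂ (U w k)) (proj₁ (V w k)) (proj₂ (V w k)))
    (cong₂ _*_ (sym (φ-neg (k *ℕ R) a)) (det-product w k))

  det-n : ∀ w → det w n ≡ - N a
  det-n w = trans (det-product w n) (trans (sym (N≡∏-φR (- a))) (N-neg a))

  -- Trace - 1 - determinant of the full product M, whose determinant is -N a. Up to sign this is
  -- the characteristic polynomial of M at 1.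
  D : (ℕ → K) → K
  D w = proj₁ (U w n) + proj₂ (V w n) + - (1# + - N a)

  -- The nonzero vector (x, t x) returns to itself after n steps, so 1 is an eigenvalue of the
  -- product matrix.
  D-vanishes : ∀ {x μ} → x ≢ 0# → A x ≡ μ * x → D (λ j → φ (j *ℕ R) μ) ≡ 0#
  D-vanishes {x} {μ} x≢0 Ax≡μx = *≡0 x≢0 (begin
    x * D w  ≡⟨ cong (λ z → x * (u + v′ + - (1# + z))) (sym (det-n w)) ⟩
    x * (u + v′ + - (1# + (u * v′ + - (v * u′)))) ≡⟨ solve 6 (λ x y u u′ v v′ → x :* (u :+ v′ :+ :- (:1 :+ (u :* v′ :+ :- (v :* u′))))
                    := (:1 :+ :- v′) :* (u :* x :+ v :* y :+ :- x) :+ v :* (u′ :* x :+ v′ :* y :+ :- y)) refl x (t x) u u′ v v′ ⟩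
    (1# + - v′) * (u * x + v * t x + - x) + v * (u′ * x + v′ * t x + - t x)
                    ≡⟨ cong₂ (λ y z → (1# + - v′) * (y + - x) + v * (z + - t x)) (cong proj₁ fixed) (cong proj₂ fixed) ⟩
    (1# + - v′) * (x + - x) + v * (t x + - t x)  ≡⟨ solve 4 (λ x y v v′ → (:1 :+ :- v′) :* (x :+ :- x) :+ v :* (y :+ :- y) := :0) refl x (t x) v v′ ⟩
    0#  ∎)
    where
    open ≡-Reasoning
    w : ℕ → K
    w j = φ (j *ℕ R) μ
    u = proj₁ (U w n)
    u′ = proj₂ (U w n)
    v = proj₁ (V w n)
    v′ = proj₂ (V w n)
    s-step : s x ≡ μ * x + a * t x
    s-step = trans (solve 3 (λ y a z → y := y :+ :- (a :* z) :+ a :* z) refl (s x) a (t x))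
      (cong (_+ a * t x) (trans (sym (A-def x)) Ax≡μx))
    orbit : ∀ j → state w (x , t x) j ≡ (φ (j *ℕ R) x , φ (j *ℕ R) (t x))
    orbit zero    = cong₂ _,_ (sym (φ-zero x)) (sym (φ-zero (t x)))
    orbit (suc j) = trans (cong (step (w j) (a_ j)) (orbit j)) (cong₂ _,_
      (trans (sym (trans (φ-+ (j *ℕ R) _ _) (cong₂ _+_ (φ-* (j *ℕ R) μ x) (φ-* (j *ℕ R) a (t x)))))
        (trans (cong (φ (j *ℕ R)) (sym s-step)) (trans (φ-∘ (j *ℕ R) R x) (cong (λ i → φ i x) (ℕₚ.+-comm (j *ℕ R) R)))))
      (trans (cong (φ (j *ℕ R)) (sym (s∘t x))) (trans (φ-∘ (j *ℕ R) R (t x)) (cong (λ i → φ i (t x)) (ℕₚ.+-comm (j *ℕ R) R)))))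
    period : ∀ y → φ (n *ℕ R) y ≡ y
    period y = trans (cong (λ i → φ i y) (ℕₚ.*-comm n R)) (φ-n* R y)
    fixed : (u * x + v * t x , u′ * x + v′ * t x) ≡ (x , t x)
    fixed = trans (sym (state-linear w x (t x) n)) (trans (orbit n) (cong₂ _,_ (period x) (period (t x))))

  -- D in the coordinates v i, which stand for μ^{q^i}.
  D′ : (ℕ → K) → K
  D′ v = D (v ∘ π)

  D′-MultiAffine : MultiAffine n D′
  D′-MultiAffine = record
    { ext    = λ eq → cong₂ (λ y z → proj₁ y + proj₂ z + - (1# + - N a)) (ext-state _ eq) (ext-state _ eq)
    ; affine = λ {i} _ → +-affine (+-affine (proj₁ (proj₁ (parts (1# , 0#) i n ℕₚ.≤-refl))) (proj₂ (proj₁ (parts (0# , 1#) i n ℕₚ.≤-refl))))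
                 (constant-affine {G = λ _ → - (1# + - N a)} (λ _ _ → refl)) }
    where
    ext-state : ∀ y {v w} → (∀ i → i < n → v i ≡ w i) → state (v ∘ π) y n ≡ state (w ∘ π) y n
    ext-state y eq = state-ext y n (λ j _ → eq (π j) (π<n j))
    -- Since π is injective below n, the variable v_i enters at one step only. Before that step the
    -- state does not depend on it, which is what the last component records; at that step it enters
    -- linearly, and later steps preserve affinity.
    parts : ∀ y i k → k ≤ n →
      (AffineAt i (λ v → proj₁ (state (v ∘ π) y k)) × AffineAt i (λ v → proj₂ (state (v ∘ π) y k))) ×
      ((∀ j → j < k → π j ≢ i) → ∀ v t → state ((v [ i ≔ t ]) ∘ π) y k ≡ state (v ∘ π) y k)
    parts y i zero    _   = (constant-affine (λ _ _ → refl) , constant-affine (λ _ _ → refl)) , λ _ _ _ → refl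
    parts y i (suc k) k<n = next (parts y i k (ℕₚ.<⇒≤ k<n)) (π k ℕ.≟ i)
      where
      first : (ℕ → K) → K
      first v = proj₁ (state (v ∘ π) y k)
      next : (AffineAt i first × AffineAt i (λ v → proj₂ (state (v ∘ π) y k))) ×
             ((∀ j → j < k → π j ≢ i) → ∀ v t → state ((v [ i ≔ t ]) ∘ π) y k ≡ state (v ∘ π) y k) → Dec (π k ≡ i) →
             (AffineAt i (λ v → proj₁ (state (v ∘ π) y (suc k))) × AffineAt i first) ×
             ((∀ j → j < suc k → π j ≢ i) → ∀ v t → state ((v [ i ≔ t ]) ∘ π) y (suc k) ≡ state (v ∘ π) y (suc k))
      next ((affine₁ , affine₂) , const) (yes refl) =
        (+-affine (affine-cong (λ v → *-comm (first v) (v i)) (*-affine (λ v t → cong proj₁ (constant v t)) (coordinate-affine i)))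
                  (*-affine (λ _ _ → refl) affine₂) , affine₁) ,
        λ avoid → ⊥-elim (avoid k ℕₚ.≤-refl refl)
        where
        constant : ∀ v t → state ((v [ i ≔ t ]) ∘ π) y k ≡ state (v ∘ π) y k
        constant = const (λ j j<k e → ℕₚ.<⇒≢ j<k (trans (sym (π⁻¹∘π (ℕₚ.<-trans j<k k<n))) (trans (cong π⁻¹ e) (π⁻¹∘π k<n))))
      next ((affine₁ , affine₂) , const) (no πk≢i) =
        (+-affine (*-affine (λ v t → ≔-other v πk≢i) affine₁)
                  (*-affine (λ _ _ → refl) affine₂) , affine₁) ,
        λ avoid v t → cong₂ (λ x z → step x (a_ k) z) (≔-other v πk≢i) (const (λ j j<k → avoid j (ℕₚ.m≤n⇒m≤1+n j<k)) v t)

  -- An odd number of steps with zero entries acts by an antidiagonal matrix.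
  zero-run : ∀ j₀ i → ∃ λ g → ∃ λ h → g ≢ 0# × h ≢ 0# × (∀ w → (∀ j → j₀ ≤ j → w j ≡ 0#) →
             ∀ y → state w y (suc (i *ℕ 2 +ℕ j₀)) ≡ (g * proj₂ (state w y j₀) , h * proj₁ (state w y j₀)))
  zero-run j₀ zero    = a_ j₀ , 1# , a_≢0 j₀ , 1≢0 , λ w z y → cong₂ _,_
    (trans (cong (λ x → x * proj₁ (state w y j₀) + a_ j₀ * proj₂ (state w y j₀)) (z j₀ ℕₚ.≤-refl)) (solve 2 (λ x y → :0 :* x :+ y := y) refl _ _))
    (sym (*-identityˡ _))
  zero-run j₀ (suc i) with zero-run j₀ i
  ... | g , h , g≢0 , h≢0 , run = a_ (suc (suc m′)) * g , a_ (suc m′) * h , *-≢0 (a_≢0 (suc (suc m′))) g≢0 , *-≢0 (a_≢0 (suc m′)) h≢0 , λ w z y →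
    trans (cong (λ st → step (w (suc (suc m′))) (a_ (suc (suc m′))) (step (w (suc m′)) (a_ (suc m′)) st)) (run w z y))
      (trans (cong₂ (λ b c → step b (a_ (suc (suc m′))) (step c (a_ (suc m′)) (g * proj₂ (state w y j₀) , h * proj₁ (state w y j₀))))
                (z (suc (suc m′)) (ℕₚ.m≤n⇒m≤1+n (ℕₚ.m≤n⇒m≤1+n j₀≤m′))) (z (suc m′) (ℕₚ.m≤n⇒m≤1+n j₀≤m′)))
        (cong₂ _,_ (solve 4 (λ b g x r → :0 :* r :+ b :* (g :* x) := b :* g :* x) refl (a_ (suc (suc m′))) g (proj₂ (state w y j₀)) _)
                   (solve 4 (λ b h x r → :0 :* r :+ b :* (h :* x) := b :* h :* x) refl (a_ (suc m′)) h (proj₁ (state w y j₀)) _)))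
    where
    m′ = i *ℕ 2 +ℕ j₀
    j₀≤m′ : j₀ ≤ m′
    j₀≤m′ = ℕₚ.m≤n+m j₀ (i *ℕ 2)

  D-run : ∀ {m g h w} → n ≡ m → ∀ j₀ → (∀ y → state w y m ≡ (g * proj₂ (state w y j₀) , h * proj₁ (state w y j₀))) →
          D w ≡ g * proj₂ (U w j₀) + h * proj₁ (V w j₀) + - (1# + - N a)
  D-run refl j₀ run = cong₂ (λ y z → proj₁ y + proj₂ z + - (1# + - N a)) (run (1# , 0#)) (run (0# , 1#))

  eigenvalue? : ∀ μ → Dec (∃ λ x → x ≢ 0# × A x ≡ μ * x)
  eigenvalue? μ = EK.exists? (λ x → ≢0? x ×-dec (A x ≟ (μ * x)))

  eigenvalue : K → K
  eigenvalue x = A x * inv x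

  A-eigenvalue : ∀ {x} → x ≢ 0# → A x ≡ eigenvalue x * x
  A-eigenvalue x≢0 = sym (trans (*-assoc _ _ _) (trans (cong (A _ *_) (inv-inverseˡ x≢0)) (*-identityʳ _)))

  *-inv-cancelʳ : ∀ {x₀} x → x₀ ≢ 0# → x * inv x₀ * x₀ ≡ x
  *-inv-cancelʳ x x₀≢0 = trans (*-assoc _ _ _) (trans (cong (x *_) (inv-inverseˡ x₀≢0)) (*-identityʳ x))

  eigenvectors-proportional : ∀ {μ x x₀} → x₀ ≢ 0# → A x ≡ μ * x → A x₀ ≡ μ * x₀ → InFq (x * inv x₀)
  eigenvectors-proportional {μ} {x} {x₀} x₀≢0 e e₀ = W⇒Fq Na≢-1 x₀≢0 (begin
    A (x * inv x₀ * x₀)  ≡⟨ cong A (*-inv-cancelʳ x x₀≢0) ⟩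
    A x  ≡⟨ e ⟩
    μ * x  ≡⟨ cong (μ *_) (sym (*-inv-cancelʳ x x₀≢0)) ⟩
    μ * (x * inv x₀ * x₀)  ≡⟨ solve 3 (λ μ l x → μ :* (l :* x) := l :* (μ :* x)) refl μ (x * inv x₀) x₀ ⟩
    x * inv x₀ * (μ * x₀)  ≡⟨ cong (x * inv x₀ *_) (sym e₀) ⟩
    x * inv x₀ * A x₀  ∎)
    where open ≡-Reasoning

  -- Because N a ≠ -1, eigenvectors for the same μ differ by factors in F_q, so x ↦ A x / x takes
  -- each value at most q - 1 times on the geom n · (q - 1) nonzero x.
  #eigenvalues : geom n ≤ EK.# eigenvalue?
  #eigenvalues = ℕₚ.*-cancelʳ-≤ (geom n) _ q-1 {{>-nonZero 0<q-1}} (begin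
    geom n *ℕ q-1  ≡⟨ sym #K* ⟩
    EK.# ≢0?  ≤⟨ fiber-≤ K-enum K-enum ≢0? eigenvalue? eigenvalue (λ x x≢0 → x , x≢0 , A-eigenvalue x≢0) fiber ⟩
    EK.# eigenvalue? *ℕ q-1 ∎)
    where
    open ℕₚ.≤-Reasoning
    fiber : ∀ μ → (∃ λ x → x ≢ 0# × A x ≡ μ * x) → EK.# (λ x → ≢0? x ×-dec (eigenvalue x ≟ μ)) ≤ q-1
    fiber μ (x₀ , x₀≢0 , e₀) = ℕₚ.≤-trans (injection K-enum K-enum _ Fq*? (λ x → x * inv x₀)
        (λ x (x≢0 , e) → *-≢0 x≢0 (inv-≢0 x₀≢0) ,
          eigenvectors-proportional x₀≢0 (trans (A-eigenvalue x≢0) (cong (_* x) e)) e₀)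
        (λ x y _ _ e → trans (sym (*-inv-cancelʳ x x₀≢0)) (trans (cong (_* x₀) e) (*-inv-cancelʳ y x₀≢0))))
      (ℕₚ.≤-reflexive #Fq*)

  vanishing-on-eigenvalues : ∀ {G} → MultiAffine n G → topCoeff n G ≡ 0# →
    (∀ {x μ} → x ≢ 0# → A x ≡ μ * x → G (λ i → φ i μ) ≡ 0#) → ∀ v → G v ≡ 0#
  vanishing-on-eigenvalues ma top≡0 vanish = multiAffine-vanishing 2≤q ma top≡0 (filter eigenvalue? elems)
    (Uniqueₚ.filter⁺ eigenvalue? elems-unique) #eigenvalues
    (λ m∈ → let (x , x≢0 , e) = proj₂ (∈-filter⁻ eigenvalue? {xs = elems} m∈) in vanish x≢0 e)

  D′-vanishes : ∀ {x μ} → x ≢ 0# → A x ≡ μ * x → D′ (λ i → φ i μ) ≡ 0#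
  D′-vanishes {μ = μ} x≢0 e = trans (cong₂ (λ y z → proj₁ y + proj₂ z + - (1# + - N a)) (reorder (1# , 0#)) (reorder (0# , 1#))) (D-vanishes x≢0 e)
    where
    reorder : ∀ y → state (λ j → φ (π j) μ) y n ≡ state (λ j → φ (j *ℕ R) μ) y n
    reorder y = state-ext y n (λ j _ → φ-% (j *ℕ R) μ)


  -- After the four free entries of `probe` an odd number of zero entries remains, as `zero-run`
  -- requires.
  n≡5+2i : ∃ λ i → n ≡ suc (i *ℕ 2 +ℕ 4)
  n≡5+2i = from h n≡1+2h
    where
    from : ∀ h → n ≡ suc (h *ℕ 2) → ∃ λ i → n ≡ suc (i *ℕ 2 +ℕ 4)
    from zero          e = ⊥-elim (ℕₚ.<⇒≱ 3<n (ℕₚ.≤-trans (ℕₚ.≤-reflexive e) (s≤s z≤n)))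
    from (suc zero)    e = ⊥-elim (ℕₚ.<⇒≱ 3<n (ℕₚ.≤-reflexive e))
    from (suc (suc i)) e = i , trans e (cong suc (ℕₚ.+-comm 4 (i *ℕ 2)))

  -- Four free entries followed by zeros: `z` is prescribed by the splitting of `G`, `y` and `x` are
  -- the variables of the comparison, and `u` is there to remove their mixed term.
  probe : K → K → K → K → ℕ → K
  probe z y x u 0 = z
  probe z y x u 1 = y
  probe z y x u 2 = x
  probe z y x u 3 = u
  probe z y x u _ = 0#

  -- The antidiagonal matrix of the zero entries turns the trace into a combination of the lower
  -- entry of the first column and the upper entry of the second column after four steps.
  D-probe : ∃ λ g → ∃ λ h′ → g ≢ 0# × h′ ≢ 0# × (∀ z y x u → D (probe z y x u) ≡
            g * (x * (y * z + a_ 1) + a_ 2 * z) + h′ * (u * (x * (y * a_ 0) + a_ 2 * a_ 0) + a_ 3 * (y * a_ 0)) + - (1# + - N a))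
  D-probe = let (i , n≡) = n≡5+2i ; (g , h′ , g≢0 , h′≢0 , run) = zero-run 4 i in g , h′ , g≢0 , h′≢0 , λ z y x u →
    trans (D-run n≡ 4 (run (probe z y x u) (zeros z y x u))) (cong (_+ - (1# + - N a)) (cong₂ _+_
      (cong (g *_) (solve 6 (λ z y x a₀ a₁ a₂ → x :* (y :* (z :* :1 :+ a₀ :* :0) :+ a₁ :* :1) :+ a₂ :* (z :* :1 :+ a₀ :* :0)
                      := x :* (y :* z :+ a₁) :+ a₂ :* z) refl z y x (a_ 0) (a_ 1) (a_ 2)))
      (cong (h′ *_) (solve 8 (λ z y x u a₀ a₁ a₂ a₃ →
              u :* (x :* (y :* (z :* :0 :+ a₀ :* :1) :+ a₁ :* :0) :+ a₂ :* (z :* :0 :+ a₀ :* :1)) :+ a₃ :* (y :* (z :* :0 :+ a₀ :* :1) :+ a₁ :* :0)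
                := u :* (x :* (y :* a₀) :+ a₂ :* a₀) :+ a₃ :* (y :* a₀)) refl z y x u (a_ 0) (a_ 1) (a_ 2) (a_ 3)))))
    where
    zeros : ∀ z y x u j → 4 ≤ j → probe z y x u j ≡ 0#
    zeros z y x u (suc (suc (suc (suc j)))) _ = refl
    zeros z y x u 1 (s≤s ())
    zeros z y x u 2 (s≤s (s≤s ()))
    zeros z y x u 3 (s≤s (s≤s (s≤s ())))

  -- The xy-term of D (probe z y x u) is killed by the choice of u; the remaining polynomial in x and y has
  -- nonzero x- and y-terms and no xy-term, so it is not a product of a function of x and a function of y.
  D-not-rank-one : ∀ z → ∃ λ u → D (probe z 0# 0# u) * D (probe z 1# 1# u) ≢ D (probe z 1# 0# u) * D (probe z 0# 1# u)
  D-not-rank-one z = from D-probe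
    where
    from : (∃ λ g → ∃ λ h′ → g ≢ 0# × h′ ≢ 0# × (∀ z y x u → D (probe z y x u) ≡
            g * (x * (y * z + a_ 1) + a_ 2 * z) + h′ * (u * (x * (y * a_ 0) + a_ 2 * a_ 0) + a_ 3 * (y * a_ 0)) + - (1# + - N a))) →
           ∃ λ u → D (probe z 0# 0# u) * D (probe z 1# 1# u) ≢ D (probe z 1# 0# u) * D (probe z 0# 1# u)
    from (g , h′ , g≢0 , h′≢0 , eq) = u , λ e → *-≢0 (*-≢0 g≢0 (a_≢0 1)) (*-≢0 h′≢0 (*-≢0 (a_≢0 3) (a_≢0 0))) (begin
      -- At the four choices of (x, y), `D` takes the values κ, κ + β, κ + α and κ + α + β, and the
      -- difference of the two products of opposite values is α β.
      α * β  ≡⟨ solve 3 (λ α β c → α :* β := (c :+ β) :* (c :+ α) :+ :- (c :* (c :+ α :+ β))) refl α β κ ⟩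
      (κ + β) * (κ + α) + - (κ * (κ + α + β))
        ≡⟨ cong₂ (λ x y → x + - y) (cong₂ _*_ (sym d₁₀) (sym d₀₁)) (cong₂ _*_ (sym d₀₀) (sym d₁₁)) ⟩
      D (probe z 1# 0# u) * D (probe z 0# 1# u) + - (D (probe z 0# 0# u) * D (probe z 1# 1# u))
        ≡⟨ cong (λ y → D (probe z 1# 0# u) * D (probe z 0# 1# u) + - y) e ⟩
      D (probe z 1# 0# u) * D (probe z 0# 1# u) + - (D (probe z 1# 0# u) * D (probe z 0# 1# u))
        ≡⟨ -‿inverseʳ _ ⟩
      0# ∎)
      where
      open ≡-Reasoning
      u α β κ e₀ : K
      -- The solution of g z + h′ u a₀ = 0, whose left side is the coefficient of x y.
      u = - (g * z * inv (h′ * a_ 0))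
      α = g * a_ 1
      β = h′ * (a_ 3 * a_ 0)
      e₀ = 1# + - N a
      κ = g * (a_ 2 * z) + h′ * (u * (a_ 2 * a_ 0)) + - e₀
      kill : g * z + h′ * u * a_ 0 ≡ 0#
      kill = trans (solve 5 (λ g z h i a₀ → g :* z :+ h :* (:- (g :* z :* i)) :* a₀ := g :* z :+ :- (g :* z :* (h :* a₀ :* i))) refl g z h′ (inv (h′ * a_ 0)) (a_ 0))
        (trans (cong (λ x → g * z + - (g * z * x)) (inv-inverseʳ (*-≢0 h′≢0 (a_≢0 0)))) (solve 1 (λ x → x :+ :- (x :* :1) := :0) refl (g * z)))
      d₀₀ : D (probe z 0# 0# u) ≡ κ
      d₀₀ = trans (eq z 0# 0# u) (solve 9 (λ g h z u a₀ a₁ a₂ a₃ e →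
        g :* (:0 :* (:0 :* z :+ a₁) :+ a₂ :* z) :+ h :* (u :* (:0 :* (:0 :* a₀) :+ a₂ :* a₀) :+ a₃ :* (:0 :* a₀)) :+ :- e
          := g :* (a₂ :* z) :+ h :* (u :* (a₂ :* a₀)) :+ :- e) refl g h′ z u (a_ 0) (a_ 1) (a_ 2) (a_ 3) e₀)
      d₁₀ : D (probe z 1# 0# u) ≡ κ + β
      d₁₀ = trans (eq z 1# 0# u) (solve 9 (λ g h z u a₀ a₁ a₂ a₃ e →
        g :* (:0 :* (:1 :* z :+ a₁) :+ a₂ :* z) :+ h :* (u :* (:0 :* (:1 :* a₀) :+ a₂ :* a₀) :+ a₃ :* (:1 :* a₀)) :+ :- e
          := g :* (a₂ :* z) :+ h :* (u :* (a₂ :* a₀)) :+ :- e :+ h :* (a₃ :* a₀)) refl g h′ z u (a_ 0) (a_ 1) (a_ 2) (a_ 3) e₀)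
      d₀₁ : D (probe z 0# 1# u) ≡ κ + α
      d₀₁ = trans (eq z 0# 1# u) (solve 9 (λ g h z u a₀ a₁ a₂ a₃ e →
        g :* (:1 :* (:0 :* z :+ a₁) :+ a₂ :* z) :+ h :* (u :* (:1 :* (:0 :* a₀) :+ a₂ :* a₀) :+ a₃ :* (:0 :* a₀)) :+ :- e
          := g :* (a₂ :* z) :+ h :* (u :* (a₂ :* a₀)) :+ :- e :+ g :* a₁) refl g h′ z u (a_ 0) (a_ 1) (a_ 2) (a_ 3) e₀)
      d₁₁ : D (probe z 1# 1# u) ≡ κ + α + β
      d₁₁ = trans (eq z 1# 1# u) (trans (solve 9 (λ g h z u a₀ a₁ a₂ a₃ e →
        g :* (:1 :* (:1 :* z :+ a₁) :+ a₂ :* z) :+ h :* (u :* (:1 :* (:1 :* a₀) :+ a₂ :* a₀) :+ a₃ :* (:1 :* a₀)) :+ :- e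
          := g :* (a₂ :* z) :+ h :* (u :* (a₂ :* a₀)) :+ :- e :+ g :* a₁ :+ h :* (a₃ :* a₀) :+ (g :* z :+ h :* u :* a₀))
            refl g h′ z u (a_ 0) (a_ 1) (a_ 2) (a_ 3) e₀)
        (trans (cong (κ + α + β +_) kill) (+-identityʳ _)))

  -- Comparison of the norm relation with the trace relation

  module _ {p₀ p₁ q₀ q₁ c : K} (det≢0 : p₀ * q₁ + - (p₁ * q₀) ≢ 0#) (c≢0 : c ≢ 0#)
           (norms : ∀ x → x ≢ 0# → N (q₀ * x + q₁ * A x) ≡ c * N (p₀ * x + p₁ * A x)) where

    private
      conjugate : K → ℕ → K
      conjugate x i = φ i x

      P Q G : (ℕ → K) → K
      P = product (conjugate p₀) (conjugate p₁)
      Q = product (conjugate q₀) (conjugate q₁)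
      G v = 1# * Q v + - (c * P v)

      G-MultiAffine : MultiAffine n G
      G-MultiAffine = linearCombination-MultiAffine 1# c (product-MultiAffine _ _) (product-MultiAffine _ _)

      product-N : ∀ r₀ r₁ μ → product (conjugate r₀) (conjugate r₁) (conjugate μ) ≡ N (r₀ + r₁ * μ)
      product-N r₀ r₁ μ = trans (∏<-cong n (λ i → sym (trans (φ-+ i r₀ (r₁ * μ)) (cong (φ i r₀ +_) (φ-* i r₁ μ))))) (sym (N≡∏ (r₀ + r₁ * μ)))

      G-conjugate : ∀ μ → G (conjugate μ) ≡ N (q₀ + q₁ * μ) + - (c * N (p₀ + p₁ * μ))
      G-conjugate μ = trans (cong (_+ - (c * P (conjugate μ))) (*-identityˡ _)) (cong₂ (λ x y → x + - (c * y)) (product-N q₀ q₁ μ) (product-N p₀ p₁ μ))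

      G-vanishes : ∀ {x μ} → x ≢ 0# → A x ≡ μ * x → G (conjugate μ) ≡ 0#
      G-vanishes {x} {μ} x≢0 e = trans (G-conjugate μ) (*≡0 (N-≢0 x≢0) (begin
        N x * (N (q₀ + q₁ * μ) + - (c * N (p₀ + p₁ * μ)))  ≡⟨ solve 4 (λ x a c b → x :* (a :+ :- (c :* b)) := x :* a :+ :- (c :* (x :* b))) refl _ _ c _ ⟩
        N x * N (q₀ + q₁ * μ) + - (c * (N x * N (p₀ + p₁ * μ)))  ≡⟨ cong₂ (λ y z → y + - (c * z)) (homogenise q₀ q₁) (homogenise p₀ p₁) ⟩
        N (q₀ * x + q₁ * A x) + - (c * N (p₀ * x + p₁ * A x))  ≡⟨ cong (_+ - (c * N (p₀ * x + p₁ * A x))) (norms x x≢0) ⟩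
        c * N (p₀ * x + p₁ * A x) + - (c * N (p₀ * x + p₁ * A x))  ≡⟨ -‿inverseʳ _ ⟩
        0#  ∎))
        where
        open ≡-Reasoning
        homogenise : ∀ r₀ r₁ → N x * N (r₀ + r₁ * μ) ≡ N (r₀ * x + r₁ * A x)
        homogenise r₀ r₁ = trans (sym (N-* x _)) (cong N (trans (solve 4 (λ x a b μ → x :* (a :+ b :* μ) := a :* x :+ b :* (μ :* x)) refl x r₀ r₁ μ)
          (cong (λ y → r₀ * x + r₁ * y) (sym e))))

      N-≡0 : ∀ {x} → N x ≡ 0# → x ≡ 0#
      N-≡0 {x} e with x ≟ 0#
      ... | yes z = z
      ... | no nz = ⊥-elim (N-≢0 nz e)

      root : K → K → K
      root r₀ r₁ = - (r₀ * inv r₁)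

      root-vanishes : ∀ {r₀ r₁} → r₁ ≢ 0# → r₀ + r₁ * root r₀ r₁ ≡ 0#
      root-vanishes {r₀} {r₁} r₁≢0 = trans (solve 3 (λ a b i → a :+ b :* (:- (a :* i)) := a :+ :- (a :* (b :* i))) refl r₀ r₁ (inv r₁))
        (trans (cong (λ x → r₀ + - (r₀ * x)) (inv-inverseʳ r₁≢0)) (solve 1 (λ a → a :+ :- (a :* :1) := :0) refl r₀))

      det-zero : ∀ {μ} → p₀ + p₁ * μ ≡ 0# → q₀ + q₁ * μ ≡ 0# → ⊥
      det-zero {μ} e e′ = det≢0 (trans (solve 5 (λ a b c d μ → a :* d :+ :- (b :* c) := d :* (a :+ b :* μ) :+ :- (b :* (c :+ d :* μ))) refl p₀ p₁ q₀ q₁ μ)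
        (trans (cong₂ (λ x y → q₁ * x + - (p₁ * y)) e e′) (solve 2 (λ a b → a :* :0 :+ :- (b :* :0) := :0) refl q₁ p₁)))

      p₁≢0 : q₁ ≡ 0# → p₁ ≢ 0#
      p₁≢0 refl refl = det≢0 (solve 2 (λ a b → a :* :0 :+ :- (:0 :* b) := :0) refl p₀ q₀)

      -- Otherwise the norms of the two linear polynomials in μ would be proportional for every μ in
      -- K; a root of one would be a root of the other, against the determinant.
      G-nonzero : ¬ (∀ v → G v ≡ 0#)
      G-nonzero G≡0 = cases (q₁ ≟ 0#)
        where
        balance : ∀ μ → N (q₀ + q₁ * μ) ≡ c * N (p₀ + p₁ * μ)
        balance μ = x-y≡0⇒x≡y (trans (sym (G-conjugate μ)) (G≡0 _))
        N-0 : N 0# ≡ 0#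
        N-0 = pow-0 0<geom-n
        cases : Dec (q₁ ≡ 0#) → ⊥
        cases (no q₁≢0)  = det-zero (N-≡0 (*≡0 c≢0 (trans (sym (balance _)) (trans (cong N (root-vanishes q₁≢0)) N-0)))) (root-vanishes q₁≢0)
        cases (yes q₁≡0) = det-zero (root-vanishes (p₁≢0 q₁≡0))
          (N-≡0 (trans (balance _) (trans (cong (c *_) (trans (cong N (root-vanishes (p₁≢0 q₁≡0))) N-0)) (zeroʳ c))))

      factor-vanishes : ∀ {r₀ r₁ v} → r₁ ≢ 0# → v 0 ≡ root r₀ r₁ → product (conjugate r₀) (conjugate r₁) v ≡ 0#
      factor-vanishes {r₀} {r₁} {v} r₁≢0 e = ∏<-zero n 0<n (trans (cong₂ (λ x y → x + y * v 0) (φ-zero r₀) (φ-zero r₁))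
        (trans (cong (λ x → r₀ + r₁ * x) e) (root-vanishes r₁≢0)))

      -- The factor of index 0 is r₀ + r₁ v₀, without Frobenius, so v₀ = -r₀ / r₁ kills its whole
      -- product. At least one of q₁ and p₁ is nonzero, by the determinant.
      G-splits : ∃ λ z → ∃ λ e → ∃ λ α → ∃ λ β → ∀ v → v 0 ≡ z → G v ≡ e * product α β v
      G-splits with q₁ ≟ 0#
      ... | no q₁≢0  = root q₀ q₁ , - c , conjugate p₀ , conjugate p₁ , λ v e →
            trans (cong (λ x → 1# * x + - (c * P v)) (factor-vanishes q₁≢0 e)) (solve 2 (λ c p → :1 :* :0 :+ :- (c :* p) := :- c :* p) refl c (P v))
      ... | yes q₁≡0 = root p₀ p₁ , 1# , conjugate q₀ , conjugate q₁ , λ v e →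
            trans (cong (λ x → 1# * Q v + - (c * x)) (factor-vanishes (p₁≢0 q₁≡0) e)) (solve 2 (λ c p → :1 :* p :+ :- (c :* :0) := :1 :* p) refl c (Q v))

      topG topD : K
      topG = topCoeff n G
      topD = topCoeff n D′

      -- A vanishing top coefficient would lower the degree of `G` below the number of its roots,
      -- making `G` zero everywhere.
      topG≢0 : topG ≢ 0#
      topG≢0 e = G-nonzero (vanishing-on-eigenvalues G-MultiAffine e G-vanishes)

      D′≡D : ∀ w → D′ (w ∘ π⁻¹) ≡ D w
      D′≡D w = cong₂ (λ y z → proj₁ y + proj₂ z + - (1# + - N a)) (reorder (1# , 0#)) (reorder (0# , 1#))
        where
        reorder : ∀ y → state (λ j → w (π⁻¹ (π j))) y n ≡ state w y n
        reorder y = state-ext y n (λ j j<n → cong w (π⁻¹∘π j<n))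

      -- Cross-multiplying by the top coefficients cancels the top term of the difference, which
      -- still vanishes at all eigenvalues and hence identically.
      proportional : ∀ v → topD * G v ≡ topG * D′ v
      proportional v = x-y≡0⇒x≡y (vanishing-on-eigenvalues (linearCombination-MultiAffine topD topG G-MultiAffine D′-MultiAffine)
        (trans (topCoeff-linear n topD topG G D′) (trans (cong (_+ - (topG * topD)) (*-comm topD topG)) (-‿inverseʳ _)))
        (λ x≢0 e → trans (cong₂ (λ y z → topD * y + - (topG * z)) (G-vanishes x≢0 e) (D′-vanishes x≢0 e))
          (solve 2 (λ a b → a :* :0 :+ :- (b :* :0) := :0) refl topD topG)) v)

      probe-rank-one : ∀ α β z u j → (α + β * probe z 0# 0# u j) * (α + β * probe z 1# 1# u j) ≡ (α + β * probe z 1# 0# u j) * (α + β * probe z 0# 1# u j)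
      probe-rank-one α β z u 0 = refl
      probe-rank-one α β z u 1 = *-comm _ _
      probe-rank-one α β z u 2 = refl
      probe-rank-one α β z u 3 = refl
      probe-rank-one α β z u (suc (suc (suc (suc j)))) = refl

      -- Reordering leaves index 0 in place, so the value prescribed for v₀ is the first entry of
      -- `probe`.
      π⁻¹-0 : π⁻¹ 0 ≡ 0
      π⁻¹-0 = m<n⇒m%n≡m {{>-nonZero 0<n}} 0<n

    norms-not-proportional : ⊥
    norms-not-proportional = from G-splits
      where
      from : (∃ λ z → ∃ λ e → ∃ λ α → ∃ λ β → ∀ v → v 0 ≡ z → G v ≡ e * product α β v) → ⊥
      from (z , e , α , β , splits) = contradict (D-not-rank-one z)
        where
        contradict : (∃ λ u → D (probe z 0# 0# u) * D (probe z 1# 1# u) ≢ D (probe z 1# 0# u) * D (probe z 0# 1# u)) → ⊥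
        contradict (u , ne) = ne (*-cancelˡ (*-≢0 topG≢0 topG≢0) (begin
          topG * topG * (D w₀₀ * D w₁₁)  ≡⟨ regroup topG (D w₀₀) (D w₁₁) ⟩
          topG * D w₀₀ * (topG * D w₁₁)  ≡⟨ cong₂ _*_ (D≡G 0# 0#) (D≡G 1# 1#) ⟩
          κ * product α β (w₀₀ ∘ π⁻¹) * (κ * product α β (w₁₁ ∘ π⁻¹)) ≡⟨ sym (regroup κ _ _) ⟩
          κ * κ * (product α β (w₀₀ ∘ π⁻¹) * product α β (w₁₁ ∘ π⁻¹)) ≡⟨ cong (κ * κ *_) (∏<-rank-one n (λ i → probe-rank-one (α i) (β i) z u (π⁻¹ i))) ⟩
          κ * κ * (product α β (w₁₀ ∘ π⁻¹) * product α β (w₀₁ ∘ π⁻¹)) ≡⟨ regroup κ _ _ ⟩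
          κ * product α β (w₁₀ ∘ π⁻¹) * (κ * product α β (w₀₁ ∘ π⁻¹)) ≡⟨ cong₂ _*_ (sym (D≡G 1# 0#)) (sym (D≡G 0# 1#)) ⟩
          topG * D w₁₀ * (topG * D w₀₁)  ≡⟨ sym (regroup topG (D w₁₀) (D w₀₁)) ⟩
          topG * topG * (D w₁₀ * D w₀₁)  ∎))
          where
          open ≡-Reasoning
          w₀₀ = probe z 0# 0# u
          w₁₀ = probe z 1# 0# u
          w₀₁ = probe z 0# 1# u
          w₁₁ = probe z 1# 1# u
          κ = topD * e
          regroup : ∀ k x y → k * k * (x * y) ≡ k * x * (k * y)
          regroup = solve 3 (λ k x y → k :* k :* (x :* y) := k :* x :* (k :* y)) refl
          D≡G : ∀ y x → topG * D (probe z y x u) ≡ κ * product α β (probe z y x u ∘ π⁻¹)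
          D≡G y x = begin
            topG * D (probe z y x u)  ≡⟨ cong (topG *_) (sym (D′≡D (probe z y x u))) ⟩
            topG * D′ (probe z y x u ∘ π⁻¹)  ≡⟨ sym (proportional (probe z y x u ∘ π⁻¹)) ⟩
            topD * G (probe z y x u ∘ π⁻¹)  ≡⟨ cong (topD *_) (splits (probe z y x u ∘ π⁻¹) (cong (probe z y x u) π⁻¹-0)) ⟩
            topD * (e * product α β (probe z y x u ∘ π⁻¹)) ≡⟨ sym (*-assoc topD e _) ⟩
            κ * product α β (probe z y x u ∘ π⁻¹)  ∎

-- The lines X₁ = X₂ = 0 and X₀ = X₃ = 0

module CoordinateLines {q n : ℕ} (F : FieldOfOrder q n) (S : Setting F) (ξ : FieldOfOrder.K F) (ξ≢0 : ξ ≢ FieldOfOrder.0# F) where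
  open Setting S
  open FiniteField F
  open Vectors F
  open Galois F {k = k} prime q≡p^ 0<n
  open Operator F S
  open Weights F S ξ ξ≢0
  open LinearSet f

  -- The common form of the two lines: in suitable coordinates the vectors of U on the line are (x,
  -- η · A x), with η = ξ on one line and η = 1 on the other.
  record Coordinates (ℓ : Line) : Set where
    field
      embed           : K → K → V4
      embed-injective : ∀ {x y x′ y′} → embed x y ≡ embed x′ y′ → x ≡ x′ × y ≡ y′
      embed-zero      : embed 0# 0# ≡ zeroV
      embed-linear    : ∀ c d x y x′ y′ → c ∙ embed x y ⊕ d ∙ embed x′ y′ ≡ embed (c * x + d * x′) (c * y + d * y′)
      ℓ-basis         : ℓ ≡ (embed 1# 0# , embed 0# 1#)
      η               : K
      η≢0             : η ≢ 0#
      graph⊆U         : ∀ x → T (inU (embed x (η * A x)))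
      U⊆graph         : ∀ x y {c d} → f x y ≡ embed c d → embed c (η * A c) ≡ f x y

    combination : ∀ c d → c ∙ embed 1# 0# ⊕ d ∙ embed 0# 1# ≡ embed c d
    combination c d = trans (embed-linear c d 1# 0# 0# 1#) (cong₂ embed
      (solve 2 (λ c d → c :* :1 :+ d :* :0 := c) refl c d) (solve 2 (λ c d → c :* :0 :+ d :* :1 := d) refl c d))

    on-intro : ∀ c d → T (onLine ℓ (embed c d))
    on-intro c d = subst (λ m → T (onLine m (embed c d))) (sym ℓ-basis) (inSpan2-intro c d (combination c d))

    on-elim : ∀ {u} → T (onLine ℓ u) → ∃ λ c → ∃ λ d → u ≡ embed c d
    on-elim {u} h = let (c , d , e) = inSpan2-elim {embed 1# 0#} {embed 0# 1#} {u} (subst (λ m → T (onLine m u)) ℓ-basis h)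
                    in c , d , trans (sym e) (combination c d)

    embed-≡0 : ∀ {c d} → embed c d ≡ zeroV → c ≡ 0# × d ≡ 0#
    embed-≡0 e = embed-injective (trans e (sym embed-zero))

    isLong : LongLine ℓ
    isLong = subst IsLine (sym ℓ-basis) (λ c d e → embed-≡0 (trans (sym (combination c d)) e)) ,
      lineWeight-n ℓ (λ x → embed x (η * A x)) graph⊆U (λ x → on-intro x (η * A x)) (λ c d e → proj₁ (embed-injective e))
        (λ x y h → onto x y (on-elim {f x y} h))
      where
      onto : ∀ x y → (∃ λ c → ∃ λ d → f x y ≡ embed c d) → ∃ λ c → embed c (η * A c) ≡ f x y
      onto x y (c , d , e) = c , U⊆graph x y e

    det≢0 : ∀ {w₀ w₁ v₀ v₁} → Indep (embed w₀ w₁) (embed v₀ v₁) → w₀ * v₁ + - (w₁ * v₀) ≢ 0#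
    det≢0 {w₀} {w₁} {v₀} {v₁} indep e = 1≢0 (proj₁ (indep 1# 0# (trans (embed-linear 1# 0# w₀ w₁ v₀ v₁)
        (trans (cong₂ embed (vanish w₀≡0) (vanish w₁≡0)) embed-zero))))
      where
      vanish : ∀ {x y} → x ≡ 0# → 1# * x + 0# * y ≡ 0#
      vanish {y = y} refl = solve 1 (λ y → :1 :* :0 :+ :0 :* y := :0) refl y
      -- The combinations of w and v with coefficients (v₁, −w₁) and (v₀, −w₀) vanish.
      w₁≡0 : w₁ ≡ 0#
      w₁≡0 = trans (sym (-‿involutive w₁)) (trans (cong -_ (proj₂ (indep v₁ (- w₁) (trans (embed-linear v₁ (- w₁) w₀ w₁ v₀ v₁)
        (trans (cong₂ embed (trans (solve 4 (λ w₀ w₁ v₀ v₁ → v₁ :* w₀ :+ :- w₁ :* v₀ := w₀ :* v₁ :+ :- (w₁ :* v₀)) refl w₀ w₁ v₀ v₁) e)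
                            (solve 2 (λ w v → v :* w :+ :- w :* v := :0) refl w₁ v₁)) embed-zero))))) -0#≈0#)
      w₀≡0 : w₀ ≡ 0#
      w₀≡0 = trans (sym (-‿involutive w₀)) (trans (cong -_ (proj₂ (indep v₀ (- w₀) (trans (embed-linear v₀ (- w₀) w₀ w₁ v₀ v₁)
        (trans (cong₂ embed (solve 2 (λ w v → v :* w :+ :- w :* v := :0) refl w₀ v₀)
                            (trans (solve 4 (λ w₀ w₁ v₀ v₁ → v₀ :* w₁ :+ :- w₀ :* v₁ := :- (w₀ :* v₁ :+ :- (w₁ :* v₀))) refl w₀ w₁ v₀ v₁) (trans (cong -_ e) -0#≈0#)))
          embed-zero))))) -0#≈0#)

  -- Multiplicativity gives N (τ x) = τ (N x), and N x lies in the fixed field of τ.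
  N-automorphism : ∀ {τ} → IsAutFixingFq τ → ∀ x → N (τ x) ≡ N x
  N-automorphism {τ} (_ , τ-* , τ-1 , _ , τ-fixed) x = trans (sym (τ-pow (geom n))) (proj₂ (τ-fixed (N x)) (N∈Fq x))
    where
    τ-pow : ∀ i → τ (pow x i) ≡ pow (τ x) i
    τ-pow zero    = τ-1
    τ-pow (suc i) = trans (τ-* x (pow x i)) (cong (τ x *_) (τ-pow i))

  module _ (a≢0 : a ≢ 0#) (Na≢-1 : N a ≢ - 1#) (3<n : 3 < n) {ℓ : Line} (coords : Coordinates ℓ) where
    open Coordinates coords

    private
      OnPseudoregulus : (w₀ w₁ v₀ v₁ ρ : K) (τ : K → K) → Set
      OnPseudoregulus w₀ w₁ v₀ v₁ ρ τ = ∀ x → x ≢ 0# → ∃ λ l → ∃ λ μ →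
        x ≡ μ * (l * w₀ + ρ * τ l * v₀) × η * A x ≡ μ * (l * w₁ + ρ * τ l * v₁)

      -- Both coordinates with respect to w and v have the same norm, up to N ρ.
      excluded : ∀ {w₀ w₁ v₀ v₁ ρ τ} → w₀ * v₁ + - (w₁ * v₀) ≢ 0# → ρ ≢ 0# → IsAutFixingFq τ → ¬ OnPseudoregulus w₀ w₁ v₀ v₁ ρ τ
      excluded {w₀} {w₁} {v₀} {v₁} {ρ} {τ} D≢0 ρ≢0 aut points =
        NotPseudoregulus.norms-not-proportional F S a≢0 Na≢-1 3<n {p₀ = v₁} {p₁ = - (v₀ * η)} {q₀ = - w₁} {q₁ = w₀ * η} {c = N ρ}
          (λ e → *-≢0 η≢0 D≢0 (trans (solve 5 (λ η w₀ w₁ v₀ v₁ → η :* (w₀ :* v₁ :+ :- (w₁ :* v₀)) := v₁ :* (w₀ :* η) :+ :- (:- (v₀ :* η) :* :- w₁)) refl η w₀ w₁ v₀ v₁) e))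
          (N-≢0 ρ≢0) (λ x x≢0 → norms x (points x x≢0))
        where
        open ≡-Reasoning
        D = w₀ * v₁ + - (w₁ * v₀)
        norms : ∀ x → (∃ λ l → ∃ λ μ → x ≡ μ * (l * w₀ + ρ * τ l * v₀) × η * A x ≡ μ * (l * w₁ + ρ * τ l * v₁)) →
                N (- w₁ * x + w₀ * η * A x) ≡ N ρ * N (v₁ * x + - (v₀ * η) * A x)
        -- By Cramer's rule the two forms recover the coefficients of v and w, each multiplied by μ
        -- D: the first is ρ · τ l · μ D, the second l · μ D.
        norms x (l , μ , e , e′) = begin
          N (- w₁ * x + w₀ * η * A x)  ≡⟨ cong N (trans (solve 5 (λ w₁ x w₀ η y → :- w₁ :* x :+ w₀ :* η :* y := w₀ :* (η :* y) :+ :- (w₁ :* x)) refl w₁ x w₀ η (A x))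
                    (trans (cong₂ (λ y z → w₀ * z + - (w₁ * y)) e e′)
                    (solve 8 (λ w₀ w₁ v₀ v₁ ρ τl l μ → w₀ :* (μ :* (l :* w₁ :+ ρ :* τl :* v₁)) :+ :- (w₁ :* (μ :* (l :* w₀ :+ ρ :* τl :* v₀)))
                    := ρ :* (τl :* (μ :* (w₀ :* v₁ :+ :- (w₁ :* v₀))))) refl w₀ w₁ v₀ v₁ ρ (τ l) l μ))) ⟩
          N (ρ * (τ l * (μ * D)))  ≡⟨ trans (N-* _ _) (cong (N ρ *_) (N-* _ _)) ⟩
          N ρ * (N (τ l) * N (μ * D))  ≡⟨ cong (λ y → N ρ * (y * N (μ * D))) (N-automorphism aut l) ⟩
          N ρ * (N l * N (μ * D))  ≡⟨ cong (N ρ *_) (sym (N-* _ _)) ⟩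
          N ρ * N (l * (μ * D))  ≡⟨ cong (λ y → N ρ * N y) (sym (trans (solve 5 (λ v₁ x v₀ η y → v₁ :* x :+ :- (v₀ :* η) :* y := v₁ :* x :+ :- (v₀ :* (η :* y))) refl v₁ x v₀ η (A x))
                    (trans (cong₂ (λ y z → v₁ * y + - (v₀ * z)) e e′)
                    (solve 8 (λ w₀ w₁ v₀ v₁ ρ τl l μ → v₁ :* (μ :* (l :* w₀ :+ ρ :* τl :* v₀)) :+ :- (v₀ :* (μ :* (l :* w₁ :+ ρ :* τl :* v₁)))
                    := l :* (μ :* (w₀ :* v₁ :+ :- (w₁ :* v₀)))) refl w₀ w₁ v₀ v₁ ρ (τ l) l μ)))) ⟩
          N ρ * N (v₁ * x + - (v₀ * η) * A x)  ∎

      graph-point : ∀ x → x ≢ 0# → T (inL (embed x (η * A x)))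
      graph-point x x≢0 = from (inU-elim {embed x (η * A x)} (graph⊆U x))
        where
        nonzero : embed x (η * A x) ≢ zeroV
        nonzero e = x≢0 (proj₁ (embed-≡0 e))
        from : (∃ λ y → ∃ λ z → f y z ≡ embed x (η * A x)) → T (inL (embed x (η * A x)))
        from (y , z , e) = subst (T ∘ inL) e (inL-f (λ e′ → nonzero (trans (sym e) e′)))

      embed-scaled : ∀ μ c d w₀ w₁ v₀ v₁ → scale μ (c ∙ embed w₀ w₁ ⊕ d ∙ embed v₀ v₁) ≡ embed (μ * (c * w₀ + d * v₀)) (μ * (c * w₁ + d * v₁))
      embed-scaled μ c d w₀ w₁ v₀ v₁ = begin
        scale μ (c ∙ embed w₀ w₁ ⊕ d ∙ embed v₀ v₁)  ≡⟨ cong (scale μ) (embed-linear c d w₀ w₁ v₀ v₁) ⟩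
        scale μ (embed x y)  ≡⟨ V-pad (embed x y) ⟩
        μ ∙ embed x y ⊕ 0# ∙ embed x y  ≡⟨ embed-linear μ 0# x y x y ⟩
        embed (μ * x + 0# * x) (μ * y + 0# * y)  ≡⟨ cong₂ embed (sym (pad x)) (sym (pad y)) ⟩
        embed (μ * x) (μ * y)  ∎
        where
        open ≡-Reasoning
        x = c * w₀ + d * v₀
        y = c * w₁ + d * v₁
        pad : ∀ x → μ * x ≡ μ * x + 0# * x
        pad x = solve 2 (λ μ x → μ :* x := μ :* x :+ :0 :* x) refl μ x
        V-pad : ∀ u → scale μ u ≡ μ ∙ u ⊕ 0# ∙ u
        V-pad (v4 _ _ _ _) = v4-cong (pad _) (pad _) (pad _) (pad _)

    notPseudoregulus : ¬ LineOfPseudoregulusType ℓ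
    notPseudoregulus (w , v , ρ , τ , w∈ , v∈ , indep , ρ≢0 , aut , iff) = from (on-elim {w} w∈) (on-elim {v} v∈)
      where
      from : (∃ λ c → ∃ λ d → w ≡ embed c d) → (∃ λ c → ∃ λ d → v ≡ embed c d) → ⊥
      from (w₀ , w₁ , refl) (v₀ , v₁ , refl) = excluded (det≢0 indep) ρ≢0 aut points
        where
        extract : ∀ x → (∃ λ l → l ≢ 0# × SamePoint (embed x (η * A x)) (l ∙ embed w₀ w₁ ⊕ (ρ * τ l) ∙ embed v₀ v₁)) →
                  ∃ λ l → ∃ λ μ → x ≡ μ * (l * w₀ + ρ * τ l * v₀) × η * A x ≡ μ * (l * w₁ + ρ * τ l * v₁)
        extract x (l , _ , μ , _ , e) = l , μ , embed-injective (trans e (embed-scaled μ l (ρ * τ l) w₀ w₁ v₀ v₁))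
        points : OnPseudoregulus w₀ w₁ v₀ v₁ ρ τ
        points x x≢0 = extract x (proj₁ (iff (embed x (η * A x)) (on-intro x (η * A x))
          (isZeroV-intro (λ e → x≢0 (proj₁ (embed-≡0 e))))) (graph-point x x≢0))

  line₀₃ : Coordinates (e0 , e3)
  line₀₃ = record
    { embed = λ x y → v4 x 0# 0# y
    ; embed-injective = λ e → cong V4.c0 e , cong V4.c3 e
    ; embed-zero = refl
    ; embed-linear = λ c d x y x′ y′ → v4-cong refl (zeros c d) (zeros c d) refl
    ; ℓ-basis = refl
    ; η = ξ
    ; η≢0 = ξ≢0
    ; graph⊆U = λ x → inU-intro x 0# (v4-cong refl refl A-0 refl)
    ; U⊆graph = λ x y e → v4-cong (sym (cong V4.c0 e)) (sym (cong V4.c1 e)) (sym (cong V4.c2 e)) (cong (λ z → ξ * A z) (sym (cong V4.c0 e)))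
    }
    where
    zeros : ∀ c d → c * 0# + d * 0# ≡ 0#
    zeros c d = solve 2 (λ c d → c :* :0 :+ d :* :0 := :0) refl c d

  line₁₂ : Coordinates (e1 , e2)
  line₁₂ = record
    { embed = λ x y → v4 0# x y 0#
    ; embed-injective = λ e → cong V4.c1 e , cong V4.c2 e
    ; embed-zero = refl
    ; embed-linear = λ c d x y x′ y′ → v4-cong (zeros c d) refl refl (zeros c d)
    ; ℓ-basis = refl
    ; η = 1#
    ; η≢0 = 1≢0
    ; graph⊆U = λ x → inU-intro 0# x (v4-cong refl refl (sym (*-identityˡ _)) (trans (cong (ξ *_) A-0) (zeroʳ ξ)))
    ; U⊆graph = λ x y e → v4-cong (sym (cong V4.c0 e)) (sym (cong V4.c1 e)) (trans (*-identityˡ _) (cong A (sym (cong V4.c1 e)))) (sym (cong V4.c3 e))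
    }
    where
    zeros : ∀ c d → c * 0# + d * 0# ≡ 0#
    zeros c d = solve 2 (λ c d → c :* :0 :+ d :* :0 := :0) refl c d

-- Integer Frobenius exponents

[n∸1]*+ : ∀ {n} → 0 < n → ∀ j → (n ∸ 1) *ℕ j +ℕ j ≡ n *ℕ j
[n∸1]*+ {suc n} _ j = ℕₚ.+-comm (n *ℕ j) j

-- `frob` reads a negative exponent -j as (n - 1) j. The exponents used for r and n - r are
-- therefore inverse only modulo n, and their sum is recorded as a multiple of n.
record FrobeniusExponents {q n : ℕ} (F : FieldOfOrder q n) (r : ℤ) : Set where
  open Setup F
  field
    R R′ m   : ℕ
    coprime  : Coprime n R
    R+R′≡mn  : R +ℕ R′ ≡ m *ℕ n
    frob-r   : ∀ x → frob r x ≡ pow x (q ^ R)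
    frob-n-r : ∀ x → frob (Int.+ n Int.- r) x ≡ pow x (q ^ R′)

frobeniusExponents : ∀ {q n} (F : FieldOfOrder q n) (r : ℤ) → 0 < n → gcd n ∣ r ∣ ≡ 1 → FrobeniusExponents F r
frobeniusExponents {q} {n} F (Int.+ k) 0<n gcd≡1 with k ℕ.≤? n
... | yes k≤n = record
  { R = k ; R′ = n ∸ k ; m = 1 ; coprime = gcd≡1⇒coprime gcd≡1
  ; R+R′≡mn  = trans (ℕₚ.m+[n∸m]≡n k≤n) (sym (ℕₚ.*-identityˡ n))
  ; frob-r   = λ _ → refl
  ; frob-n-r = λ x → cong (λ i → Setup.frob F i x) (trans (ℤₚ.m-n≡m⊖n n k) (ℤₚ.⊖-≥ k≤n)) }
-- Here n - r is negative, equal to -(j + 1), so its exponent is (n - 1)(j + 1).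
... | no k≰n = record
  { R = k ; R′ = (n ∸ 1) *ℕ suc j ; m = suc (suc j) ; coprime = gcd≡1⇒coprime gcd≡1
  ; R+R′≡mn  = begin
      k +ℕ (n ∸ 1) *ℕ suc j  ≡⟨ cong (_+ℕ (n ∸ 1) *ℕ suc j) k≡ ⟩
      n +ℕ suc j +ℕ (n ∸ 1) *ℕ suc j  ≡⟨ ℕₚ.+-assoc n (suc j) _ ⟩
      n +ℕ (suc j +ℕ (n ∸ 1) *ℕ suc j)  ≡⟨ cong (n +ℕ_) (trans (ℕₚ.+-comm (suc j) _) ([n∸1]*+ 0<n (suc j))) ⟩
      n +ℕ n *ℕ suc j  ≡⟨ cong (n +ℕ_) (ℕₚ.*-comm n (suc j)) ⟩
      suc (suc j) *ℕ n  ∎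
  ; frob-r   = λ _ → refl
  ; frob-n-r = λ x → cong (λ i → Setup.frob F i x) (trans (ℤₚ.m-n≡m⊖n n k) (trans (ℤₚ.⊖-< n<k) (cong (λ i → Int.- (Int.+ i)) k∸n≡))) }
  where
  open ≡-Reasoning
  n<k : n < k
  n<k = ℕₚ.≰⇒> k≰n
  j = k ∸ suc n
  k≡ : k ≡ n +ℕ suc j
  k≡ = trans (sym (ℕₚ.m+[n∸m]≡n n<k)) (sym (ℕₚ.+-suc n j))
  k∸n≡ : k ∸ n ≡ suc j
  k∸n≡ = trans (cong (_∸ n) k≡) (ℕₚ.m+n∸m≡n n (suc j))
frobeniusExponents {q} {n} F Int.-[1+ k ] 0<n gcd≡1 = record
  { R = (n ∸ 1) *ℕ suc k ; R′ = n +ℕ suc k ; m = suc (suc k)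
  -- A common divisor of n and (n - 1)(k + 1) divides n (k + 1), hence also the difference k + 1,
  -- which is the absolute value of r.
  ; coprime  = λ {d} (d∣n , d∣R) → gcd≡1⇒coprime gcd≡1 (d∣n ,
      ∣m+n∣m⇒∣n (subst (d ∣_) (sym ([n∸1]*+ 0<n (suc k))) (∣m⇒∣m*n (suc k) d∣n)) d∣R)
  ; R+R′≡mn  = begin
      (n ∸ 1) *ℕ suc k +ℕ (n +ℕ suc k)  ≡⟨ cong ((n ∸ 1) *ℕ suc k +ℕ_) (ℕₚ.+-comm n (suc k)) ⟩
      (n ∸ 1) *ℕ suc k +ℕ (suc k +ℕ n)  ≡⟨ sym (ℕₚ.+-assoc _ (suc k) n) ⟩
      (n ∸ 1) *ℕ suc k +ℕ suc k +ℕ n  ≡⟨ cong (_+ℕ n) (trans ([n∸1]*+ 0<n (suc k)) (ℕₚ.*-comm n (suc k))) ⟩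
      suc k *ℕ n +ℕ n  ≡⟨ ℕₚ.+-comm (suc k *ℕ n) n ⟩
      suc (suc k) *ℕ n  ∎
  ; frob-r   = λ _ → refl
  ; frob-n-r = λ _ → refl }
  where open ≡-Reasoning

theorem4p4 : (q n : ℕ) (F : FieldOfOrder q n) →
    let open Setup F in
    IsPrimePower q → q % 2 ≡ 1 →
    3 ≤ n → n % 2 ≡ 1 →
    (ξ : K) → InFq ξ → ¬ (Σ K λ y → InFq y × y * y ≡ ξ) →
    (r : ℤ) → gcd n ∣ r ∣ ≡ 1 →
    (a : K) → a ≢ 0# → N a ≢ 1# →
    let open DA ξ r a in
    (N a ≢ - 1# → n ≡ 3 → MaximumScattered × PseudoregulusType) ×
    (N a ≢ - 1# → 3 < n →
    MaximumScattered ×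
    LongLine (e0 , e3) × LongLine (e1 , e2) ×
    ¬ LineOfPseudoregulusType (e0 , e3) × ¬ LineOfPseudoregulusType (e1 , e2)) ×
    (N a ≡ - 1# →
    (∀ v w → T (inL v) → Weight v w → 1 < w → w ≡ 2) ×
    (Σ ℕ λ m → NumPoints heavy m × m *ℕ (q ∸ 1) ≡ q ^ (n ∸ 1) ∸ 1) ×
    (Σ ℕ λ m → NumPoints inL m × m *ℕ (q ∸ 1) ≡ (q ^ (2 *ℕ n) ∸ q ^ n) +ℕ (q ∸ 1)))
theorem4p4 q n F (p , k , p-prime , q≡p^) _ 3≤n n-odd ξ _ ξ-nonsquare r gcd≡1 a a≢0 _ =
  (λ Na≢-1 n≡3 → maximumScattered Na≢-1 , Pseudoregulus.pseudoregulusType F S ξ ξ≢0 Na≢-1 n≡3) ,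
  (λ Na≢-1 3<n → maximumScattered Na≢-1 ,
    Coordinates.isLong line₀₃ , Coordinates.isLong line₁₂ ,
    notPseudoregulus a≢0 Na≢-1 3<n line₀₃ , notPseudoregulus a≢0 Na≢-1 3<n line₁₂) ,
  (λ Na≡-1 → weight≡2 , HeavyPoints.#heavyPoints F S ξ ξ≢0 Na≡-1 , HeavyPoints.#points F S ξ ξ≢0 Na≡-1)
  where
  open FiniteField F hiding (ring)
  0<n : 0 < n
  0<n = ℕₚ.≤-trans (s≤s z≤n) 3≤n
  open FrobeniusExponents (frobeniusExponents F r 0<n gcd≡1)
  S : Setting F
  S = record
    { p = p ; k = k ; prime = p-prime ; q≡p^ = q≡p^ ; 0<n = 0<n
    ; h = n / 2 ; n≡1+2h = trans (m≡m%n+[m/n]*n n 2) (cong (_+ℕ (n / 2) *ℕ 2) n-odd)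
    ; R = R ; R′ = R′ ; m = m ; coprime = coprime ; R+R′≡mn = R+R′≡mn
    ; a = a ; A = DA.A ξ r a
    ; A-def = λ x → cong₂ (λ y z → y + - (a * z)) (frob-r x) (frob-n-r x) }
  ξ≢0 : ξ ≢ 0#
  -- Zero is the square of an element of F_q, so a non-square is nonzero.
  ξ≢0 ξ≡0 = ξ-nonsquare (0# , Galois.Fq-0 F {k = k} p-prime q≡p^ 0<n , trans (zeroˡ 0#) (sym ξ≡0))
  open Weights F S ξ ξ≢0
  open CoordinateLines F S ξ ξ≢0
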